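{- Let $1 \leq a \leq b \leq c$ be integers with $(a,b) \neq (1,2)$, and suppose $c \geq d = \max(4,ab)$. Then $\left|\mathcal{F}(K_{a,b,c})\right| = \left|\mathcal{F}(K_{a,b,d})\right|$.
   Context: All graphs are finite, undirected and simple, and are considered up to isomorphism. $K_{a,b,c}$ denotes the complete tripartite graph with parts of sizes $a,b,c$. A Triangle-Y ($\nabla Y$) move on a graph takes a 3-cycle with vertices $x,y,z$, deletes the edges $xy,yz,zx$, and adds a new vertex $v$ with edges $xv,yv,zv$. A Y-Triangle ($Y\nabla$) move is the inverse operation: for a vertex $v$ of degree three whose neighbours $x,y,z$ are pairwise non-adjacent, delete $v$ and add the edges $xy,yz,zx$. Two graphs are cousins if one is obtained from the other by a sequence of zero or more $\nabla Y$ and $Y\nabla$ moves. The family $\mathcal{F}(G)$ is the set of (isomorphism classes of) cousins of $G$, and $|\mathcal{F}(G)|$ is its size. -}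

module Defs where

open import Data.Nat using (ℕ; zero; suc; _+_; _<ᵇ_)
open import Data.Fin using (Fin; zero; suc; toℕ; punchIn; _≟_)
open import Data.Bool using (Bool; true; false; _∧_; _∨_; not; if_then_else_)
open import Data.Vec using (Vec; lookup)
open import Data.Product using (Σ; ∃; _×_; _,_)
open import Data.Sum using (_⊎_)
open import Relation.Binary.PropositionalEquality using (_≡_; _≢_)
open import Relation.Nullary.Decidable using (⌊_⌋)
open import Function.Bundles using (_↔_; Inverse)

record Graph : Set where
  constructor mkGraph
  field
    size : ℕ
    adj  : Fin size → Fin size → Bool
open Graph public

IsSimple : Graph → Set
IsSimple G = (∀ i j → adj G i j ≡ adj G j i) × (∀ i → adj G i i ≡ false)

_≅_ : Graph → Graph → Set
G ≅ H = Σ (Fin (size G) ↔ Fin (size H)) λ f →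
          ∀ i j → adj G i j ≡ adj H (Inverse.to f i) (Inverse.to f j)

_==_ : ∀ {n} → Fin n → Fin n → Bool
i == j = ⌊ i ≟ j ⌋

record Triangle (G : Graph) : Set where
  constructor triangle
  field
    x y z : Fin (size G)
    x≢y : x ≢ y
    y≢z : y ≢ z
    x≢z : x ≢ z
    xy : adj G x y ≡ true
    yz : adj G y z ≡ true
    xz : adj G x z ≡ true

-- The ∇Y move: delete the edges xy, yz, zx and add a new vertex v
-- (here the vertex `zero`; old vertex i becomes `suc i`) adjacent to x, y, z.
ΔY : (G : Graph) → Triangle G → Graph
ΔY G (triangle x y z _ _ _ _ _ _) = mkGraph (suc (size G)) A
  where
  inT : Fin (size G) → Bool
  inT i = (i == x) ∨ (i == y) ∨ (i == z)
  A : Fin (suc (size G)) → Fin (suc (size G)) → Bool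
  A zero    zero    = false
  A zero    (suc j) = inT j
  A (suc i) zero    = inT i
  A (suc i) (suc j) = adj G i j ∧ not (inT i ∧ inT j)

record YVertex (m : ℕ) (A : Fin (suc m) → Fin (suc m) → Bool) : Set where
  constructor yvertex
  field
    v x y z : Fin (suc m)
    x≢y : x ≢ y
    y≢z : y ≢ z
    x≢z : x ≢ z
    nbrs→ : ∀ w → A v w ≡ true → (w ≡ x ⊎ w ≡ y ⊎ w ≡ z)
    →nbrs : ∀ w → (w ≡ x ⊎ w ≡ y ⊎ w ≡ z) → A v w ≡ true
    xy : A x y ≡ false
    yz : A y z ≡ false
    xz : A x z ≡ false

-- The Y∇ move: delete v and add the edges xy, yz, zx.
-- Vertices of the result are Fin m, embedded in Fin (suc m) avoiding v
-- via punchIn v.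
YΔ : (m : ℕ) (A : Fin (suc m) → Fin (suc m) → Bool) → YVertex m A → Graph
YΔ m A (yvertex v _ _ _ _ _ _ _ _ _ _ _) = mkGraph m B
  where
  B : Fin m → Fin m → Bool
  B i j = A (punchIn v i) (punchIn v j)
          ∨ (A v (punchIn v i) ∧ A v (punchIn v j) ∧ not (i == j))

data Move : Graph → Graph → Set where
  ∇Y-move : (G : Graph) → IsSimple G → (t : Triangle G) → Move G (ΔY G t)
  Y∇-move : (m : ℕ) (A : Fin (suc m) → Fin (suc m) → Bool) →
            IsSimple (mkGraph (suc m) A) → (y : YVertex m A) →
            Move (mkGraph (suc m) A) (YΔ m A y)

data Cousin (G : Graph) : Graph → Set where
  start : ∀ {H} → G ≅ H → Cousin G H
  iso   : ∀ {H K} → Cousin G H → H ≅ K → Cousin G K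
  fwd   : ∀ {H K} → Cousin G H → Move H K → Cousin G K
  bwd   : ∀ {H K} → Cousin G H → Move K H → Cousin G K

FamilySize : Graph → ℕ → Set
FamilySize G k =
  Σ (Vec Graph k) λ reps →
    (∀ i → IsSimple (lookup reps i) × Cousin G (lookup reps i)) ×
    (∀ i j → lookup reps i ≅ lookup reps j → i ≡ j) ×
    (∀ H → Cousin G H → ∃ λ i → H ≅ lookup reps i)

part : (a b : ℕ) → ℕ → Fin 3
part a b i = if i <ᵇ a then zero else (if i <ᵇ (a + b) then suc zero else suc (suc zero))

K : ℕ → ℕ → ℕ → Graph
K a b c = mkGraph (a + b + c) λ i j → not (part a b (toℕ i) == part a b (toℕ j))

{-# OPTIONS --safe #-}
-- Call the vertices of the first two parts the base.  Every base vertex keeps at least c ≥ 4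
-- neighbours under all moves, so it is never removed by a Y∇ move.  If G belongs to the family of
-- K a b d, adding a vertex adjacent to exactly the base gives a member of the family of K a b (1 + d).
-- Conversely no new graphs appear: a triangle using an added vertex contains an edge of the base,
-- and as long as such an edge exists, one of the d ≥ ab vertices of the third part is still joined
-- to exactly the base and can play the role of the added vertex.  Added vertices can be cancelled
-- in isomorphisms respecting the base, and the base is recognised by its degrees, except in a few
-- cases where numerical invariants determine the graph.
--
-- If b ≥ 4, or a = b = 3, or a = b = 1, the members of the family are described by sets of
-- edge-disjoint triangles of K a b d; the only further move, for a = b = 3, removes a vertex of the
-- third part contained in three chosen triangles.  For (a , b) = (1 , 3), (2 , 2), (2 , 3), vertices
-- of the third part do become removable, and the 6, 10 and 97 members are listed explicitly.
module Submission where

open import Axiom.UniquenessOfIdentityProofs.WithK using (uip)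
open import Data.Bool using (Bool; true; false; _∧_; _∨_; not; if_then_else_)
import Data.Bool as Bool
open import Data.Bool.ListAction using (any; all)
import Data.Bool.Properties as Boolₚ
open import Data.Empty using (⊥; ⊥-elim)
open import Data.Fin using (Fin; zero; suc; toℕ; fromℕ<; _↑ˡ_; _↑ʳ_; splitAt; punchIn; punchOut; combine; remQuot; inject≤; finToFun; funToFin)
import Data.Fin as Fin
import Data.Fin.Permutation as Perm
import Data.Fin.Properties as Finₚ
open import Data.List using (List; []; _∷_; allFin; length)
open import Data.List.Membership.Propositional using (_∈_)
open import Data.List.Membership.Propositional.Properties using (∈-allFin)
open import Data.List.Relation.Unary.Any using (here; there)
open import Data.Nat using (ℕ; zero; suc; _+_; _*_; _^_; _∸_; _⊔_; _≤_; _<_; s≤s; z≤n; _<ᵇ_; _≤ᵇ_; _≡ᵇ_; _/_; _%_)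
import Data.Nat as ℕ
open import Data.Nat.Induction using (<-rec)
import Data.Nat.Properties as ℕₚ
open import Data.Nat.Solver using (module +-*-Solver)
open import Data.Product using (Σ; ∃; _×_; _,_; proj₁; proj₂)
open import Data.Product.Function.NonDependent.Propositional using (_×-↔_)
open import Data.Sum using (_⊎_; inj₁; inj₂; [_,_]′)
import Data.Sum as Sum
open import Data.Sum.Function.Propositional using (_⊎-↔_)
open import Data.Sum.Properties using (inj₁-injective; inj₂-injective)
open import Data.Unit using (⊤; tt)
open import Data.Vec using (Vec; []; _∷_; lookup)
import Data.Vec as Vec
import Data.Vec.Properties as Vecₚ
open import Defs
open import Function using (_∘_; id)
open import Function.Bundles using (_↔_; Inverse; mk↔ₛ′)
open import Function.Properties.Inverse using (↔-refl; ↔-sym; ↔-trans)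
open import Relation.Binary using (Tri; tri<; tri≈; tri>)
open import Relation.Binary.PropositionalEquality using (_≡_; _≢_; refl; sym; trans; cong; cong₂; subst; subst₂)
open import Relation.Nullary using (¬_; Dec; yes; no)
open import Relation.Nullary.Decidable using (⌊_⌋; _⊎-dec_; _×-dec_; _→-dec_; ¬?; map′)

-- The number `k` is defined without mentioning `c`: classes are counted among the graphs for `d`,
-- by base-preserving isomorphism, and this relation is shown to coincide with plain isomorphism of
-- the same graphs after `n` further vertices have been adjoined. The obstacle is that adjoining
-- depends on the base, while an isomorphism of the enlarged graphs knows nothing of it. So every
-- graph carries its base as data, and adjoined vertices are cancelled only once the isomorphism is
-- known to respect the base; where degrees do not show this, an invariant proves that both graphs
-- have the same normal form. Moves are a relation between graphs, because the vertex numbering that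
-- a move produces is rarely that of the listed graph isomorphic to its result. Only ∇Y occurs in
-- it; a Y∇ move is one read backwards. The pair (1 , 2) is left out because its base has three
-- vertices: once the edges of the base are gone, an adjoined vertex has degree three and
-- independent neighbours, so it could be removed. For all other pairs the base has two or at least
-- four vertices.

-- Graphs with a base and their isomorphisms

record BGraph : Set₁ where
  field
    V     : Set
    card  : ℕ
    enum  : V ↔ Fin card
    Adj   : V → V → Set
    adj?  : ∀ u v → Dec (Adj u v)
    symm  : ∀ {u v} → Adj u v → Adj v u
    irr   : ∀ {v} → ¬ Adj v v
    Base  : V → Set
    base? : ∀ v → Dec (Base v)

  index : V → Fin card
  index = Inverse.to enum

  vertex : Fin card → V
  vertex = Inverse.from enum

  vertex-index : ∀ v → vertex (index v) ≡ v
  vertex-index = Inverse.strictlyInverseʳ enum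

  index-vertex : ∀ i → index (vertex i) ≡ i
  index-vertex = Inverse.strictlyInverseˡ enum

  index-injective : ∀ {u v} → index u ≡ index v → u ≡ v
  index-injective {u} {v} p = trans (sym (vertex-index u)) (trans (cong vertex p) (vertex-index v))

  _≟ᵛ_ : (u v : V) → Dec (u ≡ v)
  u ≟ᵛ v = map′ index-injective (cong index) (index u Fin.≟ index v)

open BGraph public

record Iso (G H : BGraph) : Set where
  field
    to      : V G → V H
    from    : V H → V G
    to-from : ∀ v → to (from v) ≡ v
    from-to : ∀ u → from (to u) ≡ u
    pres    : ∀ {u v} → Adj G u v → Adj H (to u) (to v)
    reflects   : ∀ {u v} → Adj H (to u) (to v) → Adj G u v

  to-injective : ∀ {u v} → to u ≡ to v → u ≡ v
  to-injective {u} {v} p = trans (sym (from-to u)) (trans (cong from p) (from-to v))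

open Iso public

record BIso (G H : BGraph) : Set where
  field
    plain : Iso G H
    base→ : ∀ {u} → Base G u → Base H (to plain u)
    base← : ∀ {u} → Base H (to plain u) → Base G u

open BIso public

iso-refl : ∀ {G} → Iso G G
iso-refl = record { to = id ; from = id ; to-from = λ _ → refl ; from-to = λ _ → refl ; pres = id ; reflects = id }

iso-sym : ∀ {G H} → Iso G H → Iso H G
iso-sym {G} {H} f = record
  { to = from f ; from = to f ; to-from = from-to f ; from-to = to-from f
  ; pres = λ {u} {v} p → reflects f (subst₂ (Adj H) (sym (to-from f u)) (sym (to-from f v)) p)
  ; reflects = λ {u} {v} p → subst₂ (Adj H) (to-from f u) (to-from f v) (pres f p) }

iso-trans : ∀ {G H K} → Iso G H → Iso H K → Iso G K
iso-trans f g = record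
  { to = to g ∘ to f ; from = from f ∘ from g
  ; to-from = λ v → trans (cong (to g) (to-from f (from g v))) (to-from g v)
  ; from-to = λ u → trans (cong (from f) (from-to g (to f u))) (from-to f u)
  ; pres = pres g ∘ pres f ; reflects = reflects f ∘ reflects g }

biso-refl : ∀ {G} → BIso G G
biso-refl = record { plain = iso-refl ; base→ = id ; base← = id }

biso-sym : ∀ {G H} → BIso G H → BIso H G
biso-sym {G} {H} f = record
  { plain = iso-sym (plain f)
  ; base→ = λ {u} p → base← f (subst (Base H) (sym (to-from (plain f) u)) p)
  ; base← = λ {u} p → subst (Base H) (to-from (plain f) u) (base→ f p) }

biso-trans : ∀ {G H K} → BIso G H → BIso H K → BIso G K
biso-trans f g = record
  { plain = iso-trans (plain f) (plain g) ; base→ = base→ g ∘ base→ f ; base← = base← f ∘ base← g }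

-- Moves as relations between graphs

In : {A : Set} → A → A → A → A → Set
In x y z u = u ≡ x ⊎ u ≡ y ⊎ u ≡ z

in₁ : {A : Set} {x y z : A} → In x y z x
in₁ = inj₁ refl

in₂ : {A : Set} {x y z : A} → In x y z y
in₂ = inj₂ (inj₁ refl)

in₃ : {A : Set} {x y z : A} → In x y z z
in₃ = inj₂ (inj₂ refl)

In-map : {A B : Set} (f : A → B) {x y z u : A} → In x y z u → In (f x) (f y) (f z) (f u)
In-map f (inj₁ p) = inj₁ (cong f p)
In-map f (inj₂ (inj₁ p)) = inj₂ (inj₁ (cong f p))
In-map f (inj₂ (inj₂ p)) = inj₂ (inj₂ (cong f p))

In-unmap : {A B : Set} (f : A → B) → (∀ {u v} → f u ≡ f v → u ≡ v) →
  {x y z u : A} → In (f x) (f y) (f z) (f u) → In x y z u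
In-unmap f inj (inj₁ p) = inj₁ (inj p)
In-unmap f inj (inj₂ (inj₁ p)) = inj₂ (inj₁ (inj p))
In-unmap f inj (inj₂ (inj₂ p)) = inj₂ (inj₂ (inj p))

IsTriangle : (G : BGraph) → V G → V G → V G → Set
IsTriangle G x y z = Adj G x y × Adj G y z × Adj G x z

triangle-adj : ∀ G {x y z u v} → IsTriangle G x y z → In x y z u → In x y z v → u ≢ v → Adj G u v
triangle-adj G (p , q , r) (inj₁ refl) (inj₁ refl) n = ⊥-elim (n refl)
triangle-adj G (p , q , r) (inj₁ refl) (inj₂ (inj₁ refl)) n = p
triangle-adj G (p , q , r) (inj₁ refl) (inj₂ (inj₂ refl)) n = r
triangle-adj G (p , q , r) (inj₂ (inj₁ refl)) (inj₁ refl) n = symm G p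
triangle-adj G (p , q , r) (inj₂ (inj₁ refl)) (inj₂ (inj₁ refl)) n = ⊥-elim (n refl)
triangle-adj G (p , q , r) (inj₂ (inj₁ refl)) (inj₂ (inj₂ refl)) n = q
triangle-adj G (p , q , r) (inj₂ (inj₂ refl)) (inj₁ refl) n = symm G r
triangle-adj G (p , q , r) (inj₂ (inj₂ refl)) (inj₂ (inj₁ refl)) n = symm G q
triangle-adj G (p , q , r) (inj₂ (inj₂ refl)) (inj₂ (inj₂ refl)) n = ⊥-elim (n refl)

-- H arises from G by the ∇Y move at x, y, z with new vertex hub.
record Star (G H : BGraph) (x y z : V G) (hub : V H) : Set where
  field
    tri     : IsTriangle G x y z
    old     : V G → V H
    old-inj : ∀ {u v} → old u ≡ old v → u ≡ v
    old≢hub : ∀ {u} → old u ≢ hub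
    cover   : ∀ v → v ≡ hub ⊎ ∃ λ u → old u ≡ v
    hub→    : ∀ {u} → Adj H hub (old u) → In x y z u
    hub←    : ∀ {u} → In x y z u → Adj H hub (old u)
    old→    : ∀ {u v} → Adj H (old u) (old v) → Adj G u v × ¬ (In x y z u × In x y z v)
    old←    : ∀ {u v} → Adj G u v → ¬ (In x y z u × In x y z v) → Adj H (old u) (old v)

open Star public

record BStar (G H : BGraph) (x y z : V G) (hub : V H) : Set where
  field
    star      : Star G H x y z hub
    old-base→ : ∀ {u} → Base G u → Base H (old star u)
    old-base← : ∀ {u} → Base H (old star u) → Base G u
    hub-base  : ¬ Base H hub

open BStar public

-- Only one direction is built here. `star-iso` instantiates the module a second time with the
-- inverse isomorphism, which yields both the inverse map and the reflection of edges.
module StarIso {G G′ H H′ : BGraph} {x y z hub x′ y′ z′ hub′}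
  (φ : Iso G G′) (S : Star G H x y z hub) (S′ : Star G′ H′ x′ y′ z′ hub′)
  (f→ : ∀ {u} → In x y z u → In x′ y′ z′ (to φ u))
  (f← : ∀ {u} → In x′ y′ z′ (to φ u) → In x y z u) where

  fwdᵛ : V H → V H′
  fwdᵛ v with cover S v
  ... | inj₁ _ = hub′
  ... | inj₂ (u , _) = old S′ (to φ u)

  fwd-hub : fwdᵛ hub ≡ hub′
  fwd-hub with cover S hub
  ... | inj₁ _ = refl
  ... | inj₂ (u , p) = ⊥-elim (old≢hub S p)

  fwd-old : ∀ u → fwdᵛ (old S u) ≡ old S′ (to φ u)
  fwd-old u with cover S (old S u)
  ... | inj₁ p = ⊥-elim (old≢hub S p)
  ... | inj₂ (w , p) = cong (old S′ ∘ to φ) (old-inj S p)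

  fwd-pres : ∀ {u v} → Adj H u v → Adj H′ (fwdᵛ u) (fwdᵛ v)
  fwd-pres {u} {v} p with cover S u | cover S v
  ... | inj₁ refl | inj₁ refl = ⊥-elim (irr H p)
  ... | inj₁ refl | inj₂ (w , refl) = hub← S′ (f→ (hub→ S p))
  ... | inj₂ (w , refl) | inj₁ refl = symm H′ (hub← S′ (f→ (hub→ S (symm H p))))
  ... | inj₂ (w , refl) | inj₂ (w′ , refl) with old→ S p
  ... | q , n = old← S′ (pres φ q) (λ { (a , b) → n (f← a , f← b) })

star-iso : ∀ {G G′ H H′ x y z hub x′ y′ z′ hub′} (φ : Iso G G′) →
  Star G H x y z hub → Star G′ H′ x′ y′ z′ hub′ →
  (∀ {u} → In x y z u → In x′ y′ z′ (to φ u)) →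
  (∀ {u} → In x′ y′ z′ (to φ u) → In x y z u) → Iso H H′
star-iso {G} {G′} {H} {H′} {x} {y} {z} {hub} {x′} {y′} {z′} {hub′} φ S S′ f→ f← = record
  { to = A.fwdᵛ ; from = B.fwdᵛ
  ; to-from = to-from′ ; from-to = from-to′
  ; pres = A.fwd-pres
  ; reflects = λ {u} {v} p → subst₂ (Adj H) (from-to′ u) (from-to′ v) (B.fwd-pres p) }
  where
  module A = StarIso φ S S′ f→ f←
  g→ : ∀ {u} → In x′ y′ z′ u → In x y z (from φ u)
  g→ {u} i = f← (subst (In x′ y′ z′) (sym (to-from φ u)) i)
  g← : ∀ {u} → In x y z (from φ u) → In x′ y′ z′ u
  g← {u} i = subst (In x′ y′ z′) (to-from φ u) (f→ i)
  module B = StarIso (iso-sym φ) S′ S g→ g←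
  to-from′ : ∀ v → A.fwdᵛ (B.fwdᵛ v) ≡ v
  to-from′ v with cover S′ v
  ... | inj₁ refl = A.fwd-hub
  ... | inj₂ (u , refl) = trans (A.fwd-old (from φ u)) (cong (old S′) (to-from φ u))
  from-to′ : ∀ v → B.fwdᵛ (A.fwdᵛ v) ≡ v
  from-to′ v with cover S v
  ... | inj₁ refl = B.fwd-hub
  ... | inj₂ (u , refl) = trans (B.fwd-old (to φ u)) (cong (old S) (from-to φ u))

-- The three edges of the triangle are missing from `H`, so `φ` cannot transport them. They are
-- recovered from the hub: its neighbours go to the neighbours of the other hub, and those span a
-- triangle in `G′`.
module StarCoiso {G G′ H H′ : BGraph} {x y z hub x′ y′ z′ hub′}
  (φ : Iso H H′) (e : to φ hub ≡ hub′)
  (S : Star G H x y z hub) (S′ : Star G′ H′ x′ y′ z′ hub′) where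

  image : ∀ u → ∃ λ u′ → old S′ u′ ≡ to φ (old S u)
  image u with cover S′ (to φ (old S u))
  ... | inj₂ p = p
  ... | inj₁ p = ⊥-elim (old≢hub S (to-injective φ (trans p (sym e))))

  fwdᵛ : V G → V G′
  fwdᵛ u = proj₁ (image u)

  fwd-old : ∀ u → old S′ (fwdᵛ u) ≡ to φ (old S u)
  fwd-old u = proj₂ (image u)

  fwd-In : ∀ {u} → In x y z u → In x′ y′ z′ (fwdᵛ u)
  fwd-In {u} i = hub→ S′ (subst₂ (Adj H′) e (sym (fwd-old u)) (pres φ (hub← S i)))

  fwd-pres : ∀ {u v} → Adj G u v → Adj G′ (fwdᵛ u) (fwdᵛ v)
  fwd-pres {u} {v} p with in? u ×-dec in? v
    where
    in? : ∀ w → Dec (In x y z w)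
    in? w = _≟ᵛ_ G w x ⊎-dec (_≟ᵛ_ G w y ⊎-dec _≟ᵛ_ G w z)
  ... | yes (i , j) = triangle-adj G′ (tri S′) (fwd-In i) (fwd-In j)
        (λ q → irr G (subst (Adj G u) (sym (old-inj S (to-injective φ
          (trans (sym (fwd-old u)) (trans (cong (old S′) q) (fwd-old v)))))) p))
  ... | no n = proj₁ (old→ S′ (subst₂ (Adj H′) (sym (fwd-old u)) (sym (fwd-old v)) (pres φ (old← S p n))))

star-coiso : ∀ {G G′ H H′ x y z hub x′ y′ z′ hub′} (φ : Iso H H′) → to φ hub ≡ hub′ →
  Star G H x y z hub → Star G′ H′ x′ y′ z′ hub′ → Iso G G′
star-coiso {G} {G′} {H} {H′} {hub = hub} {hub′ = hub′} φ e S S′ = record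
  { to = A.fwdᵛ ; from = B.fwdᵛ ; to-from = to-from′ ; from-to = from-to′
  ; pres = A.fwd-pres
  ; reflects = λ {u} {v} p → subst₂ (Adj G) (from-to′ u) (from-to′ v) (B.fwd-pres p) }
  where
  module A = StarCoiso φ e S S′
  module B = StarCoiso (iso-sym φ) (trans (cong (from φ) (sym e)) (from-to φ hub)) S′ S
  to-from′ : ∀ v → A.fwdᵛ (B.fwdᵛ v) ≡ v
  to-from′ v = old-inj S′ (trans (A.fwd-old _) (trans (cong (to φ) (B.fwd-old v)) (to-from φ _)))
  from-to′ : ∀ u → B.fwdᵛ (A.fwdᵛ u) ≡ u
  from-to′ u = old-inj S (trans (B.fwd-old _) (trans (cong (from φ) (A.fwd-old u)) (from-to φ _)))

record IsY (G : BGraph) (v x y z : V G) : Set where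
  field
    x≢y : x ≢ y
    y≢z : y ≢ z
    x≢z : x ≢ z
    nbr→ : ∀ {u} → Adj G v u → In x y z u
    nbr← : ∀ {u} → In x y z u → Adj G v u
    ¬xy  : ¬ Adj G x y
    ¬yz  : ¬ Adj G y z
    ¬xz  : ¬ Adj G x z

-- This turns "`H` arises by a move" into a condition on a vertex of `H` alone, so closure under Y∇
-- moves can be tested by inspecting the vertices of degree three.
star-isY : ∀ {G H x y z hub} (S : Star G H x y z hub) → IsY H hub (old S x) (old S y) (old S z)
star-isY {G} {H} {x} {y} {z} {hub} S = record
  { x≢y = λ p → irr G (subst (Adj G x) (sym (old-inj S p)) (proj₁ (tri S)))
  ; y≢z = λ p → irr G (subst (Adj G y) (sym (old-inj S p)) (proj₁ (proj₂ (tri S))))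
  ; x≢z = λ p → irr G (subst (Adj G x) (sym (old-inj S p)) (proj₂ (proj₂ (tri S))))
  ; nbr→ = nbr→′
  ; nbr← = λ { (inj₁ refl) → hub← S in₁ ; (inj₂ (inj₁ refl)) → hub← S in₂ ; (inj₂ (inj₂ refl)) → hub← S in₃ }
  ; ¬xy = λ p → proj₂ (old→ S p) (in₁ , in₂)
  ; ¬yz = λ p → proj₂ (old→ S p) (in₂ , in₃)
  ; ¬xz = λ p → proj₂ (old→ S p) (in₁ , in₃) }
  where
  nbr→′ : ∀ {u} → Adj H hub u → In (old S x) (old S y) (old S z) u
  nbr→′ {u} p with cover S u
  ... | inj₁ refl = ⊥-elim (irr H p)
  ... | inj₂ (w , refl) = In-map (old S) (hub→ S p)

triangle-iso : ∀ {G H x y z} (φ : Iso G H) → IsTriangle G x y z → IsTriangle H (to φ x) (to φ y) (to φ z)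
triangle-iso φ (p , q , r) = pres φ p , pres φ q , pres φ r

-- Adjacency matrices and graphs with a base

t≢f : ∀ {b : Bool} → b ≡ true → b ≡ false → ⊥
t≢f refl ()

simple-graph : (G : Graph) → IsSimple G → BGraph
simple-graph G (s , i) = record
  { V = Fin (size G) ; card = size G ; enum = ↔-refl
  ; Adj = λ u v → adj G u v ≡ true ; adj? = λ u v → adj G u v Bool.≟ true
  ; symm = λ {u} {v} p → trans (s v u) p
  ; irr = λ {v} p → t≢f p (i v)
  ; Base = λ _ → ⊤ ; base? = λ _ → yes tt }

⌊⌋-true : ∀ {A : Set} (a? : Dec A) → ⌊ a? ⌋ ≡ true → A
⌊⌋-true (yes a) _ = a

true-⌊⌋ : ∀ {A : Set} (a? : Dec A) → A → ⌊ a? ⌋ ≡ true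
true-⌊⌋ (yes _) _ = refl
true-⌊⌋ (no n) a = ⊥-elim (n a)

≡true-ext : ∀ {b c : Bool} → (b ≡ true → c ≡ true) → (c ≡ true → b ≡ true) → b ≡ c
≡true-ext {false} {false} f g = refl
≡true-ext {false} {true} f g = g refl
≡true-ext {true} {c} f g = sym (f refl)

graph : BGraph → Graph
graph G = mkGraph (card G) (λ i j → ⌊ adj? G (vertex G i) (vertex G j) ⌋)

graph-simple : ∀ G → IsSimple (graph G)
graph-simple G =
  (λ i j → ≡true-ext (λ p → true-⌊⌋ (adj? G _ _) (symm G (⌊⌋-true (adj? G _ _) p)))
                     (λ p → true-⌊⌋ (adj? G _ _) (symm G (⌊⌋-true (adj? G _ _) p)))) ,
  (λ i → irrefl i)
  where
  irrefl : ∀ i → adj (graph G) i i ≡ false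
  irrefl i with adj? G (vertex G i) (vertex G i)
  ... | yes p = ⊥-elim (irr G p)
  ... | no _ = refl

bgraph : BGraph → BGraph
bgraph G = simple-graph (graph G) (graph-simple G)

graph-iso : ∀ G → Iso G (bgraph G)
graph-iso G = record
  { to = index G ; from = vertex G ; to-from = index-vertex G ; from-to = vertex-index G
  ; pres = λ {u} {v} p → true-⌊⌋ (adj? G _ _) (subst₂ (Adj G) (sym (vertex-index G u)) (sym (vertex-index G v)) p)
  ; reflects = λ {u} {v} p → subst₂ (Adj G) (vertex-index G u) (vertex-index G v) (⌊⌋-true (adj? G _ _) p) }

≅⇒Iso : ∀ {G H} sG sH → G ≅ H → Iso (simple-graph G sG) (simple-graph H sH)
≅⇒Iso sG sH (f , e) = record
  { to = Inverse.to f ; from = Inverse.from f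
  ; to-from = Inverse.strictlyInverseˡ f ; from-to = Inverse.strictlyInverseʳ f
  ; pres = λ {u} {v} p → trans (sym (e u v)) p
  ; reflects = λ {u} {v} p → trans (e u v) p }

Iso⇒≅ : ∀ {G H} sG sH → Iso (simple-graph G sG) (simple-graph H sH) → G ≅ H
Iso⇒≅ sG sH f = mk↔ₛ′ (to f) (from f) (to-from f) (from-to f) , λ i j → ≡true-ext (pres f) (reflects f)

≅-simple : ∀ {G H} → IsSimple G → G ≅ H → IsSimple H
≅-simple {G} {H} (s , r) (f , e) =
  (λ i j → trans (sym (back i j)) (trans (s _ _) (back j i))) ,
  (λ i → trans (sym (back i i)) (r _))
  where
  back : ∀ i j → adj G (Inverse.from f i) (Inverse.from f j) ≡ adj H i j
  back i j = trans (e _ _) (cong₂ (adj H) (Inverse.strictlyInverseˡ f i) (Inverse.strictlyInverseˡ f j))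

==-true : ∀ {n} {i j : Fin n} → (i == j) ≡ true → i ≡ j
==-true {i = i} {j} = ⌊⌋-true (i Fin.≟ j)

true-== : ∀ {n} {i j : Fin n} → i ≡ j → (i == j) ≡ true
true-== {i = i} {j} = true-⌊⌋ (i Fin.≟ j)

∨-true : ∀ {b c} → (b ∨ c) ≡ true → b ≡ true ⊎ c ≡ true
∨-true {true} p = inj₁ refl
∨-true {false} p = inj₂ p

true-∨ˡ : ∀ {b c} → b ≡ true → (b ∨ c) ≡ true
true-∨ˡ refl = refl

true-∨ʳ : ∀ {b c} → c ≡ true → (b ∨ c) ≡ true
true-∨ʳ {true} p = refl
true-∨ʳ {false} p = p

∧-true : ∀ {b c} → (b ∧ c) ≡ true → b ≡ true × c ≡ true
∧-true {true} p = refl , p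

true-∧ : ∀ {b c} → b ≡ true → c ≡ true → (b ∧ c) ≡ true
true-∧ refl refl = refl

not-true : ∀ {b} → not b ≡ true → ¬ (b ≡ true)
not-true {true} () _
not-true {false} _ ()

true-not : ∀ {b} → ¬ (b ≡ true) → not b ≡ true
true-not {true} n = ⊥-elim (n refl)
true-not {false} n = refl

inᵇ : ∀ {n} → Fin n → Fin n → Fin n → Fin n → Bool
inᵇ x y z i = (i == x) ∨ (i == y) ∨ (i == z)

inᵇ-true : ∀ {n} {x y z i : Fin n} → inᵇ x y z i ≡ true → In x y z i
inᵇ-true {x = x} {y} {z} {i} p with ∨-true {i == x} p
... | inj₁ q = inj₁ (==-true q)
... | inj₂ q with ∨-true {i == y} q
... | inj₁ r = inj₂ (inj₁ (==-true r))
... | inj₂ r = inj₂ (inj₂ (==-true r))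

true-inᵇ : ∀ {n} {x y z i : Fin n} → In x y z i → inᵇ x y z i ≡ true
true-inᵇ {x = x} {i = i} (inj₁ p) = true-∨ˡ (true-== p)
true-inᵇ {x = x} {i = i} (inj₂ (inj₁ p)) = true-∨ʳ {i == x} (true-∨ˡ (true-== p))
true-inᵇ {x = x} {y} {i = i} (inj₂ (inj₂ p)) = true-∨ʳ {i == x} (true-∨ʳ {i == y} (true-== p))

ΔY-star : ∀ G sG (t : Triangle G) sH → let open Triangle t in
  Star (simple-graph G sG) (simple-graph (ΔY G t) sH) x y z zero
ΔY-star G sG (triangle x y z x≢y y≢z x≢z xy yz xz) sH = record
  { tri = xy , yz , xz
  ; old = suc ; old-inj = Finₚ.suc-injective ; old≢hub = λ ()
  ; cover = λ { zero → inj₁ refl ; (suc i) → inj₂ (i , refl) }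
  ; hub→ = inᵇ-true ; hub← = true-inᵇ
  ; old→ = λ {u} {v} p → proj₁ (∧-true p) ,
      λ { (i , j) → not-true (proj₂ (∧-true {adj G u v} p)) (true-∧ (true-inᵇ i) (true-inᵇ j)) }
  ; old← = λ {u} {v} p n → true-∧ p (true-not (λ q → n
      (inᵇ-true (proj₁ (∧-true q)) , inᵇ-true (proj₂ (∧-true {inᵇ x y z u} q))))) }

ΔY-simple : ∀ G → IsSimple G → (t : Triangle G) → IsSimple (ΔY G t)
ΔY-simple G (s , r) (triangle x y z _ _ _ _ _ _) =
  (λ { zero zero → refl ; zero (suc j) → refl ; (suc i) zero → refl
     ; (suc i) (suc j) → cong₂ (λ b c → b ∧ not c) (s i j) (Boolₚ.∧-comm (inᵇ x y z i) _) }) ,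
  (λ { zero → refl ; (suc i) → cong (λ b → b ∧ not (inᵇ x y z i ∧ inᵇ x y z i)) (r i) })

module _ {m : ℕ} {A : Fin (suc m) → Fin (suc m) → Bool} (sA : IsSimple (mkGraph (suc m) A)) (Y : YVertex m A) where
  open YVertex Y

  private
    B : Fin m → Fin m → Bool
    B = adj (YΔ m A Y)

  YΔ-simple : IsSimple (YΔ m A Y)
  YΔ-simple =
    (λ i j → ≡true-ext (swap i j) (swap j i)) ,
    (λ i → ≡true-ext (λ p → loop i p) (λ ()))
    where
    swap : ∀ i j → B i j ≡ true → B j i ≡ true
    swap i j p with ∨-true {A (punchIn v i) (punchIn v j)} p
    ... | inj₁ q = true-∨ˡ (trans (proj₁ sA _ _) q)
    ... | inj₂ q with ∧-true {A v (punchIn v i)} q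
    ... | q₁ , q′ with ∧-true {A v (punchIn v j)} q′
    ... | q₂ , q₃ = true-∨ʳ {A (punchIn v j) (punchIn v i)}
                      (true-∧ q₂ (true-∧ q₁ (true-not (λ e → not-true q₃ (true-== (sym (==-true e)))))))
    loop : ∀ i → B i i ≡ true → false ≡ true
    loop i p with ∨-true {A (punchIn v i) (punchIn v i)} p
    ... | inj₁ q = trans (sym (proj₂ sA (punchIn v i))) q
    ... | inj₂ q = ⊥-elim (not-true (proj₂ (∧-true {A v (punchIn v i)} (proj₂ (∧-true {A v (punchIn v i)} q))))
                                    (true-== {i = i} refl))

  -- Read backwards, the removal of `v` is a ∇Y move with new vertex `v`, so a single kind of move
  -- remains to be analysed. The corners are the neighbours of `v`, renumbered by `punchOut`.
  YΔ-star : ∀ sH → ∃ λ x′ → ∃ λ y′ → ∃ λ z′ →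
    Star (simple-graph (YΔ m A Y) sH) (simple-graph (mkGraph (suc m) A) sA) x′ y′ z′ v
  YΔ-star sH = x′ , y′ , z′ , record
    { tri = join x≢y x-n y-n {in₁} {in₂} , join y≢z y-n z-n {in₂} {in₃} , join x≢z x-n z-n {in₁} {in₃}
    ; old = punchIn v ; old-inj = Finₚ.punchIn-injective v _ _ ; old≢hub = Finₚ.punchInᵢ≢i v _
    ; cover = cover′
    ; hub→ = λ {u} p → in→ (nbrs→ (punchIn v u) p)
    ; hub← = λ {u} i → →nbrs (punchIn v u) (in← i)
    ; old→ = λ {u} {w} p → true-∨ˡ p , λ { (i , j) → indep (in← i) (in← j) p }
    -- An edge created by the move joins two corners, which `n` excludes.
    ; old← = λ {u} {w} p n → [ id , (λ q → ⊥-elim (n (both u w q))) ]′ (∨-true {A (punchIn v u) (punchIn v w)} p) }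
    where
    loopless : ∀ {u} → A u u ≡ true → ⊥
    loopless {u} p = t≢f p (proj₂ sA u)
    v≢ : ∀ {u} → In x y z u → v ≢ u
    v≢ {u} i e = loopless (subst (λ q → A v q ≡ true) (sym e) (→nbrs u i))
    x-n = v≢ in₁
    y-n = v≢ in₂
    z-n = v≢ in₃
    x′ = punchOut x-n
    y′ = punchOut y-n
    z′ = punchOut z-n
    in← : ∀ {u} → In x′ y′ z′ u → In x y z (punchIn v u)
    in← (inj₁ refl) = inj₁ (Finₚ.punchIn-punchOut x-n)
    in← (inj₂ (inj₁ refl)) = inj₂ (inj₁ (Finₚ.punchIn-punchOut y-n))
    in← (inj₂ (inj₂ refl)) = inj₂ (inj₂ (Finₚ.punchIn-punchOut z-n))
    in→ : ∀ {u} → In x y z (punchIn v u) → In x′ y′ z′ u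
    in→ {u} i = In-unmap (punchIn v) (Finₚ.punchIn-injective v _ _)
      (subst₂ (λ p q → In p q (punchIn v z′) (punchIn v u)) (sym (Finₚ.punchIn-punchOut x-n)) (sym (Finₚ.punchIn-punchOut y-n))
        (subst (λ p → In x y p (punchIn v u)) (sym (Finₚ.punchIn-punchOut z-n)) i))
    join : ∀ {p q} → p ≢ q → (i : v ≢ p) (j : v ≢ q) → {In x y z p} → {In x y z q} → B (punchOut i) (punchOut j) ≡ true
    join {p} {q} n i j {a} {b} = true-∨ʳ {A (punchIn v (punchOut i)) (punchIn v (punchOut j))}
      (true-∧ (trans (cong (A v) (Finₚ.punchIn-punchOut i)) (→nbrs _ a))
      (true-∧ (trans (cong (A v) (Finₚ.punchIn-punchOut j)) (→nbrs _ b))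
      (true-not (λ e → n (Finₚ.punchOut-injective i j (==-true e))))))
    cover′ : ∀ u → u ≡ v ⊎ ∃ λ w → punchIn v w ≡ u
    cover′ u with v Fin.≟ u
    ... | yes e = inj₁ (sym e)
    ... | no n = inj₂ (punchOut n , Finₚ.punchIn-punchOut n)
    both : ∀ u w → (A v (punchIn v u) ∧ A v (punchIn v w) ∧ not (u == w)) ≡ true → In x′ y′ z′ u × In x′ y′ z′ w
    both u w q with ∧-true {A v (punchIn v u)} q
    ... | q₁ , q′ = in→ (nbrs→ _ q₁) , in→ (nbrs→ _ (proj₁ (∧-true q′)))
    indep : ∀ {p q} → In x y z p → In x y z q → A p q ≡ true → ⊥
    indep {p} {q} i j e = [ (λ { refl → loopless e }) , t≢f e ]′ (split i j)
      where
      split : ∀ {p q} → In x y z p → In x y z q → p ≡ q ⊎ A p q ≡ false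
      split (inj₁ refl) (inj₁ refl) = inj₁ refl
      split (inj₁ refl) (inj₂ (inj₁ refl)) = inj₂ xy
      split (inj₁ refl) (inj₂ (inj₂ refl)) = inj₂ xz
      split (inj₂ (inj₁ refl)) (inj₁ refl) = inj₂ (trans (proj₁ sA _ _) xy)
      split (inj₂ (inj₁ refl)) (inj₂ (inj₁ refl)) = inj₁ refl
      split (inj₂ (inj₁ refl)) (inj₂ (inj₂ refl)) = inj₂ yz
      split (inj₂ (inj₂ refl)) (inj₁ refl) = inj₂ (trans (proj₁ sA _ _) xz)
      split (inj₂ (inj₂ refl)) (inj₂ (inj₁ refl)) = inj₂ (trans (proj₁ sA _ _) yz)
      split (inj₂ (inj₂ refl)) (inj₂ (inj₂ refl)) = inj₁ refl

-- Together with `star-cotransport`, this replaces either end of a move by an isomorphic graph.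
-- Closure of a list under moves then has to be checked only at the listed graphs themselves.
star-transport : ∀ {G G′ H x y z h} (φ : Iso G G′) → Star G H x y z h → Star G′ H (to φ x) (to φ y) (to φ z) h
star-transport {G} {G′} {H} {x} {y} {z} φ S = record
  { tri = triangle-iso φ (tri S)
  ; old = old S ∘ from φ
  ; old-inj = to-injective (iso-sym φ) ∘ old-inj S
  ; old≢hub = old≢hub S
  ; cover = λ v → [ inj₁ , (λ { (u , p) → inj₂ (to φ u , trans (cong (old S) (from-to φ u)) p) }) ]′ (cover S v)
  ; hub→ = in→ ∘ hub→ S
  ; hub← = hub← S ∘ in←
  ; old→ = λ {u} {v} p → reflects (iso-sym φ) (proj₁ (old→ S p)) , λ { (i , j) → proj₂ (old→ S p) (in← i , in← j) }
  ; old← = λ {u} {v} p n → old← S (pres (iso-sym φ) p) (λ { (i , j) → n (in→ i , in→ j) }) }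
  where
  in→ : ∀ {u} → In x y z (from φ u) → In (to φ x) (to φ y) (to φ z) u
  in→ {u} i = subst (In _ _ _) (to-from φ u) (In-map (to φ) i)
  in← : ∀ {u} → In (to φ x) (to φ y) (to φ z) u → In x y z (from φ u)
  in← {u} i = In-unmap (to φ) (to-injective φ) (subst (In _ _ _) (sym (to-from φ u)) i)

star-cotransport : ∀ {G H H′ x y z h} (φ : Iso H H′) → Star G H x y z h → Star G H′ x y z (to φ h)
star-cotransport {G} {H} {H′} {h = h} φ S = record
  { tri = tri S
  ; old = to φ ∘ old S
  ; old-inj = old-inj S ∘ to-injective φ
  ; old≢hub = old≢hub S ∘ to-injective φ
  ; cover = cover′
  ; hub→ = hub→ S ∘ reflects φ ; hub← = pres φ ∘ hub← S
  ; old→ = old→ S ∘ reflects φ ; old← = λ p n → pres φ (old← S p n) }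
  where
  cover′ : ∀ v → v ≡ to φ h ⊎ ∃ λ u → to φ (old S u) ≡ v
  cover′ v with cover S (from φ v)
  ... | inj₁ p = inj₁ (trans (sym (to-from φ v)) (cong (to φ) p))
  ... | inj₂ (u , p) = inj₂ (u , trans (cong (to φ) p) (to-from φ v))

star-resp : ∀ {G H x y z x′ y′ z′ h} → (∀ {u} → In x y z u → In x′ y′ z′ u) → (∀ {u} → In x′ y′ z′ u → In x y z u) →
  IsTriangle G x′ y′ z′ → Star G H x y z h → Star G H x′ y′ z′ h
star-resp f g t S = record
  { tri = t ; old = old S ; old-inj = old-inj S ; old≢hub = old≢hub S ; cover = cover S
  ; hub→ = f ∘ hub→ S ; hub← = hub← S ∘ g
  ; old→ = λ p → proj₁ (old→ S p) , λ { (i , j) → proj₂ (old→ S p) (g i , g j) }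
  ; old← = λ p n → old← S p (λ { (i , j) → n (f i , f j) }) }

In-rotate : {A : Set} {x y z u : A} → In x y z u → In y z x u
In-rotate (inj₁ p) = inj₂ (inj₂ p)
In-rotate (inj₂ (inj₁ p)) = inj₁ p
In-rotate (inj₂ (inj₂ p)) = inj₂ (inj₁ p)

In-swap : {A : Set} {x y z u : A} → In x y z u → In y x z u
In-swap (inj₁ p) = inj₂ (inj₁ p)
In-swap (inj₂ (inj₁ p)) = inj₁ p
In-swap (inj₂ (inj₂ p)) = inj₂ (inj₂ p)

star-rotate : ∀ {G H x y z h} → Star G H x y z h → Star G H y z x h
star-rotate {G} S = let (p , q , r) = tri S in
  star-resp In-rotate (In-rotate ∘ In-rotate) (q , symm G r , symm G p) S

-- Reachability and the number of classes

-- The counterpart of `Cousin` for graphs whose vertices are not of the form `Fin n`; `cousin-path`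
-- translates it back.
data Path (G : BGraph) : BGraph → Set₁ where
  done : Path G G
  up   : ∀ {H K x y z h} → Path G H → Star H K x y z h → Path G K
  down : ∀ {H K x y z h} → Path G H → Star K H x y z h → Path G K
  via  : ∀ {H K} → Path G H → Iso H K → Path G K

index-triangle : ∀ G {x y z} → IsTriangle G x y z → Triangle (graph G)
index-triangle G {x} {y} {z} (p , q , r) = triangle (index G x) (index G y) (index G z)
  (apart p) (apart q) (apart r) (pres (graph-iso G) p) (pres (graph-iso G) q) (pres (graph-iso G) r)
  where
  apart : ∀ {u v} → Adj G u v → index G u ≢ index G v
  apart {u} p e = irr G (subst (Adj G u) (sym (index-injective G e)) p)

star-≅ : ∀ {G H x y z h} (S : Star G H x y z h) → ΔY (graph G) (index-triangle G (tri S)) ≅ graph H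
star-≅ {G} {H} {x} {y} {z} S = Iso⇒≅ sΔ (graph-simple H)
  (iso-trans (star-iso (iso-sym φ) (ΔY-star (graph G) (graph-simple G) t sΔ) S
      (λ i → subst₃ (vertex-index G x) (vertex-index G y) (vertex-index G z) (In-map (vertex G) i))
      (λ {u} i → subst (In _ _ _) (index-vertex G u) (In-map (index G) i)))
    (graph-iso H))
  where
  φ = graph-iso G
  t = index-triangle G (tri S)
  sΔ = ΔY-simple (graph G) (graph-simple G) t
  subst₃ : ∀ {x y z x′ y′ z′ u : V G} → x ≡ x′ → y ≡ y′ → z ≡ z′ → In x y z u → In x′ y′ z′ u
  subst₃ refl refl refl i = i

≅-sym : ∀ {G H} → G ≅ H → H ≅ G
≅-sym {G} {H} (f , e) = ↔-sym f , λ i j → sym (trans (e _ _)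
  (cong₂ (adj H) (Inverse.strictlyInverseˡ f i) (Inverse.strictlyInverseˡ f j)))

cousin-path : ∀ {X G H} → Cousin X (graph G) → Path G H → Cousin X (graph H)
cousin-path c done = c
cousin-path c (up {H} p S) = iso (fwd (cousin-path c p) (∇Y-move (graph H) (graph-simple H) (index-triangle H (tri S)))) (star-≅ S)
cousin-path c (down {K = K} p S) =
  bwd (iso (cousin-path c p) (≅-sym (star-≅ S))) (∇Y-move (graph K) (graph-simple K) (index-triangle K (tri S)))
cousin-path c (via {H} {K} p φ) = iso (cousin-path c p)
  (Iso⇒≅ (graph-simple H) (graph-simple K) (iso-trans (iso-sym (graph-iso H)) (iso-trans φ (graph-iso K))))

-- The size of the selection depends only on the relation on indices and its decision. In the
-- application this relation does not mention `n`, so that one number serves for all `n`.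
module Representatives {N : ℕ} (_~_ : Fin N → Fin N → Set) (_~?_ : ∀ i j → Dec (i ~ j))
  (~-refl : ∀ i → i ~ i) (~-sym : ∀ {i j} → i ~ j → j ~ i) where

  record Reps (xs : List (Fin N)) : Set where
    field
      size     : ℕ
      reps     : Vec (Fin N) size
      distinct : ∀ p q → lookup reps p ~ lookup reps q → p ≡ q
      covers   : ∀ {i} → i ∈ xs → ∃ λ p → i ~ lookup reps p
  open Reps public

  choose : ∀ xs → Reps xs
  choose [] = record { size = 0 ; reps = [] ; distinct = λ () ; covers = λ () }
  choose (x ∷ xs) with choose xs
  ... | R with Finₚ.any? (λ p → x ~? lookup (reps R) p)
  ... | yes new = record { size = size R ; reps = reps R ; distinct = distinct R
                         ; covers = λ { (here refl) → new ; (there m) → covers R m } }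
  ... | no fresh = record
    { size = suc (size R) ; reps = x ∷ reps R
    ; distinct = λ { zero zero _ → refl ; zero (suc q) e → ⊥-elim (fresh (q , e))
                   ; (suc p) zero e → ⊥-elim (fresh (p , ~-sym e))
                   ; (suc p) (suc q) e → cong suc (distinct R p q e) }
    ; covers = λ { (here refl) → zero , ~-refl x
                 ; (there m) → let (p , e) = covers R m in suc p , e } }

  classes : Reps (allFin N)
  classes = choose (allFin N)

-- Closedness under both directions puts every cousin into the list, and reachability makes every
-- entry a cousin. Entries may repeat up to isomorphism; the relation `_~_` used to count them can
-- be any decidable one that amounts to isomorphism of the entries.
module Closure (G : Graph) (sG : IsSimple G) {N : ℕ} (L : Fin N → BGraph)
  (i₀ : Fin N) (begin : Iso (simple-graph G sG) (L i₀))
  (up-closed : ∀ i {H x y z h} → Star (L i) H x y z h → ∃ λ j → Iso H (L j))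
  (down-closed : ∀ i {H x y z h} → Star H (L i) x y z h → ∃ λ j → Iso H (L j))
  (reach : ∀ i → Path (L i₀) (L i)) where

  Member : Graph → Set
  Member H = Σ (IsSimple H) λ s → ∃ λ i → Iso (simple-graph H s) (L i)

  member-up : ∀ {H K} sH sK {x y z h} → Star (simple-graph H sH) (simple-graph K sK) x y z h →
    ∃ (λ i → Iso (simple-graph H sH) (L i)) → Member K
  member-up sH sK S (i , φ) = sK , up-closed i (star-transport φ S)

  member-down : ∀ {H K} sH sK {x y z h} → Star (simple-graph H sH) (simple-graph K sK) x y z h →
    ∃ (λ i → Iso (simple-graph K sK) (L i)) → Member H
  member-down sH sK S (i , φ) = sH , down-closed i (star-cotransport φ S)

  cousin-member : ∀ {H} → Cousin G H → Member H
  cousin-member (start e) = s , i₀ , iso-trans (iso-sym (≅⇒Iso sG s e)) begin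
    where s = ≅-simple sG e
  cousin-member (iso c e) with cousin-member c
  ... | s , i , φ = ≅-simple s e , i , iso-trans (iso-sym (≅⇒Iso s (≅-simple s e) e)) φ
  cousin-member (fwd c (∇Y-move H _ t)) with cousin-member c
  ... | s , m = member-up s (ΔY-simple H s t) (ΔY-star H s t (ΔY-simple H s t)) m
  cousin-member (fwd c (Y∇-move m A _ Y)) with cousin-member c
  ... | s , q with YΔ-star s Y (YΔ-simple s Y)
  ... | _ , _ , _ , S = member-down (YΔ-simple s Y) s S q
  cousin-member (bwd c (∇Y-move H sH t)) with cousin-member c
  ... | s , m = member-down sH s (ΔY-star H sH t s) m
  cousin-member (bwd c (Y∇-move m A sA Y)) with cousin-member c
  ... | s , q with YΔ-star sA Y s
  ... | _ , _ , _ , S = member-up s sA S q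

  module _ (_~_ : Fin N → Fin N → Set) (_~?_ : ∀ i j → Dec (i ~ j))
    (~-refl : ∀ i → i ~ i) (~-sym : ∀ {i j} → i ~ j → j ~ i)
    (sound : ∀ {i j} → i ~ j → Iso (L i) (L j)) (complete : ∀ {i j} → Iso (L i) (L j) → i ~ j) where

    private
      module R = Representatives _~_ _~?_ ~-refl ~-sym

    family-size : FamilySize G (R.size R.classes)
    family-size = Vec.map (graph ∘ L) rs , valid , apart , complete′
      where
      rs = R.reps R.classes
      at : ∀ p → lookup (Vec.map (graph ∘ L) rs) p ≡ graph (L (lookup rs p))
      at p = Vecₚ.lookup-map p (graph ∘ L) rs
      valid : ∀ p → IsSimple (lookup (Vec.map (graph ∘ L) rs) p) × Cousin G (lookup (Vec.map (graph ∘ L) rs) p)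
      valid p rewrite at p = graph-simple (L i) , cousin-path (start e) (reach i)
        where
        i = lookup rs p
        e = Iso⇒≅ sG (graph-simple (L i₀)) (iso-trans begin (graph-iso (L i₀)))
      apart : ∀ p q → lookup (Vec.map (graph ∘ L) rs) p ≅ lookup (Vec.map (graph ∘ L) rs) q → p ≡ q
      apart p q e rewrite at p | at q = R.distinct R.classes p q (complete
        (iso-trans (graph-iso (L i)) (iso-trans (≅⇒Iso (graph-simple (L i)) (graph-simple (L j)) e) (iso-sym (graph-iso (L j))))))
        where
        i = lookup rs p
        j = lookup rs q
      complete′ : ∀ H → Cousin G H → ∃ λ p → H ≅ lookup (Vec.map (graph ∘ L) rs) p
      complete′ H c with cousin-member c
      ... | s , i , φ with R.covers R.classes (∈-allFin i)
      ... | p , e = p , subst (H ≅_) (sym (at p))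
              (Iso⇒≅ s (graph-simple (L j)) (iso-trans φ (iso-trans (sound e) (graph-iso (L j)))))
        where j = lookup rs p

-- Deciding base-preserving isomorphism

-- Exhaustive search over maps numbered by `funToFin`. The inverse is searched for together with the
-- map, so that being an isomorphism becomes a conjunction of decidable conditions on finitely many
-- indices.
biso? : ∀ G H → Dec (BIso G H)
biso? G H = map′ decode encode (Finₚ.any? λ k → Finₚ.any? λ l → code? (finToFun k) (finToFun l))
  where
  n = card G
  m = card H
  Code : (Fin n → Fin m) → (Fin m → Fin n) → Set
  Code f g = (∀ j → f (g j) ≡ j) × (∀ i → g (f i) ≡ i) ×
    (∀ i j → Adj G (vertex G i) (vertex G j) → Adj H (vertex H (f i)) (vertex H (f j))) ×
    (∀ i j → Adj H (vertex H (f i)) (vertex H (f j)) → Adj G (vertex G i) (vertex G j)) ×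
    (∀ i → Base G (vertex G i) → Base H (vertex H (f i))) ×
    (∀ i → Base H (vertex H (f i)) → Base G (vertex G i))
  code? : ∀ f g → Dec (Code f g)
  code? f g = Finₚ.all? (λ j → f (g j) Fin.≟ j) ×-dec Finₚ.all? (λ i → g (f i) Fin.≟ i) ×-dec
    Finₚ.all? (λ i → Finₚ.all? λ j → adj? G _ _ →-dec adj? H _ _) ×-dec
    Finₚ.all? (λ i → Finₚ.all? λ j → adj? H _ _ →-dec adj? G _ _) ×-dec
    Finₚ.all? (λ i → base? G _ →-dec base? H _) ×-dec
    Finₚ.all? (λ i → base? H _ →-dec base? G _)
  decode : (∃ λ k → ∃ λ l → Code (finToFun k) (finToFun l)) → BIso G H
  decode (k , l , fg , gf , p , r , b , b′) = record
    { plain = record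
      { to = vertex H ∘ f ∘ index G ; from = vertex G ∘ g ∘ index H
      ; to-from = λ v → trans (cong (vertex H) (trans (cong f (index-vertex G _)) (fg _))) (vertex-index H v)
      ; from-to = λ v → trans (cong (vertex G) (trans (cong g (index-vertex H _)) (gf _))) (vertex-index G v)
      ; pres = λ {u} {v} e → p _ _ (subst₂ (Adj G) (sym (vertex-index G u)) (sym (vertex-index G v)) e)
      ; reflects = λ {u} {v} e → subst₂ (Adj G) (vertex-index G u) (vertex-index G v) (r _ _ e) }
    ; base→ = λ {u} e → b _ (subst (Base G) (sym (vertex-index G u)) e)
    ; base← = λ {u} e → subst (Base G) (vertex-index G u) (b′ _ e) }
    where
    f = finToFun k
    g = finToFun l
  encode : BIso G H → ∃ λ k → ∃ λ l → Code (finToFun k) (finToFun l)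
  encode φ = funToFin f , funToFin g ,
    (λ j → trans (f≗ _) (trans (cong f (g≗ j)) (trans (cong (index H ∘ to (plain φ)) (vertex-index G _))
             (trans (cong (index H) (to-from (plain φ) _)) (index-vertex H j))))) ,
    (λ i → trans (g≗ _) (trans (cong g (f≗ i)) (trans (cong (index G ∘ from (plain φ)) (vertex-index H _))
             (trans (cong (index G) (from-to (plain φ) _)) (index-vertex G i))))) ,
    (λ i j e → subst₂ (Adj H) (sym (at i)) (sym (at j)) (pres (plain φ) e)) ,
    (λ i j e → reflects (plain φ) (subst₂ (Adj H) (at i) (at j) e)) ,
    (λ i e → subst (Base H) (sym (at i)) (base→ φ e)) ,
    (λ i e → base← φ (subst (Base H) (at i) e))
    where
    f = index H ∘ to (plain φ) ∘ vertex G
    g = index G ∘ from (plain φ) ∘ vertex H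
    f≗ = Finₚ.finToFun-funToFin f
    g≗ = Finₚ.finToFun-funToFin g
    at : ∀ i → vertex H (finToFun (funToFin f) i) ≡ to (plain φ) (vertex G i)
    at i = trans (cong (vertex H) (f≗ i)) (vertex-index H _)

-- Degree bounds

-- "Degree at least `k`" as an injection into the neighbourhood: it passes along isomorphisms by
-- composition, and its negation bounds the degree from above.
Has : ℕ → (G : BGraph) → V G → Set
Has k G v = Σ (Fin k → V G) λ g → (∀ {i j} → g i ≡ g j → i ≡ j) × (∀ i → Adj G v (g i))

has-iso : ∀ {k G H v} (φ : Iso G H) → Has k G v → Has k H (to φ v)
has-iso φ (g , inj , a) = to φ ∘ g , (inj ∘ to-injective φ) , (pres φ ∘ a)

no-injection : ∀ {n} {X : Set} {P : X → Set} (f : ∀ x → P x → Fin n) →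
  (∀ {x y} p q → f x p ≡ f y q → x ≡ y) →
  (g : Fin (suc n) → X) → (∀ {i j} → g i ≡ g j → i ≡ j) → ¬ (∀ i → P (g i))
no-injection f f-inj g g-inj a with Finₚ.pigeonhole (ℕₚ.n<1+n _) (λ i → f (g i) (a i))
... | i , j , i<j , e = ℕₚ.<⇒≢ i<j (cong Fin.toℕ (g-inj (f-inj (a i) (a j) e)))

no-four : {X : Set} {x y z : X} (g : Fin 4 → X) → (∀ {i j} → g i ≡ g j → i ≡ j) → ¬ (∀ i → In x y z (g i))
no-four {x = x} {y} {z} = no-injection {P = In x y z} code code-inj
  where
  code : ∀ u → In x y z u → Fin 3
  code u (inj₁ _) = zero
  code u (inj₂ (inj₁ _)) = suc zero
  code u (inj₂ (inj₂ _)) = suc (suc zero)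
  code-inj : ∀ {u w} p q → code u p ≡ code w q → u ≡ w
  code-inj (inj₁ refl) (inj₁ refl) _ = refl
  code-inj (inj₂ (inj₁ refl)) (inj₂ (inj₁ refl)) _ = refl
  code-inj (inj₂ (inj₂ refl)) (inj₂ (inj₂ refl)) _ = refl
  code-inj (inj₁ _) (inj₂ (inj₁ _)) ()
  code-inj (inj₁ _) (inj₂ (inj₂ _)) ()
  code-inj (inj₂ (inj₁ _)) (inj₁ _) ()
  code-inj (inj₂ (inj₁ _)) (inj₂ (inj₂ _)) ()
  code-inj (inj₂ (inj₂ _)) (inj₁ _) ()
  code-inj (inj₂ (inj₂ _)) (inj₂ (inj₁ _)) ()

isY⇒¬has4 : ∀ {G v x y z} → IsY G v x y z → ¬ Has 4 G v
isY⇒¬has4 Y (g , inj , a) = no-four g inj (IsY.nbr→ Y ∘ a)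

-- Adjoining vertices joined to exactly the base

infixl 6 _⊕_

_⊕_ : BGraph → ℕ → BGraph
G ⊕ n = record
  { V = V G ⊎ Fin n ; card = card G + n
  ; enum = ↔-trans (enum G ⊎-↔ ↔-refl) (↔-sym Finₚ.+↔⊎)
  ; Adj = A ; adj? = A? ; symm = λ {u} {v} → A-sym u v ; irr = λ {v} → A-irr v
  ; Base = B ; base? = B? }
  where
  A : V G ⊎ Fin n → V G ⊎ Fin n → Set
  A (inj₁ u) (inj₁ v) = Adj G u v
  A (inj₁ u) (inj₂ _) = Base G u
  A (inj₂ _) (inj₁ v) = Base G v
  A (inj₂ _) (inj₂ _) = ⊥
  A? : ∀ u v → Dec (A u v)
  A? (inj₁ u) (inj₁ v) = adj? G u v
  A? (inj₁ u) (inj₂ _) = base? G u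
  A? (inj₂ _) (inj₁ v) = base? G v
  A? (inj₂ _) (inj₂ _) = no λ ()
  A-sym : ∀ u v → A u v → A v u
  A-sym (inj₁ u) (inj₁ v) p = symm G p
  A-sym (inj₁ u) (inj₂ _) p = p
  A-sym (inj₂ _) (inj₁ v) p = p
  A-irr : ∀ v → ¬ A v v
  A-irr (inj₁ v) = irr G
  B : V G ⊎ Fin n → Set
  B (inj₁ u) = Base G u
  B (inj₂ _) = ⊥
  B? : ∀ u → Dec (B u)
  B? (inj₁ u) = base? G u
  B? (inj₂ _) = no λ ()

⊕-biso : ∀ {G H m n} → BIso G H → Fin m ↔ Fin n → BIso (G ⊕ m) (H ⊕ n)
⊕-biso {G} {H} {m} {n} φ e = record
  { plain = record
    { to = Sum.map (to f) (Inverse.to e) ; from = Sum.map (from f) (Inverse.from e)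
    ; to-from = λ { (inj₁ v) → cong inj₁ (to-from f v) ; (inj₂ k) → cong inj₂ (Inverse.strictlyInverseˡ e k) }
    ; from-to = λ { (inj₁ v) → cong inj₁ (from-to f v) ; (inj₂ k) → cong inj₂ (Inverse.strictlyInverseʳ e k) }
    ; pres = λ {u} {v} → P u v ; reflects = λ {u} {v} → R u v }
  ; base→ = λ { {inj₁ u} → base→ φ } ; base← = λ { {inj₁ u} → base← φ } }
  where
  f = plain φ
  g : V (G ⊕ m) → V (H ⊕ n)
  g = Sum.map (to f) (Inverse.to e)
  P : ∀ u v → Adj (G ⊕ m) u v → Adj (H ⊕ n) (g u) (g v)
  P (inj₁ u) (inj₁ v) = pres f
  P (inj₁ u) (inj₂ v) = base→ φ
  P (inj₂ u) (inj₁ v) = base→ φ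
  R : ∀ u v → Adj (H ⊕ n) (g u) (g v) → Adj (G ⊕ m) u v
  R (inj₁ u) (inj₁ v) = reflects f
  R (inj₁ u) (inj₂ v) = base← φ
  R (inj₂ u) (inj₁ v) = base← φ

-- Adjoined vertices are interchangeable, so any bijection works: the standard one gives `⊕-+`, and
-- one that singles out a chosen vertex gives `⊕-extract`.
⊕-⊎ : ∀ {G k m n} (e : Fin k ↔ (Fin m ⊎ Fin n)) → BIso (G ⊕ k) (G ⊕ m ⊕ n)
⊕-⊎ {G} {k} {m} {n} e = record
  { plain = record
    { to = t ; from = f ; to-from = tf ; from-to = ft
    ; pres = λ {u} {v} → P u v ; reflects = λ {u} {v} → R u v }
  ; base→ = λ { {inj₁ u} → id } ; base← = λ { {inj₁ u} → id ; {inj₂ i} b → ⊥-elim (nb i b) } }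
  where
  outer : Fin m ⊎ Fin n → V (G ⊕ m ⊕ n)
  outer = Sum.map inj₂ id
  t : V (G ⊕ k) → V (G ⊕ m ⊕ n)
  t (inj₁ u) = inj₁ (inj₁ u)
  t (inj₂ i) = outer (Inverse.to e i)
  f : V (G ⊕ m ⊕ n) → V (G ⊕ k)
  f (inj₁ (inj₁ u)) = inj₁ u
  f (inj₁ (inj₂ i)) = inj₂ (Inverse.from e (inj₁ i))
  f (inj₂ i) = inj₂ (Inverse.from e (inj₂ i))
  f-outer : ∀ s → f (outer s) ≡ inj₂ (Inverse.from e s)
  f-outer (inj₁ _) = refl
  f-outer (inj₂ _) = refl
  tf : ∀ v → t (f v) ≡ v
  tf (inj₁ (inj₁ u)) = refl
  tf (inj₁ (inj₂ i)) = cong outer (Inverse.strictlyInverseˡ e (inj₁ i))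
  tf (inj₂ i) = cong outer (Inverse.strictlyInverseˡ e (inj₂ i))
  ft : ∀ v → f (t v) ≡ v
  ft (inj₁ u) = refl
  ft (inj₂ i) = trans (f-outer (Inverse.to e i)) (cong inj₂ (Inverse.strictlyInverseʳ e i))
  nb : ∀ i → ¬ Base (G ⊕ m ⊕ n) (t (inj₂ i))
  nb i b with Inverse.to e i
  nb i () | inj₁ _
  nb i () | inj₂ _
  P : ∀ u v → Adj (G ⊕ k) u v → Adj (G ⊕ m ⊕ n) (t u) (t v)
  P (inj₁ u) (inj₁ v) p = p
  P (inj₁ u) (inj₂ i) p with Inverse.to e i
  ... | inj₁ _ = p
  ... | inj₂ _ = p
  P (inj₂ i) (inj₁ u) p with Inverse.to e i
  ... | inj₁ _ = p
  ... | inj₂ _ = p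
  R : ∀ u v → Adj (G ⊕ m ⊕ n) (t u) (t v) → Adj (G ⊕ k) u v
  R (inj₁ u) (inj₁ v) p = p
  R (inj₁ u) (inj₂ i) p with Inverse.to e i
  ... | inj₁ _ = p
  ... | inj₂ _ = p
  R (inj₂ i) (inj₁ u) p with Inverse.to e i
  ... | inj₁ _ = p
  ... | inj₂ _ = p
  R (inj₂ i) (inj₂ j) p with Inverse.to e i | Inverse.to e j
  ... | inj₁ _ | inj₁ _ = p
  ... | inj₁ _ | inj₂ _ = p
  ... | inj₂ _ | inj₁ _ = p
  ... | inj₂ _ | inj₂ _ = p

⊕-+ : ∀ {G} m n → BIso (G ⊕ (m + n)) (G ⊕ m ⊕ n)
⊕-+ m n = ⊕-⊎ Finₚ.+↔⊎

⊕-zero : ∀ {G} → BIso G (G ⊕ 0)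
⊕-zero = record
  { plain = record
    { to = inj₁ ; from = λ { (inj₁ u) → u } ; to-from = λ { (inj₁ u) → refl } ; from-to = λ _ → refl
    ; pres = id ; reflects = id }
  ; base→ = id ; base← = id }

⊕-extract : ∀ {G m} (k : Fin (suc m)) → BIso (G ⊕ suc m) (G ⊕ 1 ⊕ m)
⊕-extract {m = m} k = ⊕-⊎ (mk↔ₛ′ t f tf ft)
  where
  t : Fin (suc m) → Fin 1 ⊎ Fin m
  t i with k Fin.≟ i
  ... | yes _ = inj₁ zero
  ... | no n = inj₂ (punchOut n)
  f : Fin 1 ⊎ Fin m → Fin (suc m)
  f (inj₁ _) = k
  f (inj₂ i) = punchIn k i
  tf : ∀ s → t (f s) ≡ s
  tf (inj₁ zero) with k Fin.≟ k
  ... | yes _ = refl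
  ... | no n = ⊥-elim (n refl)
  tf (inj₂ i) with k Fin.≟ punchIn k i
  ... | yes e = ⊥-elim (Finₚ.punchInᵢ≢i k i (sym e))
  ... | no n = cong inj₂ (trans (Finₚ.punchOut-cong k refl) (Finₚ.punchOut-punchIn k))
  ft : ∀ i → f (t i) ≡ i
  ft i with k Fin.≟ i
  ... | yes e = e
  ... | no n = Finₚ.punchIn-punchOut n

⊕-extract-at : ∀ {G m} (k : Fin (suc m)) → to (plain (⊕-extract {G} k)) (inj₂ k) ≡ inj₁ (inj₂ zero)
⊕-extract-at k with k Fin.≟ k
... | yes _ = refl
... | no n = ⊥-elim (n refl)

-- The old vertices keep their base status and the hub lies outside the base, so each adjoined
-- vertex keeps its neighbourhood. This is what the extra fields of `BStar` are for.
⊕-star : ∀ {G H x y z h} n → BStar G H x y z h → BStar (G ⊕ n) (H ⊕ n) (inj₁ x) (inj₁ y) (inj₁ z) (inj₁ h)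
⊕-star {G} {H} {x} {y} {z} {h} n B = record
  { star = record
    { tri = tri S ; old = o
    ; old-inj = λ {u} {v} → o-inj u v
    ; old≢hub = λ { {inj₁ u} p → old≢hub S (inj₁-injective p) }
    ; cover = λ { (inj₁ v) → Sum.map (cong inj₁) (λ { (u , p) → inj₁ u , cong inj₁ p }) (cover S v)
                ; (inj₂ k) → inj₂ (inj₂ k , refl) }
    ; hub→ = λ { {inj₁ u} p → In-map inj₁ (hub→ S p) ; {inj₂ k} p → ⊥-elim (hub-base B p) }
    ; hub← = λ { {inj₁ u} i → hub← S (down₁ i)
               ; {inj₂ k} (inj₁ ()) ; {inj₂ k} (inj₂ (inj₁ ())) ; {inj₂ k} (inj₂ (inj₂ ())) }
    ; old→ = λ {u} {v} → o→ u v ; old← = λ {u} {v} → o← u v }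
  ; old-base→ = λ { {inj₁ u} → old-base→ B }
  ; old-base← = λ { {inj₁ u} → old-base← B }
  ; hub-base = hub-base B }
  where
  S = star B
  In′ : V (G ⊕ n) → Set
  In′ = In (inj₁ x) (inj₁ y) (inj₁ z)
  down₁ : ∀ {u} → In′ (inj₁ u) → In x y z u
  down₁ = In-unmap inj₁ inj₁-injective
  o : V (G ⊕ n) → V (H ⊕ n)
  o = Sum.map (old S) id
  o-inj : ∀ u v → o u ≡ o v → u ≡ v
  o-inj (inj₁ u) (inj₁ v) p = cong inj₁ (old-inj S (inj₁-injective p))
  o-inj (inj₂ u) (inj₂ v) p = cong inj₂ (inj₂-injective p)
  no₂ : ∀ {k} → ¬ In′ (inj₂ k)
  no₂ (inj₁ ())
  no₂ (inj₂ (inj₁ ()))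
  no₂ (inj₂ (inj₂ ()))
  o→ : ∀ u v → Adj (H ⊕ n) (o u) (o v) → Adj (G ⊕ n) u v × ¬ (In′ u × In′ v)
  o→ (inj₁ u) (inj₁ v) p = proj₁ (old→ S p) , λ { (i , j) → proj₂ (old→ S p) (down₁ i , down₁ j) }
  o→ (inj₁ u) (inj₂ k) p = old-base← B p , λ { (i , j) → no₂ j }
  o→ (inj₂ k) (inj₁ v) p = old-base← B p , λ { (i , j) → no₂ i }
  o← : ∀ u v → Adj (G ⊕ n) u v → ¬ (In′ u × In′ v) → Adj (H ⊕ n) (o u) (o v)
  o← (inj₁ u) (inj₁ v) p q = old← S p (λ { (i , j) → q (In-map inj₁ i , In-map inj₁ j) })
  o← (inj₁ u) (inj₂ k) p q = old-base→ B p
  o← (inj₂ k) (inj₁ v) p q = old-base→ B p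

-- A vertex of `G` that cannot be told from an adjoined one.
record Full (G : BGraph) (q : V G) : Set where
  field
    full-base : ¬ Base G q
    full→     : ∀ {u} → Adj G q u → Base G u
    full←     : ∀ {u} → Base G u → Adj G q u

module Cancel₁ {G H : BGraph} (φ : BIso (G ⊕ 1) (H ⊕ 1)) where
  private
    f = to (plain φ)
    g = from (plain φ)
    ∞ : ∀ {X : Set} → X ⊎ Fin 1
    ∞ = inj₂ zero

  data View (u : V G) : V H → Set where
    direct : ∀ {h} → f (inj₁ u) ≡ inj₁ h → View u h
    around : ∀ {h} → f (inj₁ u) ≡ ∞ → f ∞ ≡ inj₁ h → View u h

  image : ∀ u → ∃ (View u)
  image u with f (inj₁ u) in e
  ... | inj₁ h = h , direct e
  ... | inj₂ zero with f ∞ in e′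
  ... | inj₁ h = h , around e e′
  ... | inj₂ zero with () ← to-injective (plain φ) (trans e (sym e′))

module _ {G H : BGraph} (φ : BIso (G ⊕ 1) (H ⊕ 1)) where
  private
    ψ = biso-sym φ
    module A = Cancel₁ φ
    module B = Cancel₁ ψ
    f = to (plain φ)
    g = from (plain φ)
    ∞ : ∀ {X : Set} → X ⊎ Fin 1
    ∞ = inj₂ zero

    unf : ∀ {u v} → f u ≡ v → g v ≡ u
    unf p = trans (cong g (sym p)) (from-to (plain φ) _)

    view-sym : ∀ {u h} → A.View u h → B.View h u
    view-sym (A.direct p) = B.direct (unf p)
    view-sym (A.around p q) = B.around (unf q) (unf p)

    view-fun : ∀ {u h h′} → A.View u h → A.View u h′ → h ≡ h′
    view-fun (A.direct p) (A.direct q) = inj₁-injective (trans (sym p) q)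
    view-fun (A.direct p) (A.around q _) with () ← trans (sym p) q
    view-fun (A.around q _) (A.direct p) with () ← trans (sym p) q
    view-fun (A.around _ p) (A.around _ q) = inj₁-injective (trans (sym p) q)

  -- The mixed cases use that `φ` respects the base. If `v` is sent to the adjoined vertex, the edge
  -- from `u` to `v` says that the image of `u` is in the base; then so is `u`, hence `u` is joined
  -- to the adjoined vertex, and their images are joined.
  cancel-one-map : ∀ {u v h k} → A.View u h → A.View v k → Adj G u v → Adj H h k
  cancel-one-map (A.direct p) (A.direct q) e = subst₂ (Adj (H ⊕ 1)) p q (pres (plain φ) e)
  cancel-one-map {u} (A.direct {h} p) (A.around q r) e =
    symm H (subst₂ (Adj (H ⊕ 1)) r refl (subst (Adj (H ⊕ 1) (f ∞)) p (pres (plain φ) {∞} {inj₁ u}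
      (base← φ (subst (Base (H ⊕ 1)) (sym p) (subst₂ (Adj (H ⊕ 1)) p q (pres (plain φ) e)))))))
  cancel-one-map {u} {v} (A.around q r) (A.direct {h} p) e =
    subst₂ (Adj (H ⊕ 1)) r refl (subst (Adj (H ⊕ 1) (f ∞)) p (pres (plain φ) {∞} {inj₁ v}
      (base← φ (subst (Base (H ⊕ 1)) (sym p) (subst₂ (Adj (H ⊕ 1)) q p (pres (plain φ) e))))))
  cancel-one-map (A.around q r) (A.around q′ r′) e =
    ⊥-elim (subst₂ (Adj (H ⊕ 1)) q q′ (pres (plain φ) e))

  cancel-one-base : ∀ {u h} → A.View u h → Base G u → Base H h
  cancel-one-base (A.direct p) b = subst (Base (H ⊕ 1)) p (base→ φ b)
  cancel-one-base (A.around p q) b = ⊥-elim (subst (Base (H ⊕ 1)) p (base→ φ b))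

  private
    ft : ∀ u → proj₁ (B.image (proj₁ (A.image u))) ≡ u
    ft u = view-fun′ (proj₂ (B.image _)) (view-sym (proj₂ (A.image u)))
      where
      view-fun′ : ∀ {h u u′} → B.View h u → B.View h u′ → u ≡ u′
      view-fun′ (B.direct p) (B.direct q) = inj₁-injective (trans (sym p) q)
      view-fun′ (B.direct p) (B.around q _) with () ← trans (sym p) q
      view-fun′ (B.around q _) (B.direct p) with () ← trans (sym p) q
      view-fun′ (B.around _ p) (B.around _ q) = inj₁-injective (trans (sym p) q)
    fu : ∀ {u v} → g v ≡ u → f u ≡ v
    fu p = trans (cong f (sym p)) (to-from (plain φ) _)
    view-sym⁻ : ∀ {u h} → B.View h u → A.View u h
    view-sym⁻ (B.direct p) = A.direct (fu p)
    view-sym⁻ (B.around p q) = A.around (fu q) (fu p)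

  cancel-one-to : V G → V H
  cancel-one-to u = proj₁ (A.image u)

  cancel-one-from : V H → V G
  cancel-one-from h = proj₁ (B.image h)

  cancel-one-to-from : ∀ h → cancel-one-to (cancel-one-from h) ≡ h
  cancel-one-to-from h = view-fun (proj₂ (A.image _)) (view-sym⁻ (proj₂ (B.image h)))

  cancel-one-from-to : ∀ u → cancel-one-from (cancel-one-to u) ≡ u
  cancel-one-from-to = ft

  cancel-one-view : ∀ u → Cancel₁.View φ u (cancel-one-to u)
  cancel-one-view u = proj₂ (A.image u)

-- The vertex mapped to the adjoined one, if any, is redirected to the image of the adjoined one.
⊕-cancel₁ : ∀ {G H} → BIso (G ⊕ 1) (H ⊕ 1) → BIso G H
⊕-cancel₁ {G} {H} φ = record
  { plain = record
    { to = cancel-one-to φ ; from = cancel-one-from φ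
    ; to-from = cancel-one-to-from φ ; from-to = cancel-one-from-to φ
    ; pres = λ {u} {v} → cancel-one-map φ (cancel-one-view φ u) (cancel-one-view φ v)
    ; reflects = λ {u} {v} p → cancel-one-map (biso-sym φ) (back u) (back v) p }
  ; base→ = λ {u} → cancel-one-base φ (cancel-one-view φ u)
  ; base← = λ {u} → cancel-one-base (biso-sym φ) (back u) }
  where
  back : ∀ u → Cancel₁.View (biso-sym φ) (cancel-one-to φ u) u
  back u = subst (Cancel₁.View (biso-sym φ) (cancel-one-to φ u)) (cancel-one-from-to φ u)
             (cancel-one-view (biso-sym φ) (cancel-one-to φ u))

⊕-cancel : ∀ {G H} n → BIso (G ⊕ n) (H ⊕ n) → BIso G H
⊕-cancel zero φ = biso-trans ⊕-zero (biso-trans φ (biso-sym ⊕-zero))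
⊕-cancel (suc n) φ = ⊕-cancel₁ (⊕-cancel n (biso-trans (biso-sym (⊕-+ 1 n)) (biso-trans φ (⊕-+ 1 n))))

twin-swap : ∀ (G : BGraph) (p q : V G) → (∀ {u} → Adj G p u → Adj G q u) → (∀ {u} → Adj G q u → Adj G p u) →
  Σ (Iso G G) λ σ → to σ p ≡ q × (∀ {u} → u ≢ p → u ≢ q → to σ u ≡ u)
twin-swap G p q pq qp = record
  { to = s ; from = s ; to-from = ss ; from-to = ss ; pres = λ {u} {v} → P u v
  ; reflects = λ {u} {v} e → subst₂ (Adj G) (ss u) (ss v) (P _ _ e) } ,
  s-p , s-other
  where
  s : V G → V G
  s u with _≟ᵛ_ G u p
  ... | yes _ = q
  ... | no _ with _≟ᵛ_ G u q
  ... | yes _ = p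
  ... | no _ = u
  s-p : s p ≡ q
  s-p with _≟ᵛ_ G p p
  ... | yes _ = refl
  ... | no n = ⊥-elim (n refl)
  s-q : s q ≡ p
  s-q with _≟ᵛ_ G q p
  ... | yes e = e
  ... | no _ with _≟ᵛ_ G q q
  ... | yes _ = refl
  ... | no n = ⊥-elim (n refl)
  s-other : ∀ {u} → u ≢ p → u ≢ q → s u ≡ u
  s-other {u} n m with _≟ᵛ_ G u p
  ... | yes e = ⊥-elim (n e)
  ... | no _ with _≟ᵛ_ G u q
  ... | yes e = ⊥-elim (m e)
  ... | no _ = refl
  ss : ∀ u → s (s u) ≡ u
  ss u with _≟ᵛ_ G u p
  ... | yes refl = s-q
  ... | no n with _≟ᵛ_ G u q
  ... | yes refl = s-p
  ... | no m = s-other n m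
  ¬pq : ¬ Adj G p q
  ¬pq e = irr G (pq e)
  P : ∀ u v → Adj G u v → Adj G (s u) (s v)
  P u v e with _≟ᵛ_ G u p | _≟ᵛ_ G v p
  ... | yes refl | yes refl = ⊥-elim (irr G e)
  ... | yes refl | no n with _≟ᵛ_ G v q
  ... | yes refl = ⊥-elim (¬pq e)
  ... | no _ = pq e
  P u v e | no n | yes refl with _≟ᵛ_ G u q
  ... | yes refl = ⊥-elim (¬pq (symm G e))
  ... | no _ = symm G (pq (symm G e))
  P u v e | no n | no m with _≟ᵛ_ G u q | _≟ᵛ_ G v q
  ... | yes refl | yes refl = ⊥-elim (irr G e)
  ... | yes refl | no _ = qp e
  ... | no _ | yes refl = symm G (qp (symm G e))
  ... | no _ | no _ = e

-- Every step respects the base, because only such steps persist after vertices have been adjoined;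
-- see `⊕-path`.
data BPath (G : BGraph) : BGraph → Set₁ where
  done : BPath G G
  up   : ∀ {H K x y z h} → BPath G H → BStar H K x y z h → BPath G K
  down : ∀ {H K x y z h} → BPath G H → BStar K H x y z h → BPath G K
  via  : ∀ {H K} → BPath G H → BIso H K → BPath G K

⊕-path : ∀ {G H} n → BPath G H → Path (G ⊕ n) (H ⊕ n)
⊕-path n done = done
⊕-path n (up p S) = up (⊕-path n p) (star (⊕-star n S))
⊕-path n (down p S) = down (⊕-path n p) (star (⊕-star n S))
⊕-path n (via p φ) = via (⊕-path n p) (plain (⊕-biso φ ↔-refl))

path-trans : ∀ {G H K} → Path G H → Path H K → Path G K
path-trans p done = p
path-trans p (up q S) = up (path-trans p q) S
path-trans p (down q S) = down (path-trans p q) S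
path-trans p (via q φ) = via (path-trans p q) φ

-- Families that are stable under adjoining vertices

-- The members for `d` are `core i ⊕ f i`. Keeping `f i` untouched vertices of the third part
-- outside the core lets them be treated like the `n` further ones. Configurations take `f i = 0`;
-- the explicit lists draw on this reserve.
module Stable {N : ℕ} (core : Fin N → BGraph) (f : Fin N → ℕ) where

  -- Here `k` is the number of reserved vertices that took no part in the move. The equation makes
  -- `H ⊕ k` a listed member again, and `H ⊕ (k + n)` one of the enlarged list.
  Target : ℕ → BGraph → Set
  Target k H = ∃ λ j → ∃ λ g → BIso H (core j ⊕ g) × g + k ≡ f j

  -- An adjoined vertex lies in a triangle only with two base vertices, and `base-size` keeps it
  -- from being removed; `base-degree` protects the base vertices in the same way. So only moves at
  -- the cores, with at most one reserved vertex, have to be controlled, and `n` does not occur.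
  record Closed : Set₁ where
    field
      close-up : ∀ i {x y z} → IsTriangle (core i) x y z →
        Σ BGraph λ H → ∃ λ h → BStar (core i) H x y z h × Target (f i) H
      close-new : ∀ i {x y} → Base (core i) x → Base (core i) y → Adj (core i) x y →
        ∃ (Full (core i)) ⊎
        (∃ λ f′ → f i ≡ suc f′ × Σ BGraph λ H → ∃ λ h →
           BStar (core i ⊕ 1) H (inj₁ x) (inj₁ y) (inj₂ zero) h × Target f′ H)
      close-down : ∀ i {v x y z} → ¬ Base (core i) v → IsY (core i) v x y z →
        Σ BGraph λ H → ∃ λ x′ → ∃ λ y′ → ∃ λ z′ → BStar H (core i) x′ y′ z′ v × Target (f i) H
      base-degree : ∀ i {v} → Base (core i) v → Has 4 (core i ⊕ f i) (inj₁ v)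
      base-size : ∀ i → ¬ ∃ λ x → ∃ λ y → ∃ λ z → x ≢ y × y ≢ z × x ≢ z ×
        Base (core i) x × Base (core i) y × Base (core i) z × (∀ u → Base (core i) u → In x y z u)

  module _ (C : Closed) (n : ℕ) where
    open Closed C

    L : Fin N → BGraph
    L i = core i ⊕ (f i + n)

    target : ∀ {k H} → ((j , _) : Target k H) → BIso (H ⊕ (k + n)) (L j)
    target {k} {H} (j , g , φ , e) = subst (λ m → BIso (H ⊕ (k + n)) (core j ⊕ m))
      (trans (sym (ℕₚ.+-assoc g k n)) (cong (_+ n) e))
      (biso-trans (⊕-biso φ ↔-refl) (biso-sym (⊕-+ g (k + n))))

    private
      nonadjacent : ∀ {i k l} → ¬ Adj (L i) (inj₂ k) (inj₂ l)
      nonadjacent ()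

      new-case : ∀ i {x y k H h} → Star (L i) H (inj₁ x) (inj₁ y) (inj₂ k) h → ∃ λ j → Iso H (L j)
      new-case i {x} {y} {k} {H} {h} S with tri S
      ... | xy , by , bx with close-new i bx by xy
      -- The core vertex `q` and the adjoined vertex have the same neighbours, namely the base.
      -- Swapping them moves the triangle into the core.
      ... | inj₁ (q , F) with twin-swap (L i) (inj₂ k) (inj₁ q) (λ {u} → pq {u}) (λ {u} → qp {u})
        where
        pq : ∀ {u} → Adj (L i) (inj₂ k) u → Adj (L i) (inj₁ q) u
        pq {inj₁ u} e = Full.full← F e
        qp : ∀ {u} → Adj (L i) (inj₁ q) u → Adj (L i) (inj₂ k) u
        qp {inj₁ u} e = Full.full→ F e
        qp {inj₂ u} e = ⊥-elim (Full.full-base F e)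
      ... | σ , σk , σ-other with close-up i {x} {y} {q} (xy , symm (core i) (Full.full← F by) , symm (core i) (Full.full← F bx))
      ... | H′ , h′ , S′ , T = proj₁ T ,
        iso-trans (star-iso σ S (star (⊕-star (f i + n) S′)) in→ in←) (plain (target T))
        where
        σ-base : ∀ {u} → Base (core i) u → to σ (inj₁ u) ≡ inj₁ u
        σ-base b = σ-other (λ ()) (λ { refl → Full.full-base F b })
        in→ : ∀ {u} → In (inj₁ x) (inj₁ y) (inj₂ k) u → In (inj₁ x) (inj₁ y) (inj₁ q) (to σ u)
        in→ (inj₁ refl) = inj₁ (σ-base bx)
        in→ (inj₂ (inj₁ refl)) = inj₂ (inj₁ (σ-base by))
        in→ (inj₂ (inj₂ refl)) = inj₂ (inj₂ σk)
        in← : ∀ {u} → In (inj₁ x) (inj₁ y) (inj₁ q) (to σ u) → In (inj₁ x) (inj₁ y) (inj₂ k) u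
        in← (inj₁ e) = inj₁ (to-injective σ (trans e (sym (σ-base bx))))
        in← (inj₂ (inj₁ e)) = inj₂ (inj₁ (to-injective σ (trans e (sym (σ-base by)))))
        in← (inj₂ (inj₂ e)) = inj₂ (inj₂ (to-injective σ (trans e (sym σk))))
      new-case i {x} {y} {k} {H} {h} S | xy , by , bx | inj₂ (f′ , fi , H′ , h′ , S′ , T) =
        proj₁ T , go (f i) fi k S
        where
        -- With no full vertex at hand, the adjoined vertex joins the core at the expense of the
        -- reserve. The number `f i` is generalised to `m`, so that its equation can be matched on.
        go : ∀ m → m ≡ suc f′ → (k : Fin (m + n)) →
          Star (core i ⊕ (m + n)) H (inj₁ x) (inj₁ y) (inj₂ k) h → Iso H (L (proj₁ T))
        go .(suc f′) refl k S = iso-trans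
          (star-iso φ S (star (⊕-star (f′ + n) S′)) in→ in←) (plain (target T))
          where
          φ = plain (⊕-extract {core i} k)
          in→ : ∀ {u} → In (inj₁ x) (inj₁ y) (inj₂ k) u → In (inj₁ (inj₁ x)) (inj₁ (inj₁ y)) (inj₁ (inj₂ zero)) (to φ u)
          in→ (inj₁ refl) = inj₁ refl
          in→ (inj₂ (inj₁ refl)) = inj₂ (inj₁ refl)
          in→ (inj₂ (inj₂ refl)) = inj₂ (inj₂ (⊕-extract-at {core i} k))
          in← : ∀ {u} → In (inj₁ (inj₁ x)) (inj₁ (inj₁ y)) (inj₁ (inj₂ zero)) (to φ u) → In (inj₁ x) (inj₁ y) (inj₂ k) u
          in← {u} (inj₁ e) = inj₁ (to-injective φ {u} {inj₁ x} e)
          in← {u} (inj₂ (inj₁ e)) = inj₂ (inj₁ (to-injective φ {u} {inj₁ y} e))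
          in← {u} (inj₂ (inj₂ e)) = inj₂ (inj₂ (to-injective φ (trans e (sym (⊕-extract-at {core i} k)))))

    up-closed : ∀ i {H x y z h} → Star (L i) H x y z h → ∃ λ j → Iso H (L j)
    up-closed i {x = inj₁ x} {inj₁ y} {inj₁ z} S with close-up i (tri S)
    ... | H′ , h′ , S′ , T = proj₁ T ,
      iso-trans (star-iso iso-refl S (star (⊕-star (f i + n) S′)) id id) (plain (target T))
    up-closed i {x = inj₁ x} {inj₁ y} {inj₂ k} S = new-case i S
    up-closed i {x = inj₁ x} {inj₂ k} {inj₁ z} S = new-case i (star-rotate (star-rotate S))
    up-closed i {x = inj₂ k} {inj₁ y} {inj₁ z} S = new-case i (star-rotate S)
    up-closed i {x = inj₁ x} {inj₂ k} {inj₂ l} S = ⊥-elim (nonadjacent {i} {k} {l} (proj₁ (proj₂ (tri S))))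
    up-closed i {x = inj₂ k} {inj₁ y} {inj₂ l} S = ⊥-elim (nonadjacent {i} {k} {l} (proj₂ (proj₂ (tri S))))
    up-closed i {x = inj₂ k} {inj₂ l} S = ⊥-elim (nonadjacent {i} {k} {l} (proj₁ (tri S)))

    private
      base-has4 : ∀ i {v} → Base (core i) v → Has 4 (L i) (inj₁ v)
      base-has4 i {v} b with base-degree i b
      ... | g , inj , a = has-iso {v = inj₁ (inj₁ v)} (iso-sym (plain (⊕-+ {core i} (f i) n)))
              (inj₁ ∘ g , inj ∘ inj₁-injective , a)

      -- Adjoined vertices are joined to base vertices only, so the three neighbours of a vertex
      -- outside the base lie in the core.
      isY-core : ∀ i {v x y z} → ¬ Base (core i) v → IsY (L i) (inj₁ v) x y z →
        ∃ λ x′ → ∃ λ y′ → ∃ λ z′ → IsY (core i) v x′ y′ z′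
      isY-core i {v} {inj₁ x} {inj₁ y} {inj₁ z} nb Y = x , y , z , record
        { x≢y = x≢y ∘ cong inj₁ ; y≢z = y≢z ∘ cong inj₁ ; x≢z = x≢z ∘ cong inj₁
        ; nbr→ = λ {u} p → In-unmap inj₁ inj₁-injective (nbr→ {inj₁ u} p)
        ; nbr← = λ {u} i → nbr← {inj₁ u} (In-map inj₁ i)
        ; ¬xy = ¬xy ; ¬yz = ¬yz ; ¬xz = ¬xz }
        where open IsY Y
      isY-core i {x = inj₂ k} nb Y = ⊥-elim (nb (IsY.nbr← Y {inj₂ k} in₁))
      isY-core i {y = inj₂ k} nb Y = ⊥-elim (nb (IsY.nbr← Y {inj₂ k} in₂))
      isY-core i {z = inj₂ k} nb Y = ⊥-elim (nb (IsY.nbr← Y {inj₂ k} in₃))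

      isY-new : ∀ i {k x y z} → ¬ IsY (L i) (inj₂ k) x y z
      isY-new i {k} {inj₁ x} {inj₁ y} {inj₁ z} Y = base-size i (x , y , z ,
        x≢y ∘ cong inj₁ , y≢z ∘ cong inj₁ , x≢z ∘ cong inj₁ ,
        nbr← {inj₁ x} in₁ , nbr← {inj₁ y} in₂ , nbr← {inj₁ z} in₃ ,
        λ u b → In-unmap inj₁ inj₁-injective (nbr→ {inj₁ u} b))
        where open IsY Y
      isY-new i {x = inj₂ l} Y = IsY.nbr← Y {inj₂ l} in₁
      isY-new i {y = inj₂ l} Y = IsY.nbr← Y {inj₂ l} in₂
      isY-new i {z = inj₂ l} Y = IsY.nbr← Y {inj₂ l} in₃

    down-closed : ∀ i {H x y z h} → Star H (L i) x y z h → ∃ λ j → Iso H (L j)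
    down-closed i {h = inj₂ k} S = ⊥-elim (isY-new i (star-isY S))
    down-closed i {h = inj₁ v} S with base? (core i) v
    ... | yes b = ⊥-elim (isY⇒¬has4 (star-isY S) (base-has4 i b))
    ... | no nb with isY-core i nb (star-isY S)
    ... | _ , _ , _ , Y with close-down i nb Y
    ... | H′ , _ , _ , _ , S′ , T = proj₁ T ,
      iso-trans (star-coiso iso-refl refl S (star (⊕-star (f i + n) S′))) (plain (target T))

  module _ (C : Closed) (i₀ : Fin N) (reach : ∀ i → BPath (core i₀ ⊕ f i₀) (core i ⊕ f i))
    (separated : ∀ n i j → Iso (core i ⊕ f i ⊕ n) (core j ⊕ f j ⊕ n) → BIso (core i ⊕ f i) (core j ⊕ f j)) where

    private
      _~_ : Fin N → Fin N → Set
      i ~ j = BIso (core i ⊕ f i) (core j ⊕ f j)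
      module R = Representatives _~_ (λ i j → biso? _ _) (λ _ → biso-refl) biso-sym

      split : ∀ n i → BIso (L C n i) (core i ⊕ f i ⊕ n)
      split n i = ⊕-+ (f i) n

    -- Taken from the relation between the graphs for `d`, before any `n` is introduced; this is the
    -- common size of all the families.
    class-count : ℕ
    class-count = R.size R.classes

    stable-family : ∀ n G (sG : IsSimple G) → Iso (simple-graph G sG) (core i₀ ⊕ (f i₀ + n)) → FamilySize G class-count
    stable-family n G sG begin = Closure.family-size G sG (L C n) i₀ begin (up-closed C n) (down-closed C n)
      (λ i → path-trans (via done (plain (split n i₀))) (via (⊕-path n (reach i)) (iso-sym (plain (split n i)))))
      _~_ (λ i j → biso? _ _) (λ _ → biso-refl) biso-sym
      (λ {i} {j} e → iso-trans (plain (split n i)) (iso-trans (plain (⊕-biso e ↔-refl)) (iso-sym (plain (split n j)))))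
      (λ {i} {j} e → separated n i j (iso-trans (iso-sym (plain (split n i))) (iso-trans e (plain (split n j)))))

-- Recognising the base by degrees

-- A degree threshold between the base and the rest. The bound on the size of the base makes the
-- condition survive adjoining, since that size is the degree of an adjoined vertex.
record Graded (D : ℕ) (G : BGraph) : Set where
  field
    base-many    : ∀ {v} → Base G v → Has (suc D) G v
    nonbase-few  : ∀ {v} → ¬ Base G v → ¬ Has (suc D) G v
    base-bounded : (g : Fin (suc D) → V G) → (∀ {i j} → g i ≡ g j → i ≡ j) → ¬ (∀ i → Base G (g i))

open Graded public

⊕-graded : ∀ {D G} n → Graded D G → Graded D (G ⊕ n)
⊕-graded {D} {G} n Γ = record
  { base-many = λ { {inj₁ v} b → let (g , inj , a) = base-many Γ b in inj₁ ∘ g , inj ∘ inj₁-injective , a }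
  ; nonbase-few = λ { {inj₁ v} nb (g , inj , a) → few nb g inj a
                    ; {inj₂ k} nb (g , inj , a) → bounded g inj (λ i → bs (g i) (a i)) }
  ; base-bounded = bounded }
  where
  un : (s : V (G ⊕ n)) → Base (G ⊕ n) s → ∃ λ u → inj₁ u ≡ s
  un (inj₁ u) b = u , refl
  bounded : (g : Fin (suc D) → V (G ⊕ n)) → (∀ {i j} → g i ≡ g j → i ≡ j) → ¬ (∀ i → Base (G ⊕ n) (g i))
  bounded g inj b = base-bounded Γ (λ i → proj₁ (un (g i) (b i)))
    (λ {i} {j} e → inj (trans (sym (proj₂ (un (g i) (b i)))) (trans (cong inj₁ e) (proj₂ (un (g j) (b j))))))
    (λ i → subst (Base (G ⊕ n)) (sym (proj₂ (un (g i) (b i)))) (b i))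
  bs : ∀ {k} s → Adj (G ⊕ n) (inj₂ k) s → Base (G ⊕ n) s
  bs (inj₁ u) p = p
  few : ∀ {v} → ¬ Base G v → (g : Fin (suc D) → V (G ⊕ n)) → (∀ {i j} → g i ≡ g j → i ≡ j) →
    ¬ (∀ i → Adj (G ⊕ n) (inj₁ v) (g i))
  few {v} nb g inj a = nonbase-few Γ nb
    ((λ i → proj₁ (un′ (g i) (a i))) ,
     (λ {i} {j} e → inj (trans (sym (proj₂ (un′ (g i) (a i)))) (trans (cong inj₁ e) (proj₂ (un′ (g j) (a j)))))) ,
     (λ i → subst (Adj (G ⊕ n) (inj₁ v)) (sym (proj₂ (un′ (g i) (a i)))) (a i)))
    where
    un′ : ∀ s → Adj (G ⊕ n) (inj₁ v) s → ∃ λ u → inj₁ u ≡ s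
    un′ (inj₁ u) p = u , refl
    un′ (inj₂ k) p = ⊥-elim (nb p)

graded-biso : ∀ {D G H} → Graded D G → Graded D H → Iso G H → BIso G H
graded-biso {D} {G} {H} Γ Δ φ = record { plain = φ ; base→ = b→ ; base← = b← }
  where
  b→ : ∀ {u} → Base G u → Base H (to φ u)
  b→ {u} b with base? H (to φ u)
  ... | yes c = c
  ... | no n = ⊥-elim (nonbase-few Δ n (has-iso φ (base-many Γ b)))
  b← : ∀ {u} → Base H (to φ u) → Base G u
  b← {u} b with base? G u
  ... | yes c = c
  ... | no n = ⊥-elim (nonbase-few Γ n (subst (Has (suc D) G) (from-to φ u) (has-iso (iso-sym φ) (base-many Δ b))))

graded-separated : ∀ {D G H} → Graded D G → Graded D H → ∀ n → Iso (G ⊕ n) (H ⊕ n) → BIso G H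
graded-separated Γ Δ n φ = ⊕-cancel n (graded-biso (⊕-graded n Γ) (⊕-graded n Δ) φ)

bstar-transport : ∀ {G G′ H x y z h} (φ : BIso G G′) → BStar G H x y z h →
  BStar G′ H (to (plain φ) x) (to (plain φ) y) (to (plain φ) z) h
bstar-transport φ B = record
  { star = star-transport (plain φ) (star B)
  ; old-base→ = old-base→ B ∘ base→ (biso-sym φ)
  ; old-base← = base← (biso-sym φ) ∘ old-base← B
  ; hub-base = hub-base B }

bstar-resp : ∀ {G H x y z x′ y′ z′ h} → (∀ {u} → In x y z u → In x′ y′ z′ u) → (∀ {u} → In x′ y′ z′ u → In x y z u) →
  IsTriangle G x′ y′ z′ → BStar G H x y z h → BStar G H x′ y′ z′ h
bstar-resp f g t B = record
  { star = star-resp f g t (star B) ; old-base→ = old-base→ B ; old-base← = old-base← B ; hub-base = hub-base B }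

-- Families given by finitely many checked codes

allBelow : ℕ → (ℕ → Bool) → Bool
allBelow zero f = true
allBelow (suc n) f = f n ∧ allBelow n f

allBelow-sound : ∀ n {f} → allBelow n f ≡ true → ∀ {k} → k < n → f k ≡ true
allBelow-sound (suc n) {f} p {k} (s≤s k≤n) with ℕₚ.m≤n⇒m<n∨m≡n k≤n
... | inj₁ k<n = allBelow-sound n (proj₂ (∧-true {f n} p)) k<n
... | inj₂ refl = proj₁ (∧-true p)

<ᵇ-true : ∀ {m n} → (m <ᵇ n) ≡ true → m < n
<ᵇ-true {m} {n} p = ℕₚ.<ᵇ⇒< m n (subst Bool.T (sym p) _)

true-<ᵇ : ∀ {m n} → m < n → (m <ᵇ n) ≡ true
true-<ᵇ {m} {n} p with m <ᵇ n | ℕₚ.<⇒<ᵇ p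
... | true | _ = refl

≤ᵇ-true : ∀ {m n} → (m ≤ᵇ n) ≡ true → m ≤ n
≤ᵇ-true {m} {n} p = ℕₚ.≤ᵇ⇒≤ m n (subst Bool.T (sym p) _)

≡ᵇ-true : ∀ {m n} → (m ≡ᵇ n) ≡ true → m ≡ n
≡ᵇ-true {m} {n} p = ℕₚ.≡ᵇ⇒≡ m n (subst Bool.T (sym p) _)

true-≡ᵇ : ∀ {m n} → m ≡ n → (m ≡ᵇ n) ≡ true
true-≡ᵇ {zero} refl = refl
true-≡ᵇ {suc m} refl = true-≡ᵇ {m} refl

_⇒ᵇ_ : Bool → Bool → Bool
b ⇒ᵇ c = if b then c else true

⇒ᵇ-true : ∀ {b c} → (b ⇒ᵇ c) ≡ true → b ≡ true → c ≡ true
⇒ᵇ-true p refl = p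

eqᵇ : Bool → Bool → Bool
eqᵇ true c = c
eqᵇ false c = not c

eqᵇ-true : ∀ {b c} → eqᵇ b c ≡ true → b ≡ c
eqᵇ-true {true} p = sym p
eqᵇ-true {false} {false} p = refl

-- The third component replaces membership: whatever has been verified for the whole list holds for
-- the element found.
any-true : ∀ {A : Set} (f : A → Bool) xs → any f xs ≡ true → ∃ λ x → f x ≡ true × (∀ g → all g xs ≡ true → g x ≡ true)
any-true f (x ∷ xs) p with f x in e
... | true = x , e , λ g q → proj₁ (∧-true q)
... | false with any-true f xs p
... | y , fy , h = y , fy , λ g q → h g (proj₂ (∧-true {g x} q))

sort₃ : ∀ {n} (x y z : Fin n) → x ≢ y → y ≢ z → x ≢ z → ∃ λ x′ → ∃ λ y′ → ∃ λ z′ →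
  toℕ x′ < toℕ y′ × toℕ y′ < toℕ z′ × (∀ {u} → In x y z u → In x′ y′ z′ u) × (∀ {u} → In x′ y′ z′ u → In x y z u)
sort₃ x y z x≢y y≢z x≢z with ℕₚ.<-cmp (toℕ x) (toℕ y) | ℕₚ.<-cmp (toℕ y) (toℕ z) | ℕₚ.<-cmp (toℕ x) (toℕ z)
... | tri≈ _ e _ | _ | _ = ⊥-elim (x≢y (Finₚ.toℕ-injective e))
... | _ | tri≈ _ e _ | _ = ⊥-elim (y≢z (Finₚ.toℕ-injective e))
... | _ | _ | tri≈ _ e _ = ⊥-elim (x≢z (Finₚ.toℕ-injective e))
... | tri< p _ _ | tri< q _ _ | _ = x , y , z , p , q , id , id
... | tri< p _ _ | tri> _ _ q | tri< r _ _ = x , z , y , r , q , In-swap ∘ In-rotate ∘ In-rotate , In-swap ∘ In-rotate ∘ In-rotate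
... | tri< p _ _ | tri> _ _ q | tri> _ _ r = z , x , y , r , p , In-rotate ∘ In-rotate , In-rotate
... | tri> _ _ p | tri< q _ _ | tri< r _ _ = y , x , z , p , r , In-swap , In-swap
... | tri> _ _ p | tri< q _ _ | tri> _ _ r = y , z , x , q , r , In-rotate , In-rotate ∘ In-rotate
... | tri> _ _ p | tri> _ _ q | _ = z , y , x , q , p , In-swap ∘ In-rotate , In-swap ∘ In-rotate

counting : ℕ → (ℕ → Bool) → ℕ
counting zero f = 0
counting (suc n) f = if f n then suc (counting n f) else counting n f

-- The number of hits below a hit `k` serves as the rank of `k`. Ranks increase strictly from hit to
-- hit, which gives the injection behind `counting-injection`.
rank< : ∀ n f {k} → k < n → f k ≡ true → counting k f < counting n f
rank< (suc n) f {k} (s≤s k≤n) p with ℕₚ.m≤n⇒m<n∨m≡n k≤n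
... | inj₂ refl rewrite p = ℕₚ.n<1+n _
... | inj₁ k<n with f n
... | true = ℕₚ.m<n⇒m<1+n (rank< n f k<n p)
... | false = rank< n f k<n p

counting-injection : ∀ {k n} f (g : Fin k → Fin n) → (∀ {i j} → g i ≡ g j → i ≡ j) →
  (∀ i → f (toℕ (g i)) ≡ true) → k ≤ counting n f
counting-injection {k} {n} f g inj a with k ℕ.≤? counting n f
... | yes p = p
... | no p with Finₚ.pigeonhole (ℕₚ.≰⇒> p) (λ i → fromℕ< (rank< n f (Finₚ.toℕ<n (g i)) (a i)))
... | i , j , i<j , e = ⊥-elim (ℕₚ.<⇒≢ i<j (cong toℕ (inj (Finₚ.toℕ-injective (rank-injective
      (trans (sym (Finₚ.toℕ-fromℕ< _)) (trans (cong toℕ e) (Finₚ.toℕ-fromℕ< _))))))))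
  where
  rank-injective : ∀ {i j} → counting (toℕ (g i)) f ≡ counting (toℕ (g j)) f → toℕ (g i) ≡ toℕ (g j)
  rank-injective {i} {j} e with ℕₚ.<-cmp (toℕ (g i)) (toℕ (g j))
  ... | tri≈ _ q _ = q
  ... | tri< q _ _ = ⊥-elim (ℕₚ.<⇒≢ (rank< _ f q (a i)) e)
  ... | tri> _ _ q = ⊥-elim (ℕₚ.<⇒≢ (rank< _ f q (a j)) (sym e))

injection-counting : ∀ n f k → k ≤ counting n f →
  Σ (Fin k → Fin n) λ g → (∀ {i j} → g i ≡ g j → i ≡ j) × (∀ i → f (toℕ (g i)) ≡ true)
injection-counting n f zero p = (λ ()) , (λ { {()} }) , λ ()
injection-counting (suc n) f (suc k) p with f n in e
... | false with injection-counting n f (suc k) p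
... | g , inj , a = Fin.inject₁ ∘ g , inj ∘ Finₚ.inject₁-injective ,
      λ i → trans (cong f (Finₚ.toℕ-inject₁ (g i))) (a i)
injection-counting (suc n) f (suc k) (s≤s p) | true with injection-counting n f k p
... | g , inj , a = g′ , (λ {i} {j} → inj′ i j) , a′
  where
  g′ : Fin (suc k) → Fin (suc n)
  g′ zero = Fin.fromℕ n
  g′ (suc i) = Fin.inject₁ (g i)
  inj′ : ∀ i j → g′ i ≡ g′ j → i ≡ j
  inj′ zero zero _ = refl
  inj′ zero (suc j) q = ⊥-elim (Finₚ.fromℕ≢inject₁ q)
  inj′ (suc i) zero q = ⊥-elim (Finₚ.fromℕ≢inject₁ (sym q))
  inj′ (suc i) (suc j) q = cong suc (inj (Finₚ.inject₁-injective q))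
  a′ : ∀ i → f (toℕ (g′ i)) ≡ true
  a′ zero = trans (cong f (Finₚ.toℕ-fromℕ n)) e
  a′ (suc i) = trans (cong f (Finₚ.toℕ-inject₁ (g i))) (a i)
injection-counting zero f (suc k) ()

bit : ℕ → ℕ → Bool
bit m zero = (m % 2) ≡ᵇ 1
bit m (suc k) = bit (m / 2) k

digit : ℕ → ℕ → ℕ
digit p zero = p % 32
digit p (suc k) = digit (p / 32) k

nth : {A : Set} → A → List A → ℕ → A
nth d [] _ = d
nth d (x ∷ xs) zero = x
nth d (x ∷ xs) (suc k) = nth d xs k

nth-beyond : {A : Set} (d : A) (xs : List A) {k : ℕ} → length xs ≤ k → nth d xs k ≡ d
nth-beyond d [] p = refl
nth-beyond d (x ∷ xs) (s≤s p) = nth-beyond d xs p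

-- A ∇Y move at the vertices x, y, z.  The base-32 digits of perm are the names, in the resulting
-- graph, of the vertices of the original graph in order, followed by that of the new vertex.
-- For an element of ups the target is the resulting graph, for one of downs the original one.
record Cert : Set where
  constructor cert
  field
    x y z target perm : ℕ

-- Row v is the bit mask of the neighbours u < v of v.  The vertices below w form the base,
-- all vertices beyond the given rows are joined to exactly the base, and free is the number of
-- the latter in the member of the family of K a b d.
record Code : Set where
  constructor code
  field
    rows  : List ℕ
    free  : ℕ
    ups   : List Cert
    downs : List Cert

module Coded (w mask : ℕ) (mask-bits : ∀ {u} → bit mask u ≡ true → u < w) (bits-mask : ∀ {u} → u < w → bit mask u ≡ true) where

  open Code
  private module C = Cert

  order : Code → ℕ
  order c = length (rows c)

  lower : Code → ℕ → ℕ → Bool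
  lower c u v = bit (nth mask (rows c) v) u

  edge : Code → ℕ → ℕ → Bool
  edge c u v = if u <ᵇ v then lower c u v else (if v <ᵇ u then lower c v u else false)

  edge-lower : ∀ c {u v} → u < v → edge c u v ≡ lower c u v
  edge-lower c {u} {v} p rewrite true-<ᵇ p = refl

  <ᵇ-false : ∀ {u v} → ¬ (u < v) → (u <ᵇ v) ≡ false
  <ᵇ-false {u} {v} n with u <ᵇ v in e
  ... | true = ⊥-elim (n (<ᵇ-true e))
  ... | false = refl

  edge-sym : ∀ c u v → edge c u v ≡ edge c v u
  edge-sym c u v with ℕₚ.<-cmp u v
  ... | tri< p _ q rewrite true-<ᵇ p | <ᵇ-false q = refl
  ... | tri≈ _ refl _ = refl
  ... | tri> q _ p rewrite true-<ᵇ p | <ᵇ-false q = refl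

  edge-irr : ∀ c u → edge c u u ≡ false
  edge-irr c u rewrite <ᵇ-false (ℕₚ.<-irrefl {u} refl) = refl

  -- A code describes an infinite graph, of which this is an initial segment. Adjoining vertices
  -- amounts to lengthening the segment, as `seg-⊕` shows.
  seg : Code → ℕ → BGraph
  seg c m = record
    { V = Fin m ; card = m ; enum = ↔-refl
    ; Adj = λ u v → edge c (toℕ u) (toℕ v) ≡ true ; adj? = λ u v → _ Bool.≟ true
    ; symm = λ {u} {v} p → trans (edge-sym c (toℕ v) (toℕ u)) p
    ; irr = λ {v} p → t≢f p (edge-irr c (toℕ v))
    ; Base = λ u → toℕ u < w ; base? = λ u → toℕ u ℕ.<? w }

  edge-old-new : ∀ c {u v} → order c ≤ v → w ≤ v → u < v → edge c u v ≡ true → u < w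
  edge-old-new c {u} o≤v w≤v u<v e = mask-bits (trans (cong (λ r → bit r u) (sym (nth-beyond mask (rows c) o≤v)))
    (trans (sym (edge-lower c u<v)) e))

  old-new-edge : ∀ c {u v} → order c ≤ v → w ≤ v → u < w → edge c u v ≡ true
  old-new-edge c {u} o≤v w≤v u<w = trans (edge-lower c (ℕₚ.<-≤-trans u<w w≤v))
    (trans (cong (λ r → bit r u) (nth-beyond mask (rows c) o≤v)) (bits-mask u<w))

  seg-⊕ : ∀ c s p → order c ≤ s → w ≤ s → BIso (seg c s ⊕ p) (seg c (s + p))
  seg-⊕ c s p o≤s w≤s = record
    { plain = record
      { to = Fin.join s p ; from = splitAt s
      ; to-from = Finₚ.join-splitAt s p ; from-to = Finₚ.splitAt-join s p
      ; pres = λ {u} {v} → P u v ; reflects = λ {u} {v} → R u v }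
    ; base→ = λ { {inj₁ u} b → subst (_< w) (sym (Finₚ.toℕ-↑ˡ u p)) b }
    ; base← = λ { {inj₁ u} b → subst (_< w) (Finₚ.toℕ-↑ˡ u p) b
                ; {inj₂ k} b → ⊥-elim (ℕₚ.<⇒≱ b (ℕₚ.≤-trans w≤s (beyond k))) } }
    where
    beyond : ∀ k → s ≤ toℕ (s ↑ʳ k)
    beyond k = subst (s ≤_) (sym (Finₚ.toℕ-↑ʳ s k)) (ℕₚ.m≤m+n s _)
    below : ∀ u k → toℕ (u ↑ˡ p) < toℕ (s ↑ʳ k)
    below u k = ℕₚ.<-≤-trans (subst (_< s) (sym (Finₚ.toℕ-↑ˡ u p)) (Finₚ.toℕ<n u)) (beyond k)
    inj₁-inj₂ : ∀ u k → toℕ u < w → edge c (toℕ (u ↑ˡ p)) (toℕ (s ↑ʳ k)) ≡ true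
    inj₁-inj₂ u k b = old-new-edge c (ℕₚ.≤-trans o≤s (beyond k)) (ℕₚ.≤-trans w≤s (beyond k))
      (subst (_< w) (sym (Finₚ.toℕ-↑ˡ u p)) b)
    inj₁-inj₂⁻ : ∀ u k → edge c (toℕ (u ↑ˡ p)) (toℕ (s ↑ʳ k)) ≡ true → toℕ u < w
    inj₁-inj₂⁻ u k e = subst (_< w) (Finₚ.toℕ-↑ˡ u p)
      (edge-old-new c (ℕₚ.≤-trans o≤s (beyond k)) (ℕₚ.≤-trans w≤s (beyond k)) (below u k) e)
    P : ∀ u v → Adj (seg c s ⊕ p) u v → Adj (seg c (s + p)) (Fin.join s p u) (Fin.join s p v)
    P (inj₁ u) (inj₁ v) e = subst₂ (λ i j → edge c i j ≡ true) (sym (Finₚ.toℕ-↑ˡ u p)) (sym (Finₚ.toℕ-↑ˡ v p)) e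
    P (inj₁ u) (inj₂ k) b = inj₁-inj₂ u k b
    P (inj₂ k) (inj₁ u) b = trans (edge-sym c (toℕ (s ↑ʳ k)) _) (inj₁-inj₂ u k b)
    R : ∀ u v → Adj (seg c (s + p)) (Fin.join s p u) (Fin.join s p v) → Adj (seg c s ⊕ p) u v
    R (inj₁ u) (inj₁ v) e = subst₂ (λ i j → edge c i j ≡ true) (Finₚ.toℕ-↑ˡ u p) (Finₚ.toℕ-↑ˡ v p) e
    R (inj₁ u) (inj₂ k) e = inj₁-inj₂⁻ u k e
    R (inj₂ k) (inj₁ u) e = inj₁-inj₂⁻ u k (trans (edge-sym c _ (toℕ (s ↑ʳ k))) e)
    R (inj₂ k) (inj₂ l) e with ℕₚ.<-cmp (toℕ (s ↑ʳ k)) (toℕ (s ↑ʳ l))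
    ... | tri< q _ _ = ℕₚ.<⇒≱ (edge-old-new c (ℕₚ.≤-trans o≤s (beyond l)) (ℕₚ.≤-trans w≤s (beyond l)) q e)
                         (ℕₚ.≤-trans w≤s (beyond k))
    ... | tri≈ _ q _ = irr (seg c (s + p)) {s ↑ʳ k} (trans (cong (edge c (toℕ (s ↑ʳ k))) q) e)
    ... | tri> _ _ q = ℕₚ.<⇒≱ (edge-old-new c (ℕₚ.≤-trans o≤s (beyond k)) (ℕₚ.≤-trans w≤s (beyond k)) q
                                (trans (edge-sym c (toℕ (s ↑ʳ l)) (toℕ (s ↑ʳ k))) e))
                         (ℕₚ.≤-trans w≤s (beyond l))

  seg-eq : ∀ {c m n} → m ≡ n → BIso (seg c m) (seg c n)
  seg-eq refl = biso-refl

  degree : Code → ℕ → ℕ → ℕ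
  degree c m v = counting m (edge c v)

  has-degree : ∀ c m {k} (v : Fin m) → k ≤ degree c m (toℕ v) → Has k (seg c m) v
  has-degree c m v p = injection-counting m (edge c (toℕ v)) _ p

  degree-has : ∀ c m {k} (v : Fin m) → Has k (seg c m) v → k ≤ degree c m (toℕ v)
  degree-has c m v (g , inj , a) = counting-injection _ g inj a

  member : ℕ → ℕ → ℕ → ℕ → Bool
  member x y z u = (u ≡ᵇ x) ∨ (u ≡ᵇ y) ∨ (u ≡ᵇ z)

  -- A preimage under the renaming, found by search. In `star?` it certifies injectivity and, for
  -- all names but that of the hub, surjectivity; the default 0 is harmless there, because each
  -- value is checked.
  inverse : ℕ → ℕ → ℕ → ℕ
  inverse p zero v = 0
  inverse p (suc k) v = if v ≡ᵇ digit p k then k else inverse p k v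

  star? : (a b : Code) (m x y z p : ℕ) → Bool
  star? a b m x y z p =
    (x <ᵇ m) ∧ (y <ᵇ m) ∧ (z <ᵇ m) ∧ edge a x y ∧ edge a y z ∧ edge a x z ∧
    (digit p m <ᵇ suc m) ∧ not (digit p m <ᵇ w) ∧
    allBelow m (λ u → let o = digit p u ; i = member x y z u in
      (o <ᵇ suc m) ∧ not (o ≡ᵇ digit p m) ∧ (inverse p m o ≡ᵇ u) ∧ eqᵇ (o <ᵇ w) (u <ᵇ w) ∧ eqᵇ (edge b (digit p m) o) i ∧
      -- Pairs are tested with `v` below `u` only; `pairs` obtains the others by symmetry.
      allBelow u (λ v → eqᵇ (edge b (digit p v) o) (edge a v u ∧ not (i ∧ member x y z v)))) ∧
    allBelow (suc m) (λ v → (v ≡ᵇ digit p m) ∨ ((inverse p m v <ᵇ m) ∧ (digit p (inverse p m v) ≡ᵇ v)))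

  record StarOK (a b : Code) (m x y z p : ℕ) : Set where
    constructor checked
    field
      holds : star? a b m x y z p ≡ true

  module StarSound {a b : Code} {m x y z p : ℕ} (σ : StarOK a b m x y z p)
    (X Y Z : Fin m) (eX : toℕ X ≡ x) (eY : toℕ Y ≡ y) (eZ : toℕ Z ≡ z) where

    private
      k₁ = proj₂ (∧-true {x <ᵇ m} (StarOK.holds σ))
      k₂ = proj₂ (∧-true {y <ᵇ m} k₁)
      k₃ = proj₂ (∧-true {z <ᵇ m} k₂)
      exy = ∧-true {edge a x y} k₃
      eyz = ∧-true {edge a y z} (proj₂ exy)
      exz = ∧-true {edge a x z} (proj₂ eyz)
      hub< = ∧-true {digit p m <ᵇ suc m} (proj₂ exz)
      hubw = ∧-true {not (digit p m <ᵇ w)} (proj₂ hub<)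
      ends = ∧-true {allBelow m _} (proj₂ hubw)

      module At {u} (u<m : u < m) where
        c₀ = allBelow-sound m (proj₁ ends) u<m
        o<  = ∧-true {digit p u <ᵇ suc m} c₀
        o≢  = ∧-true {not (digit p u ≡ᵇ digit p m)} (proj₂ o<)
        inv = ∧-true {inverse p m (digit p u) ≡ᵇ u} (proj₂ o≢)
        bas = ∧-true {eqᵇ (digit p u <ᵇ w) (u <ᵇ w)} (proj₂ inv)
        hb  = ∧-true {eqᵇ (edge b (digit p m) (digit p u)) (member x y z u)} (proj₂ bas)

      member-true : ∀ {u : Fin m} → member x y z (toℕ u) ≡ true → In X Y Z u
      member-true {u} q with ∨-true {toℕ u ≡ᵇ x} q
      ... | inj₁ r = inj₁ (Finₚ.toℕ-injective (trans (≡ᵇ-true r) (sym eX)))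
      ... | inj₂ q′ with ∨-true {toℕ u ≡ᵇ y} q′
      ... | inj₁ r = inj₂ (inj₁ (Finₚ.toℕ-injective (trans (≡ᵇ-true r) (sym eY))))
      ... | inj₂ r = inj₂ (inj₂ (Finₚ.toℕ-injective (trans (≡ᵇ-true r) (sym eZ))))

      true-member : ∀ {u : Fin m} → In X Y Z u → member x y z (toℕ u) ≡ true
      true-member {u} (inj₁ refl) = true-∨ˡ (true-≡ᵇ eX)
      true-member {u} (inj₂ (inj₁ refl)) = true-∨ʳ {toℕ u ≡ᵇ x} (true-∨ˡ (true-≡ᵇ eY))
      true-member {u} (inj₂ (inj₂ refl)) = true-∨ʳ {toℕ u ≡ᵇ x} (true-∨ʳ {toℕ u ≡ᵇ y} (true-≡ᵇ eZ))

      o : Fin m → Fin (suc m)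
      o u = fromℕ< (<ᵇ-true {digit p (toℕ u)} (proj₁ (At.o< (Finₚ.toℕ<n u))))

      toℕ-o : ∀ u → toℕ (o u) ≡ digit p (toℕ u)
      toℕ-o u = Finₚ.toℕ-fromℕ< _

    hub : Fin (suc m)
    hub = fromℕ< (<ᵇ-true {digit p m} (proj₁ hub<))

    toℕ-hub : toℕ hub ≡ digit p m
    toℕ-hub = Finₚ.toℕ-fromℕ< _

    private
      pair : ∀ u v → toℕ v < toℕ u → edge b (toℕ (o v)) (toℕ (o u)) ≡
        (edge a (toℕ v) (toℕ u) ∧ not (member x y z (toℕ u) ∧ member x y z (toℕ v)))
      pair u v v<u = trans (cong₂ (edge b) (toℕ-o v) (toℕ-o u))
        (eqᵇ-true (allBelow-sound (toℕ u) (proj₂ (At.hb (Finₚ.toℕ<n u))) v<u))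

      Old : Fin m → Fin m → Set
      Old u v = edge b (toℕ (o u)) (toℕ (o v)) ≡ edge a (toℕ u) (toℕ v) ∧ not (member x y z (toℕ u) ∧ member x y z (toℕ v))

      pairs : ∀ u v → Old u v
      pairs u v with ℕₚ.<-cmp (toℕ u) (toℕ v)
      ... | tri< p _ _ = trans (pair v u p) (cong (λ r → edge a (toℕ u) (toℕ v) ∧ not r) (Boolₚ.∧-comm (member x y z (toℕ v)) _))
      ... | tri> _ _ p = trans (edge-sym b (toℕ (o u)) (toℕ (o v))) (trans (pair u v p)
              (cong (_∧ not (member x y z (toℕ u) ∧ member x y z (toℕ v))) (edge-sym a (toℕ v) (toℕ u))))
      ... | tri≈ _ q _ with Finₚ.toℕ-injective q
      ... | refl rewrite edge-irr b (toℕ (o u)) | edge-irr a (toℕ u) = refl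

      hubs : ∀ u → edge b (toℕ hub) (toℕ (o u)) ≡ member x y z (toℕ u)
      hubs u = trans (cong₂ (edge b) toℕ-hub (toℕ-o u)) (eqᵇ-true (proj₁ (At.hb (Finₚ.toℕ<n u))))

      cover′ : ∀ v → v ≡ hub ⊎ ∃ λ u → o u ≡ v
      cover′ v with ∨-true {toℕ v ≡ᵇ digit p m} (allBelow-sound (suc m) (proj₂ ends) (Finₚ.toℕ<n v))
      ... | inj₁ q = inj₁ (Finₚ.toℕ-injective (trans (≡ᵇ-true q) (sym toℕ-hub)))
      ... | inj₂ q with ∧-true {inverse p m (toℕ v) <ᵇ m} q
      ... | q₁ , q₂ = inj₂ (fromℕ< (<ᵇ-true {inverse p m (toℕ v)} q₁) , Finₚ.toℕ-injective
            (trans (toℕ-o (fromℕ< (<ᵇ-true {inverse p m (toℕ v)} q₁)))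
              (trans (cong (digit p) (Finₚ.toℕ-fromℕ< (<ᵇ-true {inverse p m (toℕ v)} q₁))) (≡ᵇ-true q₂))))

      same : ∀ u → (toℕ (o u) <ᵇ w) ≡ (toℕ u <ᵇ w)
      same u = trans (cong (_<ᵇ w) (toℕ-o u)) (eqᵇ-true (proj₁ (At.bas (Finₚ.toℕ<n u))))

      xy′ : edge a (toℕ X) (toℕ Y) ≡ true
      xy′ = trans (cong₂ (edge a) eX eY) (proj₁ exy)
      yz′ : edge a (toℕ Y) (toℕ Z) ≡ true
      yz′ = trans (cong₂ (edge a) eY eZ) (proj₁ eyz)
      xz′ : edge a (toℕ X) (toℕ Z) ≡ true
      xz′ = trans (cong₂ (edge a) eX eZ) (proj₁ exz)

    bstar : BStar (seg a m) (seg b (suc m)) X Y Z hub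
    bstar = record
      { star = record
        { tri = xy′ , yz′ , xz′
        ; old = o
        ; old-inj = λ {u} {v} e → Finₚ.toℕ-injective (trans (sym (≡ᵇ-true (proj₁ (At.inv (Finₚ.toℕ<n u)))))
            (trans (cong (inverse p m) (trans (sym (toℕ-o u)) (trans (cong toℕ e) (toℕ-o v)))) (≡ᵇ-true (proj₁ (At.inv (Finₚ.toℕ<n v))))))
        ; old≢hub = λ {u} e → not-true (proj₁ (At.o≢ (Finₚ.toℕ<n u)))
            (true-≡ᵇ (trans (sym (toℕ-o u)) (trans (cong toℕ e) toℕ-hub)))
        ; cover = cover′
        ; hub→ = λ {u} e → member-true (trans (sym (hubs u)) e)
        ; hub← = λ {u} i → trans (hubs u) (true-member i)
        ; old→ = λ {u} {v} e → let q = ∧-true {edge a (toℕ u) (toℕ v)} (trans (sym (pairs u v)) e) in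
            proj₁ q , λ { (i , j) → not-true (proj₂ q) (true-∧ (true-member i) (true-member j)) }
        ; old← = λ {u} {v} e n → trans (pairs u v) (true-∧ e (true-not (λ q → n
            (member-true (proj₁ (∧-true q)) , member-true (proj₂ (∧-true {member x y z (toℕ u)} q)))))) }
      ; old-base→ = λ {u} b → <ᵇ-true (trans (same u) (true-<ᵇ b))
      ; old-base← = λ {u} b → <ᵇ-true (trans (sym (same u)) (true-<ᵇ b))
      ; hub-base = λ b → not-true (proj₁ hubw) (true-<ᵇ (subst (_< w) toℕ-hub b)) }

  star-bounds : ∀ {a b m x y z p} → StarOK a b m x y z p → x < m × y < m × z < m
  star-bounds {a} {b} {m} {x} {y} {z} (checked ok) = <ᵇ-true (proj₁ k₀) , <ᵇ-true (proj₁ k₁) , <ᵇ-true (proj₁ k₂)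
    where
    k₀ = ∧-true {x <ᵇ m} ok
    k₁ = ∧-true {y <ᵇ m} (proj₂ k₀)
    k₂ = ∧-true {z <ᵇ m} (proj₂ k₁)

  true-allBelow : ∀ n {f} → (∀ {k} → k < n → f k ≡ true) → allBelow n f ≡ true
  true-allBelow zero h = refl
  true-allBelow (suc n) h = true-∧ (h (ℕₚ.n<1+n n)) (true-allBelow n (h ∘ ℕₚ.m<n⇒m<1+n))

  true-⇒ᵇ : ∀ {b c} → (b ≡ true → c ≡ true) → (b ⇒ᵇ c) ≡ true
  true-⇒ᵇ {true} h = h refl
  true-⇒ᵇ {false} h = refl

  -- The move takes place among `m` vertices of `a`, and `r` further ones look on. The two equations
  -- say that both sides, together with these onlookers, are the listed members for `d`.
  linked? : (a b : Code) (m r x y z p : ℕ) → Bool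
  linked? a b m r x y z p = (order a ≤ᵇ m) ∧ (order b ≤ᵇ suc m) ∧ (m + r ≡ᵇ order a + free a) ∧
    (suc m + r ≡ᵇ order b + free b) ∧ star? a b m x y z p

  record Linked (a b : Code) (m r x y z p : ℕ) : Set where
    field
      order≤ : order a ≤ m
      order≤′ : order b ≤ suc m
      total : m + r ≡ order a + free a
      total′ : suc m + r ≡ order b + free b
      star-ok : StarOK a b m x y z p

  linked-sound : ∀ {a b m r x y z p} → linked? a b m r x y z p ≡ true → Linked a b m r x y z p
  linked-sound {a} {b} {m} {r} {x} {y} {z} {p} ok = record
    { order≤ = ≤ᵇ-true (proj₁ k₁) ; order≤′ = ≤ᵇ-true (proj₁ k₂)
    ; total = ≡ᵇ-true (proj₁ k₃) ; total′ = ≡ᵇ-true (proj₁ k₄) ; star-ok = checked (proj₂ k₄) }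
    where
    k₁ = ∧-true {order a ≤ᵇ m} ok
    k₂ = ∧-true {order b ≤ᵇ suc m} (proj₂ k₁)
    k₃ = ∧-true {m + r ≡ᵇ order a + free a} (proj₂ k₂)
    k₄ = ∧-true {suc m + r ≡ᵇ order b + free b} (proj₂ k₃)

  match : ℕ → ℕ → ℕ → Cert → Bool
  match x y z c = (C.x c ≡ᵇ x) ∧ (C.y c ≡ᵇ y) ∧ (C.z c ≡ᵇ z)

  core : Code → BGraph
  core c = seg c (order c)

  -- The segment may contain vertices past the rows of the code; they return to the reserve as `g`
  -- adjoined ones.
  seg-target : ∀ c {m r} → w ≤ order c → order c ≤ m → m + r ≡ order c + free c →
    ∃ λ g → BIso (seg c m) (core c ⊕ g) × g + r ≡ free c
  seg-target c {m} {r} w≤ o≤m e = m ∸ order c ,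
    biso-trans (seg-eq (sym (ℕₚ.m+[n∸m]≡n o≤m))) (biso-sym (seg-⊕ c (order c) (m ∸ order c) ℕₚ.≤-refl w≤)) ,
    ℕₚ.+-cancelˡ-≡ (order c) _ _ (trans (sym (ℕₚ.+-assoc (order c) _ r)) (trans (cong (_+ r) (ℕₚ.m+[n∸m]≡n o≤m)) e))

  seg-total : ∀ c {m r} → w ≤ order c → order c ≤ m → m + r ≡ order c + free c → BIso (core c ⊕ free c) (seg c m ⊕ r)
  seg-total c {m} {r} w≤ o≤m e = biso-trans (seg-⊕ c (order c) (free c) ℕₚ.≤-refl w≤)
    (biso-trans (seg-eq (sym e)) (biso-sym (seg-⊕ c m r o≤m (ℕₚ.≤-trans w≤ o≤m))))

  -- Checking a list of codes

  module Check (codes : List Code) where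

    N : ℕ
    N = length codes

    at : ℕ → Code
    at = nth (code [] 0 [] []) codes

    -- A triangle has at most one vertex past the rows. Such vertices being interchangeable, it may
    -- be taken as the first, with number `order c`; the segment is then longer by one.
    up-size : Code → Cert → ℕ
    up-size c t = order c + (if C.z t <ᵇ order c then 0 else 1)

    up? : Code → Cert → Bool
    up? c t = (C.target t <ᵇ N) ∧ linked? c (at (C.target t)) (up-size c t) ((order c + free c) ∸ up-size c t)
      (C.x t) (C.y t) (C.z t) (C.perm t)

    down? : Code → Cert → Bool
    down? c t = (C.target t <ᵇ N) ∧ linked? (at (C.target t)) c (order c ∸ 1) (free c) (C.x t) (C.y t) (C.z t) (C.perm t)

    up-cover? : Code → Bool
    up-cover? c = allBelow (order c) λ z → allBelow z λ y → edge c y z ⇒ᵇ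
      allBelow y λ x → (edge c x y ∧ edge c x z) ⇒ᵇ any (match x y z) (ups c)

    new-cover? : Code → Bool
    new-cover? c = allBelow w λ y → allBelow y λ x → edge c x y ⇒ᵇ any (match x y (order c)) (ups c)

    independent? : Code → ℕ → ℕ → ℕ → ℕ → Bool
    independent? c v x y z = edge c v x ∧ not (edge c x y) ∧ not (edge c y z) ∧ not (edge c x z) ∧
      allBelow (order c) (λ u → edge c v u ⇒ᵇ member x y z u)

    -- A certificate is looked up by its hub alone: by `star-coiso`, the hub determines the graph
    -- before the move up to isomorphism.
    down-cover? : Code → Bool
    down-cover? c = allBelow (order c) λ v → (v <ᵇ w) ∨
      allBelow (order c) λ z → edge c v z ⇒ᵇ allBelow z λ y → edge c v y ⇒ᵇ allBelow y λ x → independent? c v x y z ⇒ᵇ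
      any (λ t → digit (C.perm t) (order c ∸ 1) ≡ᵇ v) (downs c)

    base-degree? : Code → Bool
    base-degree? c = allBelow w λ v → 4 ≤ᵇ degree c (order c + free c) v

    -- Every code except the first has a move leading to it from an earlier code or from it to an
    -- earlier code, so induction on the index connects all of them to the first.
    reach? : ℕ → Code → Bool
    reach? i c = (i ≡ᵇ 0) ∨ any (λ t → C.target t <ᵇ i) (ups c) ∨ any (λ t → C.target t <ᵇ i) (downs c)

    state? : ℕ → Bool
    state? i = let c = at i in (w ≤ᵇ order c) ∧ all (up? c) (ups c) ∧ all (down? c) (downs c) ∧
      up-cover? c ∧ new-cover? c ∧ down-cover? c ∧ base-degree? c ∧ reach? i c

    record State (i : ℕ) : Set where
      field
        w≤order : w ≤ order (at i)
        ups-ok : all (up? (at i)) (ups (at i)) ≡ true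
        downs-ok : all (down? (at i)) (downs (at i)) ≡ true
        up-cover : up-cover? (at i) ≡ true
        new-cover : new-cover? (at i) ≡ true
        down-cover : down-cover? (at i) ≡ true
        degree-ok : base-degree? (at i) ≡ true
        reach-ok : reach? i (at i) ≡ true

    state-sound : ∀ i → state? i ≡ true → State i
    state-sound i ok = record
      { w≤order = ≤ᵇ-true (proj₁ k₁) ; ups-ok = proj₁ k₂ ; downs-ok = proj₁ k₃ ; up-cover = proj₁ k₄
      ; new-cover = proj₁ k₅ ; down-cover = proj₁ k₆ ; degree-ok = proj₁ k₇ ; reach-ok = proj₂ k₇ }
      where
      c = at i
      k₁ = ∧-true {w ≤ᵇ order c} ok
      k₂ = ∧-true {all (up? c) (ups c)} (proj₂ k₁)
      k₃ = ∧-true {all (down? c) (downs c)} (proj₂ k₂)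
      k₄ = ∧-true {up-cover? c} (proj₂ k₃)
      k₅ = ∧-true {new-cover? c} (proj₂ k₄)
      k₆ = ∧-true {down-cover? c} (proj₂ k₅)
      k₇ = ∧-true {base-degree? c} (proj₂ k₆)

    module Sound (4≤w : 4 ≤ w) (ok : allBelow N state? ≡ true) where

      state : ∀ {k} → k < N → State k
      state k<N = state-sound _ (allBelow-sound N ok k<N)

      coreᵢ : Fin N → BGraph
      coreᵢ i = core (at (toℕ i))

      freeᵢ : Fin N → ℕ
      freeᵢ i = free (at (toℕ i))

      open Stable coreᵢ freeᵢ

      private
        target-at : ∀ {k m r H} → k < N → order (at k) ≤ m → m + r ≡ order (at k) + free (at k) → H ≡ seg (at k) m → Target r H
        target-at {k} {m} {r} k<N o≤ e refl = fromℕ< k<N ,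
          subst (λ l → ∃ λ g → BIso (seg (at k) m) (core (at l) ⊕ g) × g + r ≡ free (at l)) (sym (Finₚ.toℕ-fromℕ< k<N))
            (seg-target (at k) (State.w≤order (state k<N)) o≤ e)

        module Up {i} (i<N : i < N) (t : Cert) (ok : up? (at i) t ≡ true) where
          c = at i
          j<N : C.target t < N
          j<N = <ᵇ-true (proj₁ (∧-true {C.target t <ᵇ N} ok))
          link : Linked c (at (C.target t)) (up-size c t) ((order c + free c) ∸ up-size c t) (C.x t) (C.y t) (C.z t) (C.perm t)
          link = linked-sound (proj₂ (∧-true {C.target t <ᵇ N} ok))
          open Linked link public

          module _ (X Y Z : Fin (up-size c t)) (eX : toℕ X ≡ C.x t) (eY : toℕ Y ≡ C.y t) (eZ : toℕ Z ≡ C.z t) where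
            result : ∃ λ h → BStar (seg c (up-size c t)) (seg (at (C.target t)) (suc (up-size c t))) X Y Z h
            result = StarSound.hub star-ok X Y Z eX eY eZ , StarSound.bstar star-ok X Y Z eX eY eZ

          up-target : Target ((order c + free c) ∸ up-size c t) (seg (at (C.target t)) (suc (up-size c t)))
          up-target = target-at j<N order≤′ total′ refl

        match-sound : ∀ {x y z t} → match x y z t ≡ true → C.x t ≡ x × C.y t ≡ y × C.z t ≡ z
        match-sound {x} {y} {z} {t} m = let (p , q) = ∧-true {C.x t ≡ᵇ x} m ; (q₁ , q₂) = ∧-true {C.y t ≡ᵇ y} q in
          ≡ᵇ-true p , ≡ᵇ-true q₁ , ≡ᵇ-true q₂

        seg-cast : ∀ {c H m n h} (e : m ≡ n) {X Y Z : Fin m} {X′ Y′ Z′ : Fin n} →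
          toℕ X ≡ toℕ X′ → toℕ Y ≡ toℕ Y′ → toℕ Z ≡ toℕ Z′ → BStar (seg c m) H X Y Z h → BStar (seg c n) H X′ Y′ Z′ h
        seg-cast refl p q r S with Finₚ.toℕ-injective p | Finₚ.toℕ-injective q | Finₚ.toℕ-injective r
        ... | refl | refl | refl = S

        up-sorted : ∀ i {x y z : Fin (order (at (toℕ i)))} → toℕ x < toℕ y → toℕ y < toℕ z → IsTriangle (coreᵢ i) x y z →
          Σ BGraph λ H → ∃ λ h → BStar (coreᵢ i) H x y z h × Target (freeᵢ i) H
        up-sorted i {x} {y} {z} x<y y<z (xy , yz , xz) = finish
          (any-true (match (toℕ x) (toℕ y) (toℕ z)) (ups c)
            (⇒ᵇ-true (allBelow-sound (toℕ y) (⇒ᵇ-true (allBelow-sound (toℕ z) (allBelow-sound (order c) (State.up-cover st) (Finₚ.toℕ<n z))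
              y<z) yz) x<y) (true-∧ xy xz)))
          where
          c = at (toℕ i)
          st = state (Finₚ.toℕ<n i)
          finish : (∃ λ t → match (toℕ x) (toℕ y) (toℕ z) t ≡ true × (∀ g → all g (ups c) ≡ true → g t ≡ true)) →
            Σ BGraph λ H → ∃ λ h → BStar (coreᵢ i) H x y z h × Target (freeᵢ i) H
          finish (t , m , get) = seg (at (C.target t)) (suc (up-size c t)) , proj₁ S ,
            seg-cast same (cast-eq x) (cast-eq y) (cast-eq z) (proj₂ S) ,
            subst (λ r → Target r (seg (at (C.target t)) (suc (up-size c t)))) (trans (cong ((order c + free c) ∸_) same) (ℕₚ.m+n∸m≡n (order c) (free c))) U.up-target
            where
            module U = Up (Finₚ.toℕ<n i) t (get (up? c) (State.ups-ok st))
            z<o : (C.z t <ᵇ order c) ≡ true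
            z<o = true-<ᵇ (subst (_< order c) (sym (proj₂ (proj₂ (match-sound {t = t} m)))) (Finₚ.toℕ<n z))
            same : up-size c t ≡ order c
            same = trans (cong (λ b → order c + (if b then 0 else 1)) z<o) (ℕₚ.+-identityʳ _)
            cast′ : Fin (order c) → Fin (up-size c t)
            cast′ = Fin.cast (sym same)
            cast-eq : ∀ u → toℕ (cast′ u) ≡ toℕ u
            cast-eq u = Finₚ.toℕ-cast (sym same) u
            S = U.result (cast′ x) (cast′ y) (cast′ z)
              (trans (cast-eq x) (sym (proj₁ (match-sound {t = t} m)))) (trans (cast-eq y) (sym (proj₁ (proj₂ (match-sound {t = t} m)))))
              (trans (cast-eq z) (sym (proj₂ (proj₂ (match-sound {t = t} m)))))

        New : ∀ i → V (coreᵢ i) → V (coreᵢ i) → Set₁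
        New i x y = ∃ λ f′ → freeᵢ i ≡ suc f′ × Σ BGraph λ H → ∃ λ h →
           BStar (coreᵢ i ⊕ 1) H (inj₁ x) (inj₁ y) (inj₂ zero) h × Target f′ H

        new-sorted : ∀ i {x y : Fin (order (at (toℕ i)))} → toℕ x < toℕ y → toℕ y < w → Adj (coreᵢ i) x y → New i x y
        new-sorted i {x} {y} x<y y<w xy = finish
          (any-true (match (toℕ x) (toℕ y) (order c)) (ups c)
            (⇒ᵇ-true (allBelow-sound (toℕ y) (allBelow-sound w (State.new-cover st) y<w) x<y) xy))
          where
          c = at (toℕ i)
          st = state (Finₚ.toℕ<n i)
          finish : (∃ λ t → match (toℕ x) (toℕ y) (order c) t ≡ true × (∀ g → all g (ups c) ≡ true → g t ≡ true)) → New i x y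
          finish (t , m , get) = f′ ,
            -- Although `f′` is a truncated difference, the checked total shows that nothing was cut
            -- off, so the reserve does contain the vertex that is used.
            ℕₚ.+-cancelˡ-≡ (order c) _ _ (trans (sym U.total) (trans (cong (_+ f′) same)
              (trans (cong (_+ f′) (ℕₚ.+-comm (order c) 1)) (sym (ℕₚ.+-suc (order c) f′))))) ,
            _ , proj₁ S ,
            subst₃ (from-φ-old x) (from-φ-old y) from-φ-new
              (bstar-transport (biso-sym φ) (seg-cast same (cast-eq (x ↑ˡ 1)) (cast-eq (y ↑ˡ 1)) (cast-eq new) (proj₂ S))) ,
            U.up-target
            where
            module U = Up (Finₚ.toℕ<n i) t (get (up? c) (State.ups-ok st))
            f′ = (order c + free c) ∸ up-size c t
            w≤ = State.w≤order st
            φ = seg-⊕ c (order c) 1 ℕₚ.≤-refl w≤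
            new : Fin (order c + 1)
            new = order c ↑ʳ zero
            z≮o : (C.z t <ᵇ order c) ≡ false
            z≮o = <ᵇ-false (λ q → ℕₚ.<-irrefl (proj₂ (proj₂ (match-sound {t = t} m))) q)
            same : up-size c t ≡ order c + 1
            same = cong (λ b → order c + (if b then 0 else 1)) z≮o
            cast′ : Fin (order c + 1) → Fin (up-size c t)
            cast′ = Fin.cast (sym same)
            cast-eq : ∀ u → toℕ (cast′ u) ≡ toℕ u
            cast-eq u = Finₚ.toℕ-cast (sym same) u
            from-φ-old : ∀ u → splitAt (order c) (u ↑ˡ 1) ≡ inj₁ u
            from-φ-old u = Finₚ.splitAt-↑ˡ (order c) u 1
            from-φ-new : splitAt (order c) new ≡ inj₂ zero
            from-φ-new = Finₚ.splitAt-↑ʳ (order c) 1 zero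
            S = U.result (cast′ (x ↑ˡ 1)) (cast′ (y ↑ˡ 1)) (cast′ new)
              (trans (cast-eq (x ↑ˡ 1)) (trans (Finₚ.toℕ-↑ˡ x 1) (sym (proj₁ (match-sound {t = t} m)))))
              (trans (cast-eq (y ↑ˡ 1)) (trans (Finₚ.toℕ-↑ˡ y 1) (sym (proj₁ (proj₂ (match-sound {t = t} m))))))
              (trans (cast-eq new) (trans (Finₚ.toℕ-↑ʳ (order c) zero) (trans (ℕₚ.+-identityʳ _) (sym (proj₂ (proj₂ (match-sound {t = t} m)))))))
            subst₃ : ∀ {H h p q r p′ q′ r′} → p ≡ p′ → q ≡ q′ → r ≡ r′ →
              BStar (core c ⊕ 1) H p q r h → BStar (core c ⊕ 1) H p′ q′ r′ h
            subst₃ refl refl refl S = S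

        module Down {i} (i<N : i < N) (t : Cert) (ok : down? (at i) t ≡ true) where
          c = at i
          a = at (C.target t)
          m = order c ∸ 1
          j<N : C.target t < N
          j<N = <ᵇ-true (proj₁ (∧-true {C.target t <ᵇ N} ok))
          link : Linked a c m (free c) (C.x t) (C.y t) (C.z t) (C.perm t)
          link = linked-sound (proj₂ (∧-true {C.target t <ᵇ N} ok))
          open Linked link public

          bounds = star-bounds star-ok
          X = fromℕ< (proj₁ bounds)
          Y = fromℕ< (proj₁ (proj₂ bounds))
          Z = fromℕ< (proj₂ (proj₂ bounds))

          private
            module S = StarSound star-ok X Y Z (Finₚ.toℕ-fromℕ< _) (Finₚ.toℕ-fromℕ< _) (Finₚ.toℕ-fromℕ< _)

          down-star : BStar (seg a m) (seg c (suc m)) X Y Z S.hub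
          down-star = S.bstar

          suc-m : suc m ≡ order c
          suc-m = ℕₚ.+-cancelʳ-≡ (free c) _ _ total′

          result : ∀ v → digit (C.perm t) m ≡ toℕ v → BStar (seg a m) (core c) X Y Z v
          result v e = go suc-m S.hub (trans S.toℕ-hub e) S.bstar
            where
            go : ∀ {k} → k ≡ order c → (h : Fin k) → toℕ h ≡ toℕ v → BStar (seg a m) (seg c k) X Y Z h → BStar (seg a m) (core c) X Y Z v
            go refl h p B with Finₚ.toℕ-injective p
            ... | refl = B

          down-target : Target (free c) (seg a m)
          down-target = target-at j<N order≤ total refl

        down-sorted : ∀ i {v x y z : Fin (order (at (toℕ i)))} → toℕ x < toℕ y → toℕ y < toℕ z → ¬ toℕ v < w →
          IsY (coreᵢ i) v x y z →
          Σ BGraph λ H → ∃ λ x′ → ∃ λ y′ → ∃ λ z′ → BStar H (coreᵢ i) x′ y′ z′ v × Target (freeᵢ i) H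
        down-sorted i {v} {x} {y} {z} x<y y<z nb Yv = finish
          (any-true (λ t → digit (C.perm t) (order c ∸ 1) ≡ᵇ toℕ v) (downs c)
            (⇒ᵇ-true (allBelow-sound (toℕ y) (⇒ᵇ-true (allBelow-sound (toℕ z) (⇒ᵇ-true
              (allBelow-sound (order c) from-v (Finₚ.toℕ<n z)) (nbr← in₃)) y<z) (nbr← in₂)) x<y) indep))
          where
          open IsY Yv
          c = at (toℕ i)
          st = state (Finₚ.toℕ<n i)
          from-v = [ (λ p → ⊥-elim (nb (<ᵇ-true p))) , id ]′
            (∨-true {toℕ v <ᵇ w} (allBelow-sound (order c) (State.down-cover st) (Finₚ.toℕ<n v)))
          mem : ∀ {u : Fin (order c)} → In x y z u → member (toℕ x) (toℕ y) (toℕ z) (toℕ u) ≡ true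
          mem (inj₁ refl) = true-∨ˡ (true-≡ᵇ {toℕ x} refl)
          mem (inj₂ (inj₁ refl)) = true-∨ʳ {toℕ y ≡ᵇ toℕ x} (true-∨ˡ (true-≡ᵇ {toℕ y} refl))
          mem (inj₂ (inj₂ refl)) = true-∨ʳ {toℕ z ≡ᵇ toℕ x} (true-∨ʳ {toℕ z ≡ᵇ toℕ y} (true-≡ᵇ {toℕ z} refl))
          only : ∀ {k} → k < order c → edge c (toℕ v) k ≡ true → member (toℕ x) (toℕ y) (toℕ z) k ≡ true
          only k< e = subst (λ k → member (toℕ x) (toℕ y) (toℕ z) k ≡ true) (Finₚ.toℕ-fromℕ< k<)
            (mem (nbr→ {fromℕ< k<} (trans (cong (edge c (toℕ v)) (Finₚ.toℕ-fromℕ< k<)) e)))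
          indep : independent? c (toℕ v) (toℕ x) (toℕ y) (toℕ z) ≡ true
          indep = true-∧ (nbr← in₁) (true-∧ (true-not ¬xy) (true-∧ (true-not ¬yz) (true-∧ (true-not ¬xz)
            (true-allBelow (order c) (λ k< → true-⇒ᵇ (only k<))))))
          finish : (∃ λ t → (digit (C.perm t) (order c ∸ 1) ≡ᵇ toℕ v) ≡ true × (∀ g → all g (downs c) ≡ true → g t ≡ true)) →
            Σ BGraph λ H → ∃ λ x′ → ∃ λ y′ → ∃ λ z′ → BStar H (coreᵢ i) x′ y′ z′ v × Target (freeᵢ i) H
          finish (t , m , get) = _ , _ , _ , _ , D.result v (≡ᵇ-true m) , D.down-target
            where module D = Down (Finₚ.toℕ<n i) t (get (down? c) (State.downs-ok st))

        apart : ∀ {c m} {u v : Fin m} → Adj (seg c m) u v → u ≢ v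
        apart {c} {m} {u} p refl = irr (seg c m) {u} p

        up-all : ∀ i {x y z} → IsTriangle (coreᵢ i) x y z → Σ BGraph λ H → ∃ λ h → BStar (coreᵢ i) H x y z h × Target (freeᵢ i) H
        up-all i {x} {y} {z} t@(xy , yz , xz) = finish (sort₃ x y z (apart {c} {s} {x} {y} xy) (apart {c} {s} {y} {z} yz) (apart {c} {s} {x} {z} xz))
          where
          c = at (toℕ i)
          s = order c
          finish : (∃ λ x′ → ∃ λ y′ → ∃ λ z′ →
            toℕ x′ < toℕ y′ × toℕ y′ < toℕ z′ × (∀ {u} → In x y z u → In x′ y′ z′ u) × (∀ {u} → In x′ y′ z′ u → In x y z u)) →
            Σ BGraph λ H → ∃ λ h → BStar (coreᵢ i) H x y z h × Target (freeᵢ i) H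
          finish (x′ , y′ , z′ , x<y , y<z , into , outof) =
            let (H , h , S , T) = up-sorted i {x′} {y′} {z′} x<y y<z
                  (triangle-adj (coreᵢ i) {x} {y} {z} {x′} {y′} t (outof in₁) (outof in₂) (λ e → ℕₚ.<⇒≢ x<y (cong toℕ e)) ,
                   triangle-adj (coreᵢ i) {x} {y} {z} {y′} {z′} t (outof in₂) (outof in₃) (λ e → ℕₚ.<⇒≢ y<z (cong toℕ e)) ,
                   triangle-adj (coreᵢ i) {x} {y} {z} {x′} {z′} t (outof in₁) (outof in₃) (λ e → ℕₚ.<⇒≢ (ℕₚ.<-trans x<y y<z) (cong toℕ e)))
            in H , h , bstar-resp outof into t S , T

        new-all : ∀ i {x y} → Base (coreᵢ i) x → Base (coreᵢ i) y → Adj (coreᵢ i) x y → New i x y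
        new-all i {x} {y} bx by xy = compare (ℕₚ.<-cmp (toℕ x) (toℕ y))
          where
          c = at (toℕ i)
          compare : Tri (toℕ x < toℕ y) (toℕ x ≡ toℕ y) (toℕ y < toℕ x) → New i x y
          compare (tri< p _ _) = new-sorted i {x} {y} p by xy
          compare (tri≈ _ e _) = ⊥-elim (apart {c} {order c} {x} {y} xy (Finₚ.toℕ-injective e))
          compare (tri> _ _ p) = let (f′ , e , H , h , S , T) = new-sorted i {y} {x} p bx (symm (coreᵢ i) {x} {y} xy) in
            f′ , e , H , h , bstar-resp In-swap In-swap (xy , by , bx) S , T

        down-all : ∀ i {v x y z} → ¬ Base (coreᵢ i) v → IsY (coreᵢ i) v x y z →
          Σ BGraph λ H → ∃ λ x′ → ∃ λ y′ → ∃ λ z′ → BStar H (coreᵢ i) x′ y′ z′ v × Target (freeᵢ i) H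
        down-all i {v} {x} {y} {z} nb Y = finish (sort₃ x y z x≢y y≢z x≢z)
          where
          open IsY Y
          G = coreᵢ i
          indep : ∀ p q → In x y z p → In x y z q → ¬ Adj G p q
          indep _ _ (inj₁ refl) (inj₁ refl) = irr G {x}
          indep _ _ (inj₁ refl) (inj₂ (inj₁ refl)) = ¬xy
          indep _ _ (inj₁ refl) (inj₂ (inj₂ refl)) = ¬xz
          indep _ _ (inj₂ (inj₁ refl)) (inj₁ refl) e = ¬xy (symm G {y} {x} e)
          indep _ _ (inj₂ (inj₁ refl)) (inj₂ (inj₁ refl)) = irr G {y}
          indep _ _ (inj₂ (inj₁ refl)) (inj₂ (inj₂ refl)) = ¬yz
          indep _ _ (inj₂ (inj₂ refl)) (inj₁ refl) e = ¬xz (symm G {z} {x} e)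
          indep _ _ (inj₂ (inj₂ refl)) (inj₂ (inj₁ refl)) e = ¬yz (symm G {z} {y} e)
          indep _ _ (inj₂ (inj₂ refl)) (inj₂ (inj₂ refl)) = irr G {z}
          finish : (∃ λ x′ → ∃ λ y′ → ∃ λ z′ →
            toℕ x′ < toℕ y′ × toℕ y′ < toℕ z′ × (∀ {u} → In x y z u → In x′ y′ z′ u) × (∀ {u} → In x′ y′ z′ u → In x y z u)) →
            Σ BGraph λ H → ∃ λ x′ → ∃ λ y′ → ∃ λ z′ → BStar H (coreᵢ i) x′ y′ z′ v × Target (freeᵢ i) H
          finish (x′ , y′ , z′ , x<y , y<z , into , outof) = down-sorted i {v} {x′} {y′} {z′} x<y y<z nb (record
            { x≢y = λ e → ℕₚ.<⇒≢ x<y (cong toℕ e) ; y≢z = λ e → ℕₚ.<⇒≢ y<z (cong toℕ e)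
            ; x≢z = λ e → ℕₚ.<⇒≢ (ℕₚ.<-trans x<y y<z) (cong toℕ e)
            ; nbr→ = λ {u} e → into (nbr→ {u} e) ; nbr← = λ {u} e → nbr← {u} (outof e)
            ; ¬xy = indep x′ y′ (outof in₁) (outof in₂) ; ¬yz = indep y′ z′ (outof in₂) (outof in₃)
            ; ¬xz = indep x′ z′ (outof in₁) (outof in₃) })

        four : ∀ i → Fin 4 → Fin (order (at (toℕ i)))
        four i k = fromℕ< (ℕₚ.<-≤-trans (Finₚ.toℕ<n k) (ℕₚ.≤-trans 4≤w (State.w≤order (state (Finₚ.toℕ<n i)))))

        degree4 : ∀ i {v} → Base (coreᵢ i) v → Has 4 (coreᵢ i ⊕ freeᵢ i) (inj₁ v)
        degree4 i {v} b = subst (Has 4 (coreᵢ i ⊕ freeᵢ i)) (Finₚ.splitAt-↑ˡ (order c) v (free c))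
          (has-iso (iso-sym (plain (seg-⊕ c (order c) (free c) ℕₚ.≤-refl (State.w≤order st))))
            (has-degree c (order c + free c) (v ↑ˡ free c)
              (subst (λ u → 4 ≤ degree c (order c + free c) u) (sym (Finₚ.toℕ-↑ˡ v (free c)))
                (≤ᵇ-true (allBelow-sound w (State.degree-ok st) b)))))
          where
          c = at (toℕ i)
          st = state (Finₚ.toℕ<n i)

      closed : Closed
      closed = record
        { close-up = up-all
        ; close-new = λ i bx by xy → inj₂ (new-all i bx by xy)
        ; close-down = down-all
        ; base-degree = degree4
        ; base-size = λ { i (x , y , z , _ , _ , _ , _ , _ , _ , all-in) → no-four (four i)
            (λ e → Finₚ.toℕ-injective (trans (sym (Finₚ.toℕ-fromℕ< _)) (trans (cong toℕ e) (Finₚ.toℕ-fromℕ< _))))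
            (λ k → all-in (four i k) (subst (_< w) (sym (Finₚ.toℕ-fromℕ< _)) (ℕₚ.<-≤-trans (Finₚ.toℕ<n k) 4≤w))) } }

      L₀ : ℕ → BGraph
      L₀ k = core (at k) ⊕ free (at k)

      reach-below : ∀ k → k < N → BPath (L₀ 0) (L₀ k)
      reach-below = <-rec _ step
        where
        step : ∀ k → (∀ {l} → l < k → l < N → BPath (L₀ 0) (L₀ l)) → k < N → BPath (L₀ 0) (L₀ k)
        step k rec k<N with ∨-true {k ≡ᵇ 0} (State.reach-ok (state k<N))
        ... | inj₁ e with ≡ᵇ-true {k} e
        ... | refl = done
        step k rec k<N | inj₂ e with ∨-true {any (λ t → C.target t <ᵇ k) (ups (at k))} e
        ... | inj₁ e₁ with any-true (λ t → C.target t <ᵇ k) (ups (at k)) e₁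
        -- The certified move leads from `k` to an earlier code, so the path traverses it backwards.
        ... | t , q , get = via (down (via (rec (<ᵇ-true q) U.j<N)
                (seg-total (at (C.target t)) (State.w≤order (state U.j<N)) U.order≤′ U.total′))
                (⊕-star r (proj₂ (U.result X Y Z (Finₚ.toℕ-fromℕ< _) (Finₚ.toℕ-fromℕ< _) (Finₚ.toℕ-fromℕ< _)))))
                (biso-sym (seg-total (at k) (State.w≤order (state k<N)) U.order≤ U.total))
          where
          module U = Up k<N t (get (up? (at k)) (State.ups-ok (state k<N)))
          r = (order (at k) + free (at k)) ∸ up-size (at k) t
          bounds = star-bounds U.star-ok
          X = fromℕ< (proj₁ bounds)
          Y = fromℕ< (proj₁ (proj₂ bounds))
          Z = fromℕ< (proj₂ (proj₂ bounds))
        step k rec k<N | inj₂ e | inj₂ e₂ with any-true (λ t → C.target t <ᵇ k) (downs (at k)) e₂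
        ... | t , q , get = via (up (via (rec (<ᵇ-true q) D.j<N)
                (seg-total (at (C.target t)) (State.w≤order (state D.j<N)) D.order≤ D.total))
                (⊕-star (free (at k)) D.down-star))
                (biso-sym (seg-total (at k) (State.w≤order (state k<N)) D.order≤′ D.total′))
          where
          module D = Down k<N t (get (down? (at k)) (State.downs-ok (state k<N)))

graded-iso : ∀ {D G H} → BIso G H → Graded D G → Graded D H
graded-iso {D} {G} {H} φ Γ = record
  { base-many = λ {v} b → subst (Has (suc D) H) (to-from f v) (has-iso f (base-many Γ (base→ (biso-sym φ) b)))
  ; nonbase-few = λ {v} nb h → nonbase-few Γ (nb ∘ base← (biso-sym φ)) (has-iso (iso-sym f) h)
  ; base-bounded = λ g inj b → base-bounded Γ (from f ∘ g) (inj ∘ to-injective (iso-sym f)) (base→ (biso-sym φ) ∘ b) }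
  where f = plain φ

-- Complete tripartite graphs

part≥ : ∀ a b {i} → a + b ≤ i → part a b i ≡ suc (suc zero)
part≥ a b {i} p with i <ᵇ a in e | i <ᵇ (a + b) in e′
... | true  | _     = ⊥-elim (ℕₚ.<⇒≱ (<ᵇ-true e) (ℕₚ.≤-trans (ℕₚ.m≤m+n a b) p))
... | false | true  = ⊥-elim (ℕₚ.<⇒≱ (<ᵇ-true e′) p)
... | false | false = refl

part< : ∀ a b {i} → i < a + b → part a b i ≢ suc (suc zero)
part< a b {i} p q with i <ᵇ a in e | i <ᵇ (a + b) in e′
part< a b p () | true | _
part< a b p () | false | true
... | false | false with () ← trans (sym e′) (true-<ᵇ p)

-- All vertices belong to the base, so adjoining `c` vertices produces the third part.
bipartite : ℕ → ℕ → BGraph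
bipartite a b = record
  { V = Fin (a + b) ; card = a + b ; enum = ↔-refl
  ; Adj = λ u v → part a b (toℕ u) ≢ part a b (toℕ v)
  ; adj? = λ u v → ¬? (part a b (toℕ u) Fin.≟ part a b (toℕ v))
  ; symm = λ p q → p (sym q) ; irr = λ p → p refl
  ; Base = λ _ → ⊤ ; base? = λ _ → yes tt }

K-simple : ∀ a b c → IsSimple (K a b c)
K-simple a b c =
  (λ i j → ≡true-ext (λ p → true-not (λ q → not-true p (true-== (sym (==-true q)))))
                     (λ p → true-not (λ q → not-true p (true-== (sym (==-true q)))))) ,
  (λ i → cong not (true-== {i = part a b (toℕ i)} refl))

K-⊕ : ∀ a b c → Iso (simple-graph (K a b c) (K-simple a b c)) (bipartite a b ⊕ c)
K-⊕ a b c = iso-sym record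
  { to = Fin.join (a + b) c ; from = splitAt (a + b)
  ; to-from = Finₚ.join-splitAt (a + b) c ; from-to = Finₚ.splitAt-join (a + b) c
  ; pres = λ {u} {v} e → true-not (λ q → P u v e (==-true q))
  ; reflects = λ {u} {v} e → R u v (λ q → not-true e (true-== q)) }
  where
  pt : Fin (a + b + c) → Fin 3
  pt i = part a b (toℕ i)
  old-part : ∀ u → pt (u ↑ˡ c) ≡ part a b (toℕ u)
  old-part u = cong (part a b) (Finₚ.toℕ-↑ˡ u c)
  new-part : ∀ k → pt ((a + b) ↑ʳ k) ≡ suc (suc zero)
  new-part k = part≥ a b (subst (a + b ≤_) (sym (Finₚ.toℕ-↑ʳ (a + b) k)) (ℕₚ.m≤m+n (a + b) _))
  old-new : ∀ u k → pt (u ↑ˡ c) ≢ pt ((a + b) ↑ʳ k)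
  old-new u k e = part< a b (Finₚ.toℕ<n u) (trans (sym (old-part u)) (trans e (new-part k)))
  P : ∀ u v → Adj (bipartite a b ⊕ c) u v → pt (Fin.join (a + b) c u) ≢ pt (Fin.join (a + b) c v)
  P (inj₁ u) (inj₁ v) n e = n (trans (sym (old-part u)) (trans e (old-part v)))
  P (inj₁ u) (inj₂ k) _ = old-new u k
  P (inj₂ k) (inj₁ u) _ = old-new u k ∘ sym
  R : ∀ u v → pt (Fin.join (a + b) c u) ≢ pt (Fin.join (a + b) c v) → Adj (bipartite a b ⊕ c) u v
  R (inj₁ u) (inj₁ v) n e = n (trans (old-part u) (trans e (sym (old-part v))))
  R (inj₁ u) (inj₂ k) _ = tt
  R (inj₂ k) (inj₁ u) _ = tt
  R (inj₂ k) (inj₂ l) n = n (trans (new-part k) (sym (new-part l)))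

-- Telling listed graphs apart

module Separation (w mask : ℕ) (mask-bits : ∀ {u} → bit mask u ≡ true → u < w) (bits-mask : ∀ {u} → u < w → bit mask u ≡ true)
  (4≤w : 4 ≤ w) (codes : List Code) where

  open Coded w mask mask-bits bits-mask
  open Check codes
  open Code

  -- Degrees are measured after `e` vertices have been adjoined to the member for `d`. Only vertices
  -- with a row are tested: a later one has all its neighbours among the `w` base vertices.
  graded? : ℕ → Code → Bool
  graded? e c = allBelow (order c) λ v →
    if v <ᵇ w then suc w ≤ᵇ degree c (order c + free c + e) v else degree c (order c + free c + e) v ≤ᵇ w

  graded-sound : ∀ e c → w ≤ order c → graded? e c ≡ true → Graded w (seg c (order c + free c + e))
  graded-sound e c w≤ ok = record
    { base-many = λ {v} b → has-degree c M v (many (toℕ v) b)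
    ; nonbase-few = λ {v} nb h → few v nb h
    ; base-bounded = bounded }
    where
    M = order c + free c + e
    many : ∀ v → v < w → suc w ≤ degree c M v
    many v b with allBelow-sound (order c) ok (ℕₚ.<-≤-trans b w≤)
    ... | q rewrite true-<ᵇ b = ≤ᵇ-true {suc w} q
    bounded : (g : Fin (suc w) → Fin M) → (∀ {i j} → g i ≡ g j → i ≡ j) → ¬ (∀ i → toℕ (g i) < w)
    bounded = no-injection {P = λ u → toℕ u < w} (λ u b → fromℕ< b)
      (λ p q e → Finₚ.toℕ-injective (trans (sym (Finₚ.toℕ-fromℕ< p)) (trans (cong toℕ e) (Finₚ.toℕ-fromℕ< q))))
    few : ∀ v → ¬ toℕ v < w → ¬ Has (suc w) (seg c M) v
    few v nb h@(g , inj , a) with toℕ v ℕ.<? order c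
    ... | yes v< with allBelow-sound (order c) ok v<
    ... | q rewrite <ᵇ-false nb = ℕₚ.<⇒≱ (degree-has c M v h) (≤ᵇ-true q)
    few v nb h@(g , inj , a) | no v≮ = bounded g inj base
      where
      o≤ = ℕₚ.≮⇒≥ v≮
      w≤v = ℕₚ.≮⇒≥ nb
      base : ∀ i → toℕ (g i) < w
      base i with ℕₚ.<-cmp (toℕ (g i)) (toℕ v)
      ... | tri< p _ _ = edge-old-new c o≤ w≤v p (symm (seg c M) {v} {g i} (a i))
      ... | tri≈ _ p _ = ⊥-elim (irr (seg c M) {v} (trans (cong (edge c (toℕ v)) (sym p)) (a i)))
      ... | tri> _ _ p = ⊥-elim (nb (edge-old-new c (ℕₚ.≤-trans o≤ (ℕₚ.<⇒≤ p)) (ℕₚ.≤-trans w≤v (ℕₚ.<⇒≤ p)) p (a i)))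

  degree-count : Code → ℕ → ℕ → ℕ
  degree-count c M k = counting M (λ v → degree c M v ≡ᵇ k)

  degree-iso : ∀ a m b n (φ : Iso (seg a m) (seg b n)) v → degree a m (toℕ v) ≡ degree b n (toℕ (to φ v))
  degree-iso a m b n φ v = ℕₚ.≤-antisym
    (degree-has b n (to φ v) (has-iso φ (has-degree a m v ℕₚ.≤-refl)))
    (subst (λ u → degree b n (toℕ (to φ v)) ≤ degree a m (toℕ u)) (from-to φ v)
      (degree-has a m (from φ (to φ v)) (has-iso (iso-sym φ) (has-degree b n (to φ v) ℕₚ.≤-refl))))

  degree-count-≤ : ∀ a m b n → Iso (seg a m) (seg b n) → ∀ k → degree-count a m k ≤ degree-count b n k
  degree-count-≤ a m b n φ k with injection-counting m (λ v → degree a m v ≡ᵇ k) _ ℕₚ.≤-refl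
  ... | g , inj , h = counting-injection (λ v → degree b n v ≡ᵇ k) (to φ ∘ g) (inj ∘ to-injective φ)
        (λ i → true-≡ᵇ (trans (sym (degree-iso a m b n φ (g i))) (≡ᵇ-true (h i))))

  degree-count-iso : ∀ a m b n → Iso (seg a m) (seg b n) → ∀ k → degree-count a m k ≡ degree-count b n k
  degree-count-iso a m b n φ k = ℕₚ.≤-antisym (degree-count-≤ a m b n φ k) (degree-count-≤ b n a m (iso-sym φ) k)

  same-degrees? : ℕ → ℕ → Bool
  same-degrees? i j = let a = at i ; b = at j ; m = order a + free a ; n = order b + free b in
    (degree-count a m 2 ≡ᵇ degree-count b n 2) ∧ (degree-count a m 3 ≡ᵇ degree-count b n 3) ∧
    (degree-count a m 4 ≡ᵇ degree-count b n 4)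

  module _ (ok : allBelow N state? ≡ true) where

    open Sound 4≤w ok
    open Stable coreᵢ freeᵢ

    private
      whole : ∀ i → BIso (coreᵢ i ⊕ freeᵢ i) (seg (at (toℕ i)) (order (at (toℕ i)) + free (at (toℕ i))))
      whole i = seg-⊕ (at (toℕ i)) _ _ ℕₚ.≤-refl (State.w≤order (state (Finₚ.toℕ<n i)))

      whole⊕ : ∀ e i → BIso (seg (at (toℕ i)) (order (at (toℕ i)) + free (at (toℕ i)) + e)) (coreᵢ i ⊕ freeᵢ i ⊕ e)
      whole⊕ e i = biso-sym (biso-trans (⊕-biso (whole i) ↔-refl)
        (seg-⊕ (at (toℕ i)) _ e (ℕₚ.m≤m+n _ _) (ℕₚ.≤-trans (State.w≤order (state (Finₚ.toℕ<n i))) (ℕₚ.m≤m+n _ _))))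

      graded⊕ : ∀ e → allBelow N (λ k → graded? e (at k)) ≡ true → ∀ i → Graded w (coreᵢ i ⊕ freeᵢ i ⊕ e)
      graded⊕ e g i = graded-iso (whole⊕ e i) (graded-sound e (at (toℕ i)) (State.w≤order (state (Finₚ.toℕ<n i)))
        (allBelow-sound N g (Finₚ.toℕ<n i)))

    Separated : Set
    Separated = ∀ n i j → Iso (coreᵢ i ⊕ freeᵢ i ⊕ n) (coreᵢ j ⊕ freeᵢ j ⊕ n) → BIso (coreᵢ i ⊕ freeᵢ i) (coreᵢ j ⊕ freeᵢ j)

    separated-by-degree : allBelow N (λ k → graded? 0 (at k)) ≡ true → Separated
    separated-by-degree g n i j = graded-separated (graded-iso (biso-sym ⊕-zero) (graded⊕ 0 g i))
      (graded-iso (biso-sym ⊕-zero) (graded⊕ 0 g j)) n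

    -- One further free vertex already makes the base visible from the degrees; with none,
    -- the numbers of vertices of degree 2, 3 and 4 tell the graphs apart.
    separated-by-counts : allBelow N (λ k → graded? 1 (at k)) ≡ true →
      allBelow N (λ i → allBelow i (λ j → not (same-degrees? i j))) ≡ true → Separated
    separated-by-counts g s (suc n) i j φ = ⊕-cancel₁ (graded-separated (graded⊕ 1 g i) (graded⊕ 1 g j) n
      (iso-trans (iso-sym (plain (⊕-+ 1 n))) (iso-trans φ (plain (⊕-+ 1 n)))))
    separated-by-counts g s zero i j φ = subst (λ k → BIso (coreᵢ i ⊕ freeᵢ i) (coreᵢ k ⊕ freeᵢ k)) i≡j biso-refl
      where
      total : Fin N → ℕ
      total k = order (at (toℕ k)) + free (at (toℕ k))
      count-eq : ∀ k → degree-count (at (toℕ i)) (total i) k ≡ degree-count (at (toℕ j)) (total j) k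
      count-eq = degree-count-iso (at (toℕ i)) (total i) (at (toℕ j)) (total j)
        (iso-trans (iso-sym (plain (whole i))) (iso-trans (plain ⊕-zero) (iso-trans φ (iso-trans (iso-sym (plain ⊕-zero)) (plain (whole j))))))
      same : same-degrees? (toℕ i) (toℕ j) ≡ true
      same = true-∧ (true-≡ᵇ (count-eq 2)) (true-∧ (true-≡ᵇ (count-eq 3)) (true-≡ᵇ (count-eq 4)))
      same′ : same-degrees? (toℕ j) (toℕ i) ≡ true
      same′ = true-∧ (true-≡ᵇ (sym (count-eq 2))) (true-∧ (true-≡ᵇ (sym (count-eq 3))) (true-≡ᵇ (sym (count-eq 4))))
      i≡j : i ≡ j
      i≡j with ℕₚ.<-cmp (toℕ i) (toℕ j)
      ... | tri≈ _ e _ = Finₚ.toℕ-injective e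
      ... | tri< p _ _ = ⊥-elim (not-true (allBelow-sound (toℕ j) (allBelow-sound N s (Finₚ.toℕ<n j)) p) same′)
      ... | tri> _ _ p = ⊥-elim (not-true (allBelow-sound (toℕ i) (allBelow-sound N s (Finₚ.toℕ<n i)) p) same)

    coded-family : Separated → ∀ a b (0<N : 0 < N) → BIso (bipartite a b) (core (at 0)) →
      ∃ λ k → ∀ n → FamilySize (K a b (free (at 0) + n)) k
    coded-family sep a b 0<N φ = class-count closed i₀ reach sep ,
      λ n → stable-family closed i₀ reach sep n (K a b (free (at 0) + n)) (K-simple a b _)
        (iso-trans (K-⊕ a b _) (plain (subst (λ l → BIso (bipartite a b ⊕ (free (at 0) + n)) (core (at l) ⊕ (free (at l) + n)))
          (sym (Finₚ.toℕ-fromℕ< 0<N)) (⊕-biso φ ↔-refl))))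
      where
      i₀ : Fin N
      i₀ = fromℕ< 0<N
      reach : ∀ i → BPath (coreᵢ i₀ ⊕ freeᵢ i₀) (coreᵢ i ⊕ freeᵢ i)
      reach i = subst (λ l → BPath (L₀ l) (coreᵢ i ⊕ freeᵢ i)) (sym (Finₚ.toℕ-fromℕ< 0<N)) (reach-below (toℕ i) (Finₚ.toℕ<n i))

  bipartite-core : ∀ a b c → order c ≡ a + b → a + b ≡ w →
    allBelow (a + b) (λ u → allBelow (a + b) λ v → eqᵇ (edge c u v) (not (part a b u == part a b v))) ≡ true →
    BIso (bipartite a b) (core c)
  bipartite-core a b c o refl ok = biso-trans (record
    { plain = record { to = id ; from = id ; to-from = λ _ → refl ; from-to = λ _ → refl
      ; pres = λ {u} {v} n → trans (agree u v) (true-not (n ∘ ==-true))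
      ; reflects = λ {u} {v} e q → not-true (trans (sym (agree u v)) e) (true-== q) }
    ; base→ = λ {u} _ → Finₚ.toℕ<n u ; base← = λ _ → tt }) (seg-eq {c} (sym o))
    where
    agree : ∀ (u v : Fin (a + b)) → edge c (toℕ u) (toℕ v) ≡ not (part a b (toℕ u) == part a b (toℕ v))
    agree u v = eqᵇ-true (allBelow-sound (a + b) (allBelow-sound (a + b) ok (Finₚ.toℕ<n u)) (Finₚ.toℕ<n v))

-- Found by breadth-first search over the moves; the first code is the complete bipartite graph.

family₁₃ : List Code
family₁₃ =
  code (0 ∷ 1 ∷ 1 ∷ 1 ∷ []) 4 (cert 0 1 4 1 139527264 ∷ cert 0 2 4 1 139529248 ∷ cert 0 3 4 1 139560992 ∷ []) [] ∷
  code (0 ∷ 1 ∷ 1 ∷ 0 ∷ 9 ∷ 22 ∷ []) 3 (cert 0 1 6 2 145161815104 ∷ cert 0 2 6 2 145161816096 ∷ []) (cert 0 3 4 0 139560992 ∷ cert 2 3 4 3 172033027 ∷ []) ∷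
  code (0 ∷ 1 ∷ 0 ∷ 0 ∷ 5 ∷ 9 ∷ 38 ∷ 26 ∷ []) 2 (cert 0 1 8 4 150915693774880 ∷ []) (cert 0 2 6 1 145161816096 ∷ cert 0 2 6 1 178480286752 ∷ cert 0 2 6 1 211668797441 ∷ cert 0 2 6 1 244987268097 ∷ []) ∷
  code (0 ∷ 0 ∷ 2 ∷ 6 ∷ []) 4 (cert 1 2 3 5 4294688 ∷ cert 1 2 4 1 171968547 ∷ cert 1 3 4 1 172032035 ∷ cert 2 3 4 1 172033027 ∷ []) [] ∷
  code (0 ∷ 0 ∷ 0 ∷ 0 ∷ 3 ∷ 5 ∷ 9 ∷ 70 ∷ 42 ∷ 28 ∷ []) 1 [] (cert 0 1 8 2 150915693774880 ∷ cert 0 1 8 2 185034912924736 ∷ cert 0 1 8 2 219120813540448 ∷ cert 0 1 8 2 253202553471041 ∷ cert 0 1 8 2 287288454086753 ∷ cert 0 1 8 2 321338955825250 ∷ []) ∷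
  code (0 ∷ 0 ∷ 0 ∷ 0 ∷ 14 ∷ []) 4 [] (cert 1 2 3 3 4294688 ∷ []) ∷
  []

family₂₂ : List Code
family₂₂ =
  code (0 ∷ 0 ∷ 3 ∷ 3 ∷ []) 4 (cert 0 2 4 1 172001283 ∷ cert 0 3 4 1 172033027 ∷ cert 1 2 4 1 172001376 ∷ cert 1 3 4 1 172033120 ∷ []) [] ∷
  code (0 ∷ 1 ∷ 1 ∷ 2 ∷ 3 ∷ 28 ∷ []) 3 (cert 0 1 4 2 4469130304 ∷ cert 0 1 6 3 179520504896 ∷ cert 0 2 6 4 211766283265 ∷ cert 1 3 6 4 211766315040 ∷ []) (cert 1 3 4 0 172033120 ∷ []) ∷
  code (0 ∷ 1 ∷ 0 ∷ 4 ∷ 5 ∷ 10 ∷ 48 ∷ []) 3 (cert 0 1 7 5 7842816884834 ∷ cert 2 3 7 5 7842816952352 ∷ []) (cert 0 1 4 1 4469130304 ∷ cert 0 1 4 1 5509283937 ∷ []) ∷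
  code (0 ∷ 1 ∷ 0 ∷ 4 ∷ 5 ∷ 5 ∷ 26 ∷ 42 ∷ []) 2 (cert 0 1 8 6 321339996012642 ∷ cert 2 3 8 6 321339996080160 ∷ []) (cert 0 1 6 1 144121627712 ∷ cert 0 1 6 1 179520504896 ∷ cert 0 1 6 1 210628575329 ∷ cert 0 1 6 1 246027452513 ∷ []) ∷
  code (0 ∷ 1 ∷ 1 ∷ 0 ∷ 3 ∷ 5 ∷ 42 ∷ 28 ∷ []) 2 (cert 0 1 4 5 5711375467584 ∷ cert 0 1 8 6 220152646960192 ∷ cert 0 2 5 5 5744791488544 ∷ cert 0 2 8 6 220219251460128 ∷ []) (cert 1 3 6 1 211766315040 ∷ cert 1 3 6 1 245019804736 ∷ []) ∷
  code (0 ∷ 1 ∷ 0 ∷ 0 ∷ 3 ∷ 5 ∷ 10 ∷ 28 ∷ 96 ∷ []) 2 (cert 0 1 4 7 150880229885984 ∷ cert 0 1 9 8 5887001349949472 ∷ []) (cert 0 2 5 4 5744791488544 ∷ cert 0 2 5 4 6843229342721 ∷ cert 2 3 7 2 7842816952352 ∷ []) ∷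
  code (0 ∷ 1 ∷ 0 ∷ 0 ∷ 3 ∷ 5 ∷ 5 ∷ 42 ∷ 74 ∷ 28 ∷ []) 1 (cert 0 1 4 8 9331766856877120 ∷ cert 0 1 10 9 192890905995348000 ∷ []) (cert 0 2 8 4 183936475039776 ∷ cert 0 2 8 4 220219251460128 ∷ cert 0 2 8 4 252104115555329 ∷ cert 0 2 8 4 288386891975681 ∷ cert 2 3 8 3 321339996080160 ∷ []) ∷
  code (0 ∷ 0 ∷ 0 ∷ 0 ∷ 3 ∷ 5 ∷ 10 ∷ 12 ∷ 144 ∷ 96 ∷ []) 2 [] (cert 0 1 4 5 150880229885984 ∷ cert 0 1 4 5 184931771843648 ∷ cert 0 1 4 5 220081784160353 ∷ cert 0 1 4 5 256330266869858 ∷ []) ∷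
  code (0 ∷ 0 ∷ 0 ∷ 0 ∷ 3 ∷ 3 ∷ 28 ∷ 44 ∷ 5 ∷ 10 ∷ 768 ∷ []) 1 [] (cert 0 1 9 5 4725951431804960 ∷ cert 0 1 9 5 5887001349949472 ∷ cert 0 1 9 5 6907313783865442 ∷ cert 0 1 9 5 8068363702009954 ∷ cert 0 1 4 6 9331766856877120 ∷ cert 0 1 4 6 10422482391597153 ∷ []) ∷
  code (0 ∷ 0 ∷ 0 ∷ 0 ∷ 3 ∷ 3 ∷ 5 ∷ 5 ∷ 74 ∷ 138 ∷ 28 ∷ 44 ∷ []) 0 [] (cert 0 1 10 6 155771393442678816 ∷ cert 0 1 10 6 192890905995348000 ∷ cert 0 1 10 6 225509084452979776 ∷ cert 0 1 10 6 262628597005648960 ∷ cert 0 1 10 6 295244509935108193 ∷ cert 0 1 10 6 332364022487777377 ∷ cert 0 1 10 6 364977669889097826 ∷ cert 0 1 10 6 402097182441767010 ∷ []) ∷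
  []

family₂₃ : List Code
family₂₃ =
  code (0 ∷ 0 ∷ 3 ∷ 3 ∷ 3 ∷ []) 6 (cert 0 2 5 1 6612357123 ∷ cert 0 3 5 1 6612452355 ∷ cert 0 4 5 1 6614483971 ∷ cert 1 2 5 1 6612357216 ∷ cert 1 3 5 1 6612452448 ∷ cert 1 4 5 1 6614484064 ∷ []) [] ∷
  code (0 ∷ 1 ∷ 1 ∷ 6 ∷ 1 ∷ 7 ∷ 56 ∷ []) 5 (cert 0 1 5 2 178479235201 ∷ cert 0 1 7 3 7911500742785 ∷ cert 0 2 5 2 178479239169 ∷ cert 0 2 7 3 7911500746753 ∷ cert 0 4 7 4 7911501825026 ∷ cert 1 3 7 5 7911500809280 ∷ cert 2 3 7 5 7911500810272 ∷ []) (cert 1 4 5 0 6614484064 ∷ []) ∷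
  code (0 ∷ 1 ∷ 1 ∷ 2 ∷ 4 ∷ 18 ∷ 12 ∷ 97 ∷ []) 5 (cert 0 1 8 6 252104112439426 ∷ cert 0 2 8 6 252106194849794 ∷ cert 1 3 8 7 287288452055137 ∷ cert 2 4 8 7 287289494277121 ∷ []) (cert 0 2 5 1 178479239169 ∷ cert 0 2 5 1 211766250498 ∷ cert 2 5 6 8 247132684353 ∷ []) ∷
  code (0 ∷ 1 ∷ 1 ∷ 2 ∷ 4 ∷ 19 ∷ 13 ∷ 82 ∷ 44 ∷ []) 4 (cert 0 1 5 6 288318237540481 ∷ cert 0 1 9 9 10353350690308225 ∷ cert 0 2 6 6 289387551199233 ∷ cert 0 2 9 9 10355483075481601 ∷ cert 1 3 9 10 11444032939099232 ∷ cert 2 4 9 10 11445099133209632 ∷ []) (cert 0 2 7 1 7911500746753 ∷ cert 0 2 7 1 8975613463554 ∷ []) ∷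
  code (0 ∷ 0 ∷ 3 ∷ 3 ∷ 0 ∷ 7 ∷ 11 ∷ 84 ∷ 56 ∷ []) 4 (cert 0 2 5 7 253168227191842 ∷ cert 0 2 9 10 10353350692342786 ∷ cert 0 3 6 7 255302691815458 ∷ cert 0 3 9 10 10355483076559874 ∷ cert 1 2 5 7 253168227191873 ∷ cert 1 2 9 10 10353350692342848 ∷ cert 1 3 6 7 255302691815489 ∷ cert 1 3 9 10 10355483076559936 ∷ []) (cert 0 4 7 1 7911501825026 ∷ cert 0 4 7 1 8975613494275 ∷ []) ∷
  code (0 ∷ 1 ∷ 1 ∷ 1 ∷ 2 ∷ 7 ∷ 11 ∷ 84 ∷ 56 ∷ []) 4 (cert 0 1 5 6 220148518652000 ∷ cert 0 1 6 6 219087527543904 ∷ cert 0 1 9 9 9264800827769952 ∷ cert 0 2 5 7 219083365748768 ∷ cert 0 2 9 10 9263734634647553 ∷ cert 0 3 6 7 220152678451232 ∷ cert 0 3 9 10 9264800826787841 ∷ cert 1 4 9 11 9264800827803680 ∷ []) (cert 2 3 7 1 7911500810272 ∷ cert 2 3 7 1 8975611464736 ∷ []) ∷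
  code (0 ∷ 1 ∷ 1 ∷ 0 ∷ 8 ∷ 11 ∷ 9 ∷ 52 ∷ 18 ∷ 324 ∷ []) 4 (cert 0 1 5 12 8206966653552768 ∷ cert 0 1 10 13 330286945224625282 ∷ cert 0 2 10 14 331409649644376066 ∷ cert 3 4 10 15 366314676021200928 ∷ []) (cert 0 1 6 5 219087527543904 ∷ cert 0 2 8 2 252106194849794 ∷ cert 0 2 6 3 289387551199233 ∷ cert 4 6 7 16 324637420555296 ∷ []) ∷
  code (0 ∷ 1 ∷ 1 ∷ 2 ∷ 0 ∷ 7 ∷ 17 ∷ 12 ∷ 56 ∷ 194 ∷ []) 4 (cert 0 1 5 12 5990353328965728 ∷ cert 0 1 10 13 259354188058787937 ∷ cert 0 2 5 17 5990386614995969 ∷ cert 0 2 10 18 259353156192898049 ∷ cert 1 3 10 15 295384115726910528 ∷ []) (cert 0 3 6 5 220152678451232 ∷ cert 1 3 6 4 255302691815489 ∷ cert 2 4 8 2 287289494277121 ∷ cert 1 6 7 19 325702574508064 ∷ []) ∷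
  code (0 ∷ 0 ∷ 3 ∷ 1 ∷ 2 ∷ 21 ∷ 46 ∷ []) 5 (cert 0 2 5 20 211763138563 ∷ cert 0 2 7 16 8974570164227 ∷ cert 0 3 7 19 8974571275267 ∷ cert 1 2 6 20 213844529248 ∷ cert 1 2 7 16 8975611367520 ∷ cert 1 4 7 19 8975613494368 ∷ cert 2 5 6 2 247132684353 ∷ []) [] ∷
  code (0 ∷ 1 ∷ 1 ∷ 0 ∷ 8 ∷ 11 ∷ 13 ∷ 22 ∷ 137 ∷ 82 ∷ 52 ∷ []) 3 (cert 0 1 5 13 369619737273008257 ∷ cert 0 1 11 21 12908875885690519682 ∷ cert 0 2 6 13 370710459048890369 ∷ cert 0 2 11 21 12912148035415347202 ∷ cert 3 4 11 22 14027948961277511712 ∷ []) (cert 0 1 9 5 9264800827769952 ∷ cert 0 2 9 3 10355483075481601 ∷ cert 0 2 9 3 11445099132129282 ∷ []) ∷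
  code (0 ∷ 1 ∷ 2 ∷ 1 ∷ 0 ∷ 7 ∷ 19 ∷ 13 ∷ 146 ∷ 76 ∷ 56 ∷ []) 3 (cert 0 1 5 13 299745740043881536 ∷ cert 0 1 6 14 262627332202759264 ∷ cert 0 1 11 21 10677274033969497184 ∷ cert 0 3 7 15 335807728367831041 ∷ cert 0 3 11 22 11795324629272365057 ∷ cert 1 2 5 18 335807555696660512 ∷ cert 1 2 11 23 10678432986837355552 ∷ []) (cert 0 3 9 5 9264800826787841 ∷ cert 1 3 9 4 10355483076559936 ∷ cert 2 4 9 3 11445099133209632 ∷ []) ∷
  code (0 ∷ 1 ∷ 1 ∷ 1 ∷ 0 ∷ 7 ∷ 11 ∷ 13 ∷ 146 ∷ 84 ∷ 56 ∷ []) 3 (cert 0 1 5 15 262627327001790560 ∷ cert 0 1 6 15 261536616668005472 ∷ cert 0 1 11 22 10677274033969497184 ∷ cert 0 2 5 15 262695530008710208 ∷ cert 0 2 7 15 261570901244447776 ∷ cert 0 2 11 22 10677342270262414368 ∷ cert 0 3 6 15 263786251784651840 ∷ cert 0 3 7 15 263752333354174496 ∷ cert 0 3 11 22 10678432986837387296 ∷ []) (cert 1 4 9 5 9264800827803680 ∷ cert 1 4 9 5 10355483076559936 ∷ cert 1 4 9 5 11445099133207648 ∷ []) ∷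
  code (0 ∷ 0 ∷ 1 ∷ 2 ∷ 0 ∷ 9 ∷ 6 ∷ 17 ∷ 18 ∷ 292 ∷ 200 ∷ []) 4 (cert 0 2 11 24 10569251586450690051 ∷ cert 1 3 11 24 10570346563633284192 ∷ []) (cert 0 1 5 7 5990353328965728 ∷ cert 0 1 5 7 7079936099617857 ∷ cert 0 1 5 6 8206966653552768 ∷ cert 0 1 5 6 9366918100225153 ∷ cert 3 5 6 25 10492854384263265 ∷ cert 3 5 6 25 11584634030752832 ∷ []) ∷
  code (0 ∷ 1 ∷ 0 ∷ 4 ∷ 0 ∷ 11 ∷ 21 ∷ 74 ∷ 5 ∷ 52 ∷ 18 ∷ 1288 ∷ []) 3 (cert 0 1 5 26 10784158691229728898 ∷ cert 0 1 12 27 412075155090783109251 ∷ cert 2 3 12 28 448966495858673716256 ∷ []) (cert 0 1 10 7 259354188058787937 ∷ cert 0 1 5 10 299745740043881536 ∷ cert 0 1 10 6 330286945224625282 ∷ cert 0 2 6 9 370710459048890369 ∷ cert 3 5 8 29 406707363890956320 ∷ []) ∷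
  code (0 ∷ 0 ∷ 1 ∷ 2 ∷ 0 ∷ 7 ∷ 11 ∷ 9 ∷ 6 ∷ 84 ∷ 56 ∷ 400 ∷ []) 3 (cert 0 2 5 24 11969767576986192930 ∷ cert 0 2 12 28 413223712667027409922 ∷ cert 1 3 6 24 11971946883993141313 ∷ cert 1 3 12 28 413228076596398752832 ∷ []) (cert 0 1 6 10 262627332202759264 ∷ cert 0 1 6 10 299745779571064897 ∷ cert 0 2 10 6 331409649644376066 ∷ cert 0 2 10 6 366313610867118115 ∷ cert 4 7 8 30 407901468851537952 ∷ []) ∷
  code (0 ∷ 1 ∷ 1 ∷ 0 ∷ 0 ∷ 7 ∷ 11 ∷ 9 ∷ 84 ∷ 18 ∷ 56 ∷ 644 ∷ []) 3 (cert 0 1 5 26 8514378632582497344 ∷ cert 0 1 6 24 7324339787399300160 ∷ cert 0 1 12 27 303699547430104171584 ∷ cert 0 2 5 24 8514346678024736800 ∷ cert 0 2 12 28 303699445174481522689 ∷ []) (cert 0 3 7 11 263752333354174496 ∷ cert 1 3 10 7 295384115726910528 ∷ cert 0 3 7 10 335807728367831041 ∷ cert 3 4 10 6 366314676021200928 ∷ cert 2 7 8 31 407867383991076896 ∷ []) ∷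
  code (0 ∷ 1 ∷ 0 ∷ 4 ∷ 1 ∷ 7 ∷ 21 ∷ 90 ∷ 56 ∷ []) 4 (cert 0 1 5 25 289383390381186 ∷ cert 0 1 9 29 11480281390284930 ∷ cert 0 4 6 32 289387552246785 ∷ cert 0 4 9 30 10355449790563330 ∷ cert 2 3 9 31 11445099131178016 ∷ cert 4 6 7 6 324637420555296 ∷ []) (cert 1 2 7 8 8975611367520 ∷ []) ∷
  code (0 ∷ 1 ∷ 1 ∷ 0 ∷ 0 ∷ 10 ∷ 18 ∷ 12 ∷ 20 ∷ 289 ∷ 193 ∷ []) 4 (cert 0 1 11 26 7110489171830046849 ∷ cert 0 2 11 26 7111582152892944385 ∷ []) (cert 0 2 5 7 5990386614995969 ∷ cert 0 2 5 7 7080035956625409 ∷ cert 0 2 5 7 8204736494865410 ∷ cert 0 2 5 7 9364754513563650 ∷ cert 0 5 6 33 10492854384298016 ∷ cert 0 5 6 33 11584634029738016 ∷ []) ∷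
  code (0 ∷ 1 ∷ 1 ∷ 0 ∷ 0 ∷ 11 ∷ 21 ∷ 74 ∷ 52 ∷ 18 ∷ 12 ∷ 1537 ∷ []) 3 (cert 0 1 5 24 9627928859213168737 ∷ cert 0 1 12 27 339438987106848964737 ∷ cert 0 2 6 24 9631204208556444673 ∷ cert 0 2 12 27 339441171735455535105 ∷ []) (cert 0 2 10 7 259353156192898049 ∷ cert 0 2 10 7 294254920539869186 ∷ cert 1 2 5 10 335807555696660512 ∷ cert 1 2 5 10 370676334663339072 ∷ cert 0 5 6 34 405577036979111968 ∷ []) ∷
  code (0 ∷ 1 ∷ 1 ∷ 2 ∷ 0 ∷ 7 ∷ 19 ∷ 78 ∷ 56 ∷ []) 4 (cert 0 1 5 25 255265245037664 ∷ cert 0 1 6 35 255302691782753 ∷ cert 0 1 9 29 10390565476696161 ∷ cert 0 2 5 33 255298529988609 ∷ cert 0 2 9 34 10425781019807745 ∷ cert 1 3 7 36 255402548790336 ∷ cert 1 3 9 31 10355483075544128 ∷ cert 1 6 7 7 325702574508064 ∷ []) (cert 1 4 7 8 8975613494368 ∷ []) ∷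
  code (0 ∷ 1 ∷ 0 ∷ 4 ∷ 1 ∷ 21 ∷ 24 ∷ 98 ∷ []) 5 (cert 0 1 8 35 287289493192834 ∷ cert 0 4 5 37 5744791424064 ∷ cert 0 4 8 32 252106195894370 ∷ cert 2 3 8 36 287289492245536 ∷ []) (cert 1 2 6 8 213844529248 ∷ cert 3 5 6 38 247132621888 ∷ []) ∷
  code (0 ∷ 0 ∷ 1 ∷ 2 ∷ 0 ∷ 7 ∷ 11 ∷ 25 ∷ 22 ∷ 265 ∷ 134 ∷ 84 ∷ 56 ∷ []) 2 (cert 0 2 5 27 454657812064992497698 ∷ cert 0 2 13 39 15583403114562508066818 ∷ cert 1 3 6 27 455773613000215363649 ∷ cert 1 3 13 39 15585637991760450946112 ∷ []) (cert 0 1 11 10 10677274033969497184 ∷ cert 0 1 11 10 11795256392980463681 ∷ cert 0 2 11 9 12912148035415347202 ∷ cert 0 2 11 9 14027948961275318307 ∷ []) ∷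
  code (0 ∷ 1 ∷ 1 ∷ 0 ∷ 0 ∷ 7 ∷ 11 ∷ 13 ∷ 22 ∷ 265 ∷ 146 ∷ 84 ∷ 56 ∷ []) 2 (cert 0 1 5 27 383106872951858857056 ∷ cert 0 1 6 28 383106872993465368641 ∷ cert 0 1 13 39 13298171988929392246849 ∷ cert 0 2 5 27 383176678779369098272 ∷ cert 0 2 7 28 383176679020691589121 ∷ cert 0 2 13 39 13298276697720586602497 ∷ []) (cert 0 3 11 11 10678432986837387296 ∷ cert 0 3 11 10 11795324629272365057 ∷ cert 0 3 11 10 12912182153561900034 ∷ cert 3 4 11 9 14027948961277511712 ∷ []) ∷
  code (0 ∷ 1 ∷ 1 ∷ 0 ∷ 0 ∷ 11 ∷ 19 ∷ 13 ∷ 21 ∷ 266 ∷ 146 ∷ 76 ∷ 52 ∷ []) 2 (cert 0 1 5 28 343871651572103644256 ∷ cert 0 1 6 28 341638957943857677408 ∷ cert 0 1 13 39 12152205202096605168768 ∷ cert 0 2 7 28 345167424064550210592 ∷ cert 0 2 8 28 346282141733022141472 ∷ cert 0 2 13 39 12154580782796827070496 ∷ []) (cert 1 2 11 10 10678432986837355552 ∷ cert 1 2 11 10 11794233912697360416 ∷ cert 1 2 11 10 12909898365973597248 ∷ cert 1 2 11 10 14025699291833602112 ∷ []) ∷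
  code (0 ∷ 1 ∷ 0 ∷ 0 ∷ 0 ∷ 7 ∷ 5 ∷ 17 ∷ 10 ∷ 56 ∷ 12 ∷ 1154 ∷ 336 ∷ []) 3 (cert 0 1 5 40 199862231017249083456 ∷ cert 0 1 13 41 8501006210680525750369 ∷ []) (cert 0 1 6 15 7324339787399300160 ∷ cert 0 2 5 15 8514346678024736800 ∷ cert 0 2 6 18 9631204208556444673 ∷ cert 1 3 11 12 10570346563633284192 ∷ cert 1 3 6 14 11971946883993141313 ∷ cert 1 5 7 42 13124903635316213792 ∷ cert 4 6 7 43 14241867743447058464 ∷ []) ∷
  code (0 ∷ 1 ∷ 0 ∷ 4 ∷ 0 ∷ 14 ∷ 57 ∷ 9 ∷ 20 ∷ 386 ∷ []) 4 (cert 0 1 10 42 367439510740435075 ∷ cert 2 3 5 44 9366951388384288 ∷ cert 2 3 10 43 366314674978950176 ∷ cert 3 5 6 12 11584634030752832 ∷ []) (cert 0 1 5 19 255265245037664 ∷ cert 0 1 5 16 289383390381186 ∷ cert 2 5 8 45 325667208135744 ∷ []) ∷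
  code (0 ∷ 1 ∷ 0 ∷ 0 ∷ 0 ∷ 13 ∷ 50 ∷ 5 ∷ 9 ∷ 20 ∷ 24 ∷ 1154 ∷ 770 ∷ []) 3 (cert 0 1 13 46 8502125424387365568642 ∷ []) (cert 0 2 11 17 7111582152892944385 ∷ cert 0 1 5 15 8514378632582497344 ∷ cert 0 1 5 15 9630180590309409888 ∷ cert 0 1 5 13 10784158691229728898 ∷ cert 0 1 5 13 11971949008053633155 ∷ cert 1 5 7 47 13124835465595291680 ∷ cert 1 5 7 47 14242852939252173856 ∷ []) ∷
  code (0 ∷ 1 ∷ 0 ∷ 0 ∷ 0 ∷ 7 ∷ 13 ∷ 26 ∷ 133 ∷ 82 ∷ 9 ∷ 56 ∷ 20 ∷ 5122 ∷ []) 2 (cert 0 1 5 41 13480328942316163173505 ∷ cert 0 1 14 48 423220567001561862013058 ∷ []) (cert 0 1 12 15 303699547430104171584 ∷ cert 0 2 12 18 339441171735455535105 ∷ cert 0 2 5 22 383176678779369098272 ∷ cert 0 1 12 13 412075155090783109251 ∷ cert 1 3 6 21 455773613000215363649 ∷ cert 1 5 8 49 492631008536160177184 ∷ []) ∷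
  code (0 ∷ 1 ∷ 0 ∷ 0 ∷ 0 ∷ 7 ∷ 19 ∷ 13 ∷ 146 ∷ 9 ∷ 6 ∷ 76 ∷ 56 ∷ 1552 ∷ []) 2 (cert 0 1 5 41 11155969453603247165472 ∷ cert 0 1 6 46 11151501882781218210880 ∷ cert 0 1 14 48 350022733632894511711296 ∷ []) (cert 0 2 12 15 303699445174481522689 ∷ cert 0 2 8 23 346282141733022141472 ∷ cert 0 2 7 22 383176679020691589121 ∷ cert 1 3 12 14 413228076596398752832 ∷ cert 2 3 12 13 448966495858673716256 ∷ cert 4 8 9 50 493856089924652075040 ∷ []) ∷
  code (0 ∷ 1 ∷ 0 ∷ 4 ∷ 0 ∷ 13 ∷ 11 ∷ 21 ∷ 58 ∷ 138 ∷ 84 ∷ []) 3 (cert 0 1 6 47 369619743515115650 ∷ cert 0 1 11 49 14062885911003168898 ∷ cert 2 3 5 51 370710452807797761 ∷ cert 2 3 11 50 14027948925909077024 ∷ cert 3 5 8 13 406707363890956320 ∷ []) (cert 0 1 9 19 10390565476696161 ∷ cert 0 1 9 16 11480281390284930 ∷ []) ∷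
  code (0 ∷ 0 ∷ 1 ∷ 2 ∷ 0 ∷ 7 ∷ 11 ∷ 25 ∷ 150 ∷ 84 ∷ 56 ∷ []) 3 (cert 0 2 5 43 333626124628134946 ∷ cert 0 2 11 50 12909999655261080578 ∷ cert 1 3 6 43 335806496786972737 ∷ cert 1 3 11 50 12912182153562915904 ∷ cert 4 7 8 14 407901468851537952 ∷ []) (cert 0 4 9 16 10355449790563330 ∷ cert 0 4 9 16 11445099133206563 ∷ []) ∷
  code (0 ∷ 1 ∷ 1 ∷ 0 ∷ 0 ∷ 7 ∷ 11 ∷ 13 ∷ 150 ∷ 84 ∷ 56 ∷ []) 3 (cert 0 1 5 47 299813909764834400 ∷ cert 0 1 6 42 299813914964788288 ∷ cert 0 1 11 49 11867381021827728480 ∷ cert 0 2 5 43 298723227515031584 ∷ cert 0 2 7 52 298723399144935425 ∷ cert 0 2 11 50 11794232847545470977 ∷ cert 2 7 8 15 407867383991076896 ∷ []) (cert 1 3 9 19 10355483075544128 ∷ cert 2 3 9 16 11445099131178016 ∷ []) ∷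
  code (0 ∷ 1 ∷ 0 ∷ 4 ∷ 0 ∷ 11 ∷ 21 ∷ 52 ∷ 18 ∷ 328 ∷ []) 4 (cert 0 1 5 44 8206966656630882 ∷ cert 0 1 10 51 330286978513797218 ∷ cert 2 3 10 52 331410748083374112 ∷ []) (cert 0 4 8 20 252106195894370 ∷ cert 0 4 6 16 289387552246785 ∷ cert 3 5 7 53 324636382431264 ∷ []) ∷
  code (0 ∷ 1 ∷ 1 ∷ 0 ∷ 0 ∷ 11 ∷ 53 ∷ 18 ∷ 12 ∷ 385 ∷ []) 4 (cert 0 1 5 54 8204836350853217 ∷ cert 0 1 10 47 331410746000900225 ∷ cert 0 2 6 54 8206971857603585 ∷ cert 0 2 10 47 331412878386073601 ∷ cert 0 5 6 17 10492854384298016 ∷ []) (cert 0 2 5 19 255298529988609 ∷ cert 0 2 5 19 289350105467906 ∷ cert 0 6 7 55 323538984732704 ∷ []) ∷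
  code (0 ∷ 1 ∷ 1 ∷ 0 ∷ 0 ∷ 11 ∷ 53 ∷ 19 ∷ 13 ∷ 274 ∷ 140 ∷ []) 3 (cert 0 1 5 56 333623961036390497 ∷ cert 0 1 7 42 333625196781043809 ∷ cert 0 1 11 49 12946026253288308865 ∷ cert 0 2 6 56 335807527612648449 ∷ cert 0 2 8 42 335811955688344577 ∷ cert 0 2 11 49 12948210882935066625 ∷ cert 0 5 6 18 405577036979111968 ∷ []) (cert 0 2 9 19 10425781019807745 ∷ cert 0 2 9 19 11515363791506434 ∷ []) ∷
  code (0 ∷ 1 ∷ 0 ∷ 4 ∷ 0 ∷ 11 ∷ 13 ∷ 10 ∷ 52 ∷ 208 ∷ []) 4 (cert 0 1 5 54 9365886238490722 ∷ cert 0 1 10 56 366313609829056610 ∷ cert 2 3 6 57 9366955550181377 ∷ cert 2 3 10 52 366314676020185120 ∷ []) (cert 0 1 6 19 255302691782753 ∷ cert 0 1 8 20 287289493192834 ∷ cert 4 5 7 53 325701534320672 ∷ []) ∷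
  code (0 ∷ 1 ∷ 1 ∷ 0 ∷ 0 ∷ 7 ∷ 13 ∷ 20 ∷ 56 ∷ 194 ∷ []) 4 (cert 0 1 5 54 7116285447046272 ∷ cert 0 1 10 56 296510014559945856 ∷ cert 0 2 5 44 7080035956625440 ∷ cert 0 2 6 57 7080041156546592 ∷ cert 0 2 10 51 295383050574958624 ∷ []) (cert 1 3 7 19 255402548790336 ∷ cert 2 3 8 20 287289492245536 ∷ cert 1 5 7 58 325701534320672 ∷ []) ∷
  code (0 ∷ 0 ∷ 1 ∷ 2 ∷ 0 ∷ 17 ∷ 18 ∷ 68 ∷ 168 ∷ []) 5 (cert 0 2 9 57 8067467125492738 ∷ cert 1 3 9 57 8068534357820480 ∷ []) (cert 0 4 5 20 5744791424064 ∷ cert 0 4 5 20 6877555460193 ∷ cert 3 5 7 59 7977033597025 ∷ cert 3 5 7 59 9043225707584 ∷ []) ∷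
  code (0 ∷ 0 ∷ 2 ∷ 1 ∷ 1 ∷ 27 ∷ 60 ∷ []) 5 (cert 0 3 5 59 211765297186 ∷ cert 0 3 7 53 9009938695170 ∷ cert 0 4 5 59 211766312994 ∷ cert 0 4 7 53 9009939710978 ∷ cert 1 2 7 58 9009937551456 ∷ cert 3 5 6 20 247132621888 ∷ cert 4 5 6 20 247129574464 ∷ []) [] ∷
  code (0 ∷ 1 ∷ 0 ∷ 0 ∷ 0 ∷ 7 ∷ 11 ∷ 21 ∷ 25 ∷ 14 ∷ 529 ∷ 262 ∷ 138 ∷ 84 ∷ 56 ∷ []) 1 (cert 0 1 5 48 508072197259037929148512 ∷ cert 0 1 6 48 504643336648882793874528 ∷ cert 0 1 15 60 13695397085189433506989152 ∷ []) (cert 0 2 13 23 12154580782796827070496 ∷ cert 0 2 13 22 13298276697720586602497 ∷ cert 0 2 13 22 14440857903497090239489 ∷ cert 1 3 13 21 15585637991760450946112 ∷ cert 1 3 13 21 16728148299895470687328 ∷ []) ∷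
  code (0 ∷ 0 ∷ 0 ∷ 0 ∷ 0 ∷ 5 ∷ 9 ∷ 17 ∷ 6 ∷ 18 ∷ 10 ∷ 580 ∷ 1072 ∷ 392 ∷ []) 3 [] (cert 0 1 5 24 199862231017249083456 ∷ cert 0 1 5 24 235673696401023338592 ∷ cert 0 1 5 24 271380449695165877376 ∷ cert 0 1 5 24 309386287509862878273 ∷ cert 0 1 5 24 347467567105796212865 ∷ cert 0 1 5 24 382093456489337327713 ∷ cert 4 5 6 61 420140996404755696672 ∷ cert 4 5 6 61 458116542499053996064 ∷ cert 4 5 6 61 492741308212883558432 ∷ []) ∷
  code (0 ∷ 0 ∷ 0 ∷ 0 ∷ 0 ∷ 11 ∷ 21 ∷ 74 ∷ 52 ∷ 3 ∷ 5 ∷ 18 ∷ 12 ∷ 4624 ∷ 3080 ∷ []) 2 [] (cert 0 1 13 24 8501006210680525750369 ∷ cert 0 1 13 24 9645820073809781227650 ∷ cert 0 1 5 28 11155969453603247165472 ∷ cert 0 1 5 28 12298479727653408508992 ∷ cert 0 1 5 27 13480328942316163173505 ∷ cert 0 1 5 27 14696626192661093552226 ∷ cert 4 6 7 62 15877181782625936836640 ∷ cert 4 6 7 62 17021995716055217079360 ∷ []) ∷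
  code (0 ∷ 1 ∷ 0 ∷ 0 ∷ 0 ∷ 19 ∷ 7 ∷ 46 ∷ 5 ∷ 10 ∷ 88 ∷ 784 ∷ []) 3 (cert 0 1 5 63 10816881256750448769 ∷ cert 0 1 6 61 10781977267440487552 ∷ cert 0 1 12 62 412071918027620253826 ∷ cert 1 5 7 24 13124903635316213792 ∷ []) (cert 0 1 6 31 299813914964788288 ∷ cert 0 2 8 34 335811955688344577 ∷ cert 0 1 10 25 367439510740435075 ∷ cert 4 7 9 64 407900402659461152 ∷ []) ∷
  code (0 ∷ 1 ∷ 0 ∷ 0 ∷ 0 ∷ 7 ∷ 21 ∷ 90 ∷ 17 ∷ 12 ∷ 56 ∷ 770 ∷ []) 3 (cert 0 1 5 61 8514346678025750624 ∷ cert 0 1 12 62 341745889908841578593 ∷ cert 4 6 7 24 14241867743447058464 ∷ []) (cert 0 2 5 31 298723227515031584 ∷ cert 1 3 6 30 335806496786972737 ∷ cert 2 3 10 25 366314674978950176 ∷ cert 1 6 8 64 407832167406733344 ∷ []) ∷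
  code (0 ∷ 1 ∷ 0 ∷ 0 ∷ 0 ∷ 21 ∷ 17 ∷ 12 ∷ 24 ∷ 290 ∷ 194 ∷ []) 4 (cert 0 1 11 63 8264502525743366242 ∷ []) (cert 0 2 5 36 7080035956625440 ∷ cert 0 1 5 32 8206966656630882 ∷ cert 2 3 5 25 9366951388384288 ∷ cert 1 5 6 65 10492854384298016 ∷ cert 1 5 7 66 11584700602746912 ∷ []) ∷
  code (0 ∷ 0 ∷ 1 ∷ 2 ∷ 0 ∷ 13 ∷ 14 ∷ 89 ∷ 54 ∷ []) 4 (cert 0 2 5 66 288318237478915 ∷ cert 0 2 9 64 11442899134746627 ∷ cert 1 3 6 66 289387550213216 ∷ cert 1 3 9 64 11443967407293536 ∷ cert 2 5 8 25 325667208135744 ∷ cert 3 6 7 25 323538984668162 ∷ []) [] ∷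
  code (0 ∷ 0 ∷ 0 ∷ 0 ∷ 0 ∷ 7 ∷ 11 ∷ 84 ∷ 56 ∷ 5 ∷ 9 ∷ 6 ∷ 10 ∷ 4624 ∷ 3088 ∷ []) 2 [] (cert 0 1 13 26 8502125424387365568642 ∷ cert 0 1 13 26 9644705504298321084547 ∷ cert 0 1 6 28 11151501882781218210880 ∷ cert 0 1 6 28 12294012156831378506848 ∷ cert 0 1 6 28 13475717397044588019777 ∷ cert 0 1 6 28 14692014647387439038561 ∷ cert 4 7 8 67 15873688227258889766944 ∷ cert 4 7 8 67 17016270556770636729376 ∷ []) ∷
  code (0 ∷ 1 ∷ 0 ∷ 0 ∷ 0 ∷ 7 ∷ 13 ∷ 58 ∷ 9 ∷ 82 ∷ 20 ∷ 1282 ∷ []) 3 (cert 0 1 5 68 11970892377379310721 ∷ cert 0 1 12 67 413224839597725352066 ∷ cert 1 5 7 26 13124835465595291680 ∷ []) (cert 0 1 5 31 299813909764834400 ∷ cert 0 2 10 33 331412878386073601 ∷ cert 0 1 6 29 369619743515115650 ∷ cert 1 6 8 69 406707367011518496 ∷ []) ∷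
  code (0 ∷ 0 ∷ 0 ∷ 0 ∷ 0 ∷ 7 ∷ 11 ∷ 21 ∷ 26 ∷ 261 ∷ 138 ∷ 84 ∷ 56 ∷ 9 ∷ 6 ∷ 24592 ∷ []) 1 [] (cert 0 1 14 28 350022733632894511711296 ∷ cert 0 1 14 28 386619883835183360704609 ∷ cert 0 1 14 27 423220567001561862013058 ∷ cert 0 1 14 27 459820022976491179476099 ∷ cert 0 1 6 39 504643336648882793874528 ∷ cert 0 1 6 39 543564778785957695586369 ∷ cert 4 7 8 70 580125070373572491414560 ∷ []) ∷
  code (0 ∷ 1 ∷ 0 ∷ 0 ∷ 0 ∷ 7 ∷ 11 ∷ 13 ∷ 58 ∷ 22 ∷ 521 ∷ 146 ∷ 84 ∷ []) 2 (cert 0 1 5 71 454657777946844990593 ∷ cert 0 1 6 62 454657812038986858625 ∷ cert 0 1 13 70 15582252374356900479106 ∷ cert 1 5 8 27 492631008536160177184 ∷ []) (cert 0 1 11 31 11867381021827728480 ∷ cert 0 2 11 34 12948210882935066625 ∷ cert 0 1 11 29 14062885911003168898 ∷ []) ∷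
  code (0 ∷ 1 ∷ 0 ∷ 0 ∷ 0 ∷ 7 ∷ 19 ∷ 13 ∷ 25 ∷ 278 ∷ 146 ∷ 76 ∷ 56 ∷ []) 2 (cert 0 1 5 62 383106836670122593344 ∷ cert 0 1 6 67 345097618004040025184 ∷ cert 0 1 13 70 13370879086441753805920 ∷ cert 4 8 9 28 493856089924652075040 ∷ []) (cert 0 2 11 31 11794232847545470977 ∷ cert 1 3 11 30 12912182153562915904 ∷ cert 2 3 11 29 14027948925909077024 ∷ []) ∷
  code (0 ∷ 1 ∷ 0 ∷ 0 ∷ 0 ∷ 19 ∷ 14 ∷ 21 ∷ 81 ∷ 44 ∷ 24 ∷ 1154 ∷ []) 3 (cert 0 1 5 68 9631204201275097186 ∷ cert 0 1 12 71 376334624696423186530 ∷ []) (cert 0 2 10 36 295383050574958624 ∷ cert 0 1 10 32 330286978513797218 ∷ cert 2 3 5 29 370710452807797761 ∷ cert 1 5 8 72 406742548229490720 ∷ []) ∷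
  code (0 ∷ 1 ∷ 0 ∷ 0 ∷ 0 ∷ 11 ∷ 19 ∷ 21 ∷ 18 ∷ 76 ∷ 52 ∷ 392 ∷ []) 3 (cert 0 1 5 63 9631204201275164704 ∷ cert 0 1 6 68 8477193087926503456 ∷ cert 0 1 12 71 340592968438594504736 ∷ []) (cert 0 2 7 31 298723399144935425 ∷ cert 2 3 10 32 331410748083374112 ∷ cert 2 3 10 35 366314676020185120 ∷ cert 3 5 8 73 407901433485166624 ∷ []) ∷
  code (0 ∷ 1 ∷ 0 ∷ 4 ∷ 0 ∷ 29 ∷ 11 ∷ 58 ∷ 84 ∷ []) 4 (cert 0 1 6 65 289387552211042 ∷ cert 0 1 9 72 11480283471708258 ∷ cert 2 3 5 74 289383391528961 ∷ cert 2 3 9 73 10390666374907936 ∷ cert 3 5 7 32 324636382431264 ∷ cert 4 5 7 35 325701534320672 ∷ []) (cert 0 4 7 38 9009939710978 ∷ []) ∷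
  code (0 ∷ 1 ∷ 0 ∷ 0 ∷ 0 ∷ 7 ∷ 17 ∷ 10 ∷ 12 ∷ 322 ∷ 176 ∷ []) 4 (cert 0 1 5 75 263854483914656896 ∷ cert 0 1 11 68 10569252686969995394 ∷ []) (cert 0 1 5 36 7116285447046272 ∷ cert 0 2 6 33 8206971857603585 ∷ cert 0 1 5 35 9365886238490722 ∷ cert 1 5 7 76 10492919916103712 ∷ cert 4 5 6 65 11584668356937760 ∷ []) ∷
  code (0 ∷ 1 ∷ 1 ∷ 0 ∷ 0 ∷ 11 ∷ 19 ∷ 77 ∷ 53 ∷ []) 4 (cert 0 1 5 76 288251665580129 ∷ cert 0 1 6 76 287188596097121 ∷ cert 0 1 9 69 11512068476829825 ∷ cert 0 2 7 76 289487408204801 ∷ cert 0 2 8 76 291616673827841 ∷ cert 0 2 9 69 11515466769043457 ∷ cert 0 5 8 33 325667207120928 ∷ cert 0 6 7 33 323538984732704 ∷ []) [] ∷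
  code (0 ∷ 1 ∷ 0 ∷ 0 ∷ 0 ∷ 19 ∷ 7 ∷ 14 ∷ 145 ∷ 10 ∷ 44 ∷ 592 ∷ []) 3 (cert 0 1 5 63 11934863547108982914 ∷ cert 0 1 6 77 10818006063385709696 ∷ cert 0 1 12 71 412071918027620253826 ∷ []) (cert 0 1 10 36 296510014559945856 ∷ cert 0 2 6 34 335807527612648449 ∷ cert 0 1 10 35 366313609829056610 ∷ cert 4 5 8 72 407867382950889504 ∷ []) ∷
  code (0 ∷ 1 ∷ 0 ∷ 0 ∷ 0 ∷ 19 ∷ 17 ∷ 44 ∷ 20 ∷ 258 ∷ 584 ∷ []) 4 (cert 0 1 5 75 190637938118329408 ∷ cert 0 1 11 77 8299441705631974464 ∷ []) (cert 0 2 6 36 7080041156546592 ∷ cert 1 3 9 37 8068534357820480 ∷ cert 2 3 6 35 9366955550181377 ∷ cert 1 6 9 78 10492854384298016 ∷ cert 4 6 9 74 11584701641918496 ∷ []) ∷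
  code (0 ∷ 1 ∷ 1 ∷ 0 ∷ 0 ∷ 15 ∷ 7 ∷ 54 ∷ 88 ∷ []) 4 (cert 0 1 5 78 255298528969856 ∷ cert 0 1 6 65 255302690735232 ∷ cert 0 1 9 72 10390666373825664 ∷ cert 0 2 5 78 255298528972832 ∷ cert 0 2 6 65 255302690738208 ∷ cert 0 2 9 72 10390666373828640 ∷ cert 1 5 7 36 325701534320672 ∷ cert 2 5 7 36 325701534319680 ∷ []) (cert 1 2 7 38 9009937551456 ∷ []) ∷
  code (0 ∷ 1 ∷ 0 ∷ 4 ∷ 0 ∷ 25 ∷ 20 ∷ 106 ∷ []) 5 (cert 0 1 8 78 287289494241378 ∷ cert 2 3 8 74 252106194946080 ∷ cert 3 5 7 37 9043225707584 ∷ []) (cert 0 4 5 38 211766312994 ∷ []) ∷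
  code (0 ∷ 0 ∷ 0 ∷ 0 ∷ 0 ∷ 11 ∷ 19 ∷ 13 ∷ 21 ∷ 14 ∷ 22 ∷ 1033 ∷ 529 ∷ 266 ∷ 146 ∷ 76 ∷ 52 ∷ []) 0 [] (cert 0 1 15 39 13695397085189433506989152 ∷ cert 0 1 15 39 14865327675690694015517824 ∷ cert 0 1 15 39 16037617003842520897093729 ∷ cert 0 1 15 39 17207547594343781405622401 ∷ cert 0 1 15 39 18377547292442920742846562 ∷ cert 0 1 15 39 19547477882944181251375234 ∷ []) ∷
  code (0 ∷ 0 ∷ 0 ∷ 0 ∷ 0 ∷ 21 ∷ 58 ∷ 9 ∷ 6 ∷ 17 ∷ 18 ∷ 1156 ∷ 776 ∷ []) 3 (cert 4 5 6 40 458116542499053996064 ∷ []) (cert 0 1 5 43 8514346678025750624 ∷ cert 0 1 5 43 9630079367593856065 ∷ cert 0 1 6 42 10781977267440487552 ∷ cert 0 1 6 42 11969767548900083841 ∷ cert 3 5 8 79 13123817147102989344 ∷ cert 4 6 7 79 14242887027232213024 ∷ []) ∷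
  code (0 ∷ 0 ∷ 0 ∷ 0 ∷ 0 ∷ 11 ∷ 19 ∷ 92 ∷ 21 ∷ 266 ∷ 5 ∷ 52 ∷ 18 ∷ 5128 ∷ []) 2 (cert 4 6 7 41 15877181782625936836640 ∷ []) (cert 0 1 12 43 341745889908841578593 ∷ cert 0 1 5 50 383106836670122593344 ∷ cert 0 1 12 42 412071918027620253826 ∷ cert 0 1 6 49 454657812038986858625 ∷ cert 4 6 9 80 492630054130941036576 ∷ []) ∷
  code (0 ∷ 0 ∷ 0 ∷ 0 ∷ 0 ∷ 19 ∷ 21 ∷ 44 ∷ 3 ∷ 18 ∷ 20 ∷ 584 ∷ 1288 ∷ []) 3 [] (cert 0 1 11 44 8264502525743366242 ∷ cert 0 1 5 52 9631204201275164704 ∷ cert 0 1 5 42 10816881256750448769 ∷ cert 0 1 5 56 11934863547108982914 ∷ cert 4 5 7 81 13125996515479913536 ∷ cert 4 5 8 82 14241765419172104224 ∷ []) ∷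
  code (0 ∷ 1 ∷ 0 ∷ 0 ∷ 0 ∷ 7 ∷ 19 ∷ 21 ∷ 78 ∷ 154 ∷ 56 ∷ []) 3 (cert 0 1 5 79 335806423972743296 ∷ cert 0 1 6 82 370710424724766817 ∷ cert 0 1 11 80 12984236348200255617 ∷ cert 1 6 8 43 407832167406733344 ∷ cert 4 7 9 42 407900402659461152 ∷ []) (cert 1 3 9 45 11443967407293536 ∷ []) ∷
  code (0 ∷ 1 ∷ 0 ∷ 0 ∷ 0 ∷ 23 ∷ 58 ∷ 17 ∷ 12 ∷ 386 ∷ []) 4 (cert 0 1 5 83 8240020690307201 ∷ cert 0 1 10 81 331410748082290817 ∷ cert 1 5 6 44 10492854384298016 ∷ cert 4 5 6 54 11584668356937760 ∷ []) (cert 0 2 6 58 255302690738208 ∷ cert 0 1 6 53 289387552211042 ∷ cert 1 6 7 84 323538984732704 ∷ []) ∷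
  code (0 ∷ 1 ∷ 0 ∷ 0 ∷ 0 ∷ 19 ∷ 21 ∷ 46 ∷ 24 ∷ 322 ∷ []) 4 (cert 0 1 5 85 8206966655615105 ∷ cert 0 1 10 82 331412775407485058 ∷ cert 1 5 7 44 11584700602746912 ∷ []) (cert 1 3 6 45 289387550213216 ∷ cert 1 5 8 84 325701534320672 ∷ []) ∷
  code (0 ∷ 0 ∷ 0 ∷ 0 ∷ 0 ∷ 7 ∷ 11 ∷ 21 ∷ 154 ∷ 9 ∷ 6 ∷ 84 ∷ 56 ∷ 1552 ∷ []) 2 (cert 4 7 8 46 15873688227258889766944 ∷ []) (cert 0 1 6 50 345097618004040025184 ∷ cert 0 1 6 50 383106838908605923393 ∷ cert 0 1 12 47 413224839597725352066 ∷ cert 0 1 12 47 448966495823307211907 ∷ cert 4 8 9 86 493856089924652075040 ∷ []) ∷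
  code (0 ∷ 0 ∷ 0 ∷ 0 ∷ 0 ∷ 11 ∷ 21 ∷ 3 ∷ 12 ∷ 52 ∷ 18 ∷ 1096 ∷ 400 ∷ []) 3 [] (cert 0 1 6 52 8477193087926503456 ∷ cert 0 1 5 51 9631204201275097186 ∷ cert 0 1 11 54 10569252686969995394 ∷ cert 0 1 5 47 11970892377379310721 ∷ cert 3 5 7 81 13123814019259532352 ∷ cert 4 6 7 87 14242957360543926304 ∷ []) ∷
  code (0 ∷ 1 ∷ 0 ∷ 0 ∷ 0 ∷ 7 ∷ 11 ∷ 13 ∷ 86 ∷ 58 ∷ 146 ∷ []) 3 (cert 0 1 5 87 370710419521670273 ∷ cert 0 1 6 87 370676339862241409 ∷ cert 0 1 11 86 12912180953185550466 ∷ cert 1 5 9 47 406809618472307744 ∷ cert 1 6 8 47 406707367011518496 ∷ []) (cert 0 2 9 55 11515466769043457 ∷ []) ∷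
  code (0 ∷ 0 ∷ 0 ∷ 0 ∷ 0 ∷ 7 ∷ 11 ∷ 21 ∷ 154 ∷ 25 ∷ 22 ∷ 1033 ∷ 518 ∷ 84 ∷ 56 ∷ []) 1 (cert 4 7 8 48 580125070373572491414560 ∷ []) (cert 0 1 13 50 13370879086441753805920 ∷ cert 0 1 13 50 14515692951769966542913 ∷ cert 0 1 13 49 15582252374356900479106 ∷ cert 0 1 13 49 16727066307852752651395 ∷ []) ∷
  code (0 ∷ 0 ∷ 0 ∷ 0 ∷ 0 ∷ 11 ∷ 19 ∷ 28 ∷ 21 ∷ 131 ∷ 76 ∷ 52 ∷ 18 ∷ 4360 ∷ []) 2 [] (cert 0 1 12 52 340592968438594504736 ∷ cert 0 1 12 51 376334624696423186530 ∷ cert 0 1 12 56 412071918027620253826 ∷ cert 0 1 5 49 454657777946844990593 ∷ cert 3 5 8 88 492668163233018905664 ∷ []) ∷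
  code (0 ∷ 1 ∷ 0 ∷ 0 ∷ 0 ∷ 23 ∷ 19 ∷ 14 ∷ 58 ∷ 145 ∷ 76 ∷ []) 3 (cert 0 1 5 89 369619703989012577 ∷ cert 0 1 6 81 369619743516196961 ∷ cert 0 1 11 88 12946028353428717665 ∷ cert 1 5 8 51 406742548229490720 ∷ cert 4 5 8 56 407867382950889504 ∷ []) (cert 0 2 9 58 10390666373828640 ∷ cert 0 1 9 53 11480283471708258 ∷ []) ∷
  code (0 ∷ 1 ∷ 0 ∷ 0 ∷ 0 ∷ 29 ∷ 11 ∷ 19 ∷ 58 ∷ 140 ∷ 84 ∷ []) 3 (cert 0 1 6 81 299813949290972224 ∷ cert 0 1 7 81 298723400187216960 ∷ cert 0 1 11 88 11867381089439941696 ∷ cert 3 5 8 52 407901433485166624 ∷ cert 4 5 8 52 406810684663400480 ∷ []) (cert 2 3 9 53 10390666374907936 ∷ cert 2 3 9 53 11480283470759968 ∷ []) ∷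
  code (0 ∷ 1 ∷ 0 ∷ 0 ∷ 0 ∷ 11 ∷ 25 ∷ 52 ∷ 12 ∷ 338 ∷ []) 4 (cert 0 1 5 83 7080035956687936 ∷ cert 0 1 10 89 295384115727926336 ∷ cert 4 6 9 57 11584701641918496 ∷ []) (cert 2 3 8 59 252106194946080 ∷ cert 2 3 5 53 289383391528961 ∷ []) ∷
  code (0 ∷ 0 ∷ 0 ∷ 0 ∷ 0 ∷ 5 ∷ 10 ∷ 17 ∷ 18 ∷ 136 ∷ 772 ∷ 112 ∷ []) 4 [] (cert 0 1 5 57 190637938118329408 ∷ cert 0 1 5 57 227756317874389089 ∷ cert 0 1 5 54 263854483914656896 ∷ cert 0 1 5 54 298756248263723137 ∷ cert 3 5 9 83 337002793422391328 ∷ cert 3 5 9 83 372995273305164801 ∷ cert 4 5 6 90 407901468851537952 ∷ []) ∷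
  code (0 ∷ 1 ∷ 0 ∷ 0 ∷ 0 ∷ 19 ∷ 7 ∷ 46 ∷ 10 ∷ 336 ∷ []) 4 (cert 0 1 5 91 8206966655615105 ∷ cert 0 1 6 90 8242155153820800 ∷ cert 0 1 10 87 330286910900568194 ∷ cert 1 5 7 54 10492919916103712 ∷ []) (cert 0 2 8 55 291616673827841 ∷ cert 4 5 8 84 325701534320672 ∷ []) ∷
  code (0 ∷ 0 ∷ 0 ∷ 0 ∷ 0 ∷ 21 ∷ 26 ∷ 69 ∷ 42 ∷ 17 ∷ 18 ∷ 520 ∷ 3076 ∷ []) 3 [] (cert 0 1 11 57 8299441705631974464 ∷ cert 0 1 11 57 9417423995990507617 ∷ cert 0 1 6 56 10818006063385709696 ∷ cert 0 1 6 56 11933738752954861697 ∷ cert 4 7 11 89 13126030601380562976 ∷ cert 4 7 11 89 14241763357519645697 ∷ []) ∷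
  code (0 ∷ 1 ∷ 0 ∷ 0 ∷ 0 ∷ 19 ∷ 22 ∷ 17 ∷ 44 ∷ 202 ∷ []) 4 (cert 0 1 5 83 9330701899989089 ∷ cert 0 1 10 89 330284848209002625 ∷ cert 1 6 9 57 10492854384298016 ∷ []) (cert 0 2 5 58 255298528972832 ∷ cert 0 1 8 59 287289494241378 ∷ []) ∷
  code (0 ∷ 0 ∷ 0 ∷ 0 ∷ 0 ∷ 13 ∷ 22 ∷ 89 ∷ 58 ∷ 17 ∷ 10 ∷ 1540 ∷ []) 3 (cert 3 5 8 61 13123817147102989344 ∷ cert 4 6 7 61 14242887027232213024 ∷ []) (cert 0 1 5 64 335806423972743296 ∷ cert 0 1 5 64 370673072635644001 ∷ cert 2 5 8 92 405546314004301856 ∷ []) ∷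
  code (0 ∷ 0 ∷ 0 ∷ 0 ∷ 0 ∷ 11 ∷ 21 ∷ 19 ∷ 13 ∷ 90 ∷ 60 ∷ 274 ∷ 140 ∷ []) 2 (cert 3 5 10 62 490401719093823636544 ∷ cert 4 6 9 62 492630054130941036576 ∷ []) (cert 0 1 11 64 12984236348200255617 ∷ cert 0 1 11 64 14099966907465629794 ∷ []) ∷
  code (0 ∷ 0 ∷ 0 ∷ 0 ∷ 0 ∷ 27 ∷ 13 ∷ 60 ∷ 5 ∷ 82 ∷ 10 ∷ 1296 ∷ []) 3 (cert 3 5 7 68 13123814019259532352 ∷ cert 4 5 7 63 13125996515479913536 ∷ []) (cert 0 1 7 73 298723400187216960 ∷ cert 0 1 10 65 331410748082290817 ∷ cert 0 1 6 72 369619743516196961 ∷ cert 4 7 9 93 406809688164894752 ∷ []) ∷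
  code (0 ∷ 0 ∷ 0 ∷ 0 ∷ 0 ∷ 19 ∷ 11 ∷ 13 ∷ 60 ∷ 84 ∷ 10 ∷ 1168 ∷ []) 3 (cert 4 5 8 63 14241765419172104224 ∷ []) (cert 0 1 10 66 331412775407485058 ∷ cert 0 1 6 64 370710424724766817 ∷ cert 4 5 8 93 406742514943493184 ∷ []) ∷
  code (0 ∷ 0 ∷ 0 ∷ 0 ∷ 0 ∷ 25 ∷ 5 ∷ 18 ∷ 10 ∷ 172 ∷ 336 ∷ []) 4 (cert 3 5 9 75 337002793422391328 ∷ []) (cert 0 1 5 74 7080035956687936 ∷ cert 0 1 5 65 8240020690307201 ∷ cert 0 1 5 78 9330701899989089 ∷ cert 4 5 6 94 11583535592867872 ∷ []) ∷
  code (0 ∷ 1 ∷ 0 ∷ 0 ∷ 0 ∷ 23 ∷ 19 ∷ 78 ∷ 58 ∷ []) 4 (cert 0 1 5 94 289350104385665 ∷ cert 0 1 6 95 289387551195265 ∷ cert 0 1 9 93 11479151746809985 ∷ cert 1 5 8 66 325701534320672 ∷ cert 1 6 7 65 323538984732704 ∷ cert 4 5 8 76 325701534320672 ∷ []) [] ∷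
  code (0 ∷ 0 ∷ 0 ∷ 0 ∷ 0 ∷ 11 ∷ 21 ∷ 18 ∷ 12 ∷ 304 ∷ 200 ∷ []) 4 [] (cert 0 1 5 66 8206966655615105 ∷ cert 0 1 5 66 9366918104383586 ∷ cert 4 5 7 95 10492920956291104 ∷ cert 4 5 7 95 11584700601730112 ∷ []) ∷
  code (0 ∷ 0 ∷ 0 ∷ 0 ∷ 0 ∷ 7 ∷ 11 ∷ 21 ∷ 25 ∷ 278 ∷ 154 ∷ 84 ∷ 56 ∷ []) 2 (cert 4 7 10 67 492741376516789701664 ∷ cert 4 8 9 67 493856089924652075040 ∷ []) (cert 0 1 11 69 12912180953185550466 ∷ cert 0 1 11 69 14027911512448860291 ∷ []) ∷
  code (0 ∷ 0 ∷ 0 ∷ 0 ∷ 0 ∷ 11 ∷ 19 ∷ 92 ∷ 21 ∷ 52 ∷ 18 ∷ 1288 ∷ []) 3 (cert 4 6 7 68 14242957360543926304 ∷ []) (cert 0 1 10 76 330286910900568194 ∷ cert 0 1 6 69 370676339862241409 ∷ cert 3 5 8 93 406707363890955328 ∷ []) ∷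
  code (0 ∷ 0 ∷ 0 ∷ 0 ∷ 0 ∷ 27 ∷ 13 ∷ 21 ∷ 60 ∷ 26 ∷ 517 ∷ 138 ∷ 82 ∷ []) 2 (cert 3 5 8 71 492668163233018905664 ∷ cert 4 5 8 71 491551270492144010304 ∷ []) (cert 0 1 11 73 11867381089439941696 ∷ cert 0 1 11 72 12946028353428717665 ∷ cert 0 1 11 72 14062885911003201665 ∷ []) ∷
  code (0 ∷ 0 ∷ 0 ∷ 0 ∷ 0 ∷ 13 ∷ 26 ∷ 25 ∷ 69 ∷ 50 ∷ 10 ∷ 1172 ∷ []) 3 (cert 4 7 11 77 13126030601380562976 ∷ []) (cert 0 1 10 74 295384115727926336 ∷ cert 0 1 10 78 330284848209002625 ∷ cert 0 1 5 72 369619703989012577 ∷ []) ∷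
  code (0 ∷ 0 ∷ 0 ∷ 0 ∷ 0 ∷ 21 ∷ 58 ∷ 17 ∷ 18 ∷ 136 ∷ 772 ∷ []) 4 (cert 4 5 6 75 407901468851537952 ∷ []) (cert 0 1 6 76 8242155153820800 ∷ cert 0 1 6 76 9331737925519489 ∷ cert 3 7 9 94 10493986108180512 ∷ cert 3 7 9 94 11583635450825729 ∷ []) ∷
  code (0 ∷ 0 ∷ 0 ∷ 0 ∷ 0 ∷ 19 ∷ 21 ∷ 18 ∷ 20 ∷ 296 ∷ 200 ∷ []) 4 [] (cert 0 1 5 76 8206966655615105 ∷ cert 0 1 5 76 9366918103335042 ∷ cert 3 5 7 95 10492920956291104 ∷ cert 3 5 7 95 11584700602745920 ∷ []) ∷
  code (0 ∷ 0 ∷ 0 ∷ 0 ∷ 0 ∷ 13 ∷ 21 ∷ 25 ∷ 54 ∷ 142 ∷ 90 ∷ []) 3 (cert 2 5 8 79 405546314004301856 ∷ cert 3 7 9 79 403433123389443104 ∷ cert 4 6 10 79 407864020022956064 ∷ []) [] ∷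
  code (0 ∷ 0 ∷ 0 ∷ 0 ∷ 0 ∷ 27 ∷ 13 ∷ 21 ∷ 60 ∷ 154 ∷ 82 ∷ []) 3 (cert 3 5 8 87 406707363890955328 ∷ cert 4 5 8 82 406742514943493184 ∷ cert 4 7 9 81 406809688164894752 ∷ []) (cert 0 1 9 84 11479151746809985 ∷ []) ∷
  code (0 ∷ 0 ∷ 0 ∷ 0 ∷ 0 ∷ 21 ∷ 58 ∷ 25 ∷ 18 ∷ 396 ∷ []) 4 (cert 3 7 9 90 10493986108180512 ∷ cert 4 5 6 83 11583535592867872 ∷ []) (cert 0 1 5 84 289350104385665 ∷ []) ∷
  code (0 ∷ 0 ∷ 0 ∷ 0 ∷ 0 ∷ 27 ∷ 21 ∷ 60 ∷ 18 ∷ 328 ∷ []) 4 (cert 3 5 7 91 10492920956291104 ∷ cert 4 5 7 85 10492920956291104 ∷ []) (cert 0 1 6 84 289387551195265 ∷ cert 3 6 7 96 324637422618656 ∷ []) ∷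
  code (0 ∷ 0 ∷ 0 ∷ 0 ∷ 0 ∷ 27 ∷ 29 ∷ 90 ∷ 60 ∷ []) 4 (cert 3 5 8 95 325701534319680 ∷ cert 3 6 7 95 324637422618656 ∷ cert 4 5 8 95 325701533303872 ∷ cert 4 6 7 95 324637421602848 ∷ []) [] ∷
  []

-- The three explicitly listed families

zero-bits : ∀ u → bit 0 u ≡ true → ⊥
zero-bits (suc u) p = zero-bits u p

bits₄ : ∀ {u} → bit 15 u ≡ true → u < 4
bits₄ {0} _ = s≤s z≤n
bits₄ {1} _ = s≤s (s≤s z≤n)
bits₄ {2} _ = s≤s (s≤s (s≤s z≤n))
bits₄ {3} _ = s≤s (s≤s (s≤s (s≤s z≤n)))
bits₄ {suc (suc (suc (suc u)))} p = ⊥-elim (zero-bits u p)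

bits₄⁻ : ∀ {u} → u < 4 → bit 15 u ≡ true
bits₄⁻ {0} _ = refl
bits₄⁻ {1} _ = refl
bits₄⁻ {2} _ = refl
bits₄⁻ {3} _ = refl
bits₄⁻ {suc (suc (suc (suc u)))} (s≤s (s≤s (s≤s (s≤s ()))))

bits₅ : ∀ {u} → bit 31 u ≡ true → u < 5
bits₅ {0} _ = s≤s z≤n
bits₅ {suc u} p = s≤s (bits₄ p)

bits₅⁻ : ∀ {u} → u < 5 → bit 31 u ≡ true
bits₅⁻ {0} _ = refl
bits₅⁻ {suc u} (s≤s p) = bits₄⁻ p

-- Each `refl` in the checks evaluates a Boolean test on the whole list. For `d = 4` a base vertex
-- may have only four neighbours, no more than there are base vertices; hence the comparison by
-- numbers of degrees when `n = 0`.
family-1-3 : ∃ λ k → ∀ n → FamilySize (K 1 3 (4 + n)) k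
family-1-3 = coded-family refl (separated-by-counts refl refl refl) 1 3 (s≤s z≤n) (bipartite-core 1 3 _ refl refl refl)
  where open Separation 4 15 bits₄ bits₄⁻ (ℕₚ.≤ᵇ⇒≤ 4 4 _) family₁₃

family-2-2 : ∃ λ k → ∀ n → FamilySize (K 2 2 (4 + n)) k
family-2-2 = coded-family refl (separated-by-counts refl refl refl) 2 2 (s≤s z≤n) (bipartite-core 2 2 _ refl refl refl)
  where open Separation 4 15 bits₄ bits₄⁻ (ℕₚ.≤ᵇ⇒≤ 4 4 _) family₂₂

-- Here `d = 6` exceeds the size 5 of the base, so the degrees show the base even when `n = 0`.
family-2-3 : ∃ λ k → ∀ n → FamilySize (K 2 3 (6 + n)) k
family-2-3 = coded-family refl (separated-by-degree refl refl) 2 3 (s≤s z≤n) (bipartite-core 2 3 _ refl refl refl)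
  where open Separation 5 31 bits₅ bits₅⁻ (ℕₚ.≤ᵇ⇒≤ 4 5 _) family₂₃

-- Configurations of edge-disjoint triangles

Finite : Set → Set
Finite X = ∃ λ n → X ↔ Fin n

finite-⊎ : ∀ {X Y} → Finite X → Finite Y → Finite (X ⊎ Y)
finite-⊎ (m , e) (n , f) = m + n , ↔-trans (e ⊎-↔ f) (↔-sym Finₚ.+↔⊎)

finite-≡ : ∀ (b v : Bool) → Finite (b ≡ v)
finite-≡ b v with b Bool.≟ v
... | yes p = 1 , mk↔ₛ′ (λ _ → zero) (λ _ → p) (λ { zero → refl }) (λ q → uip p q)
... | no n = 0 , mk↔ₛ′ (⊥-elim ∘ n) (λ ()) (λ ()) (λ q → ⊥-elim (n q))

finite-fiberᶠ : ∀ n (f : Fin n → Bool) v → Finite (Σ (Fin n) λ i → f i ≡ v)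
finite-fiberᶠ zero f v = 0 , mk↔ₛ′ (λ { (() , _) }) (λ ()) (λ ()) (λ { (() , _) })
finite-fiberᶠ (suc n) f v with finite-⊎ (finite-≡ (f zero) v) (finite-fiberᶠ n (f ∘ suc) v)
... | m , e = m , ↔-trans (mk↔ₛ′ (λ { (zero , p) → inj₁ p ; (suc i , p) → inj₂ (i , p) })
    (λ { (inj₁ p) → zero , p ; (inj₂ (i , p)) → suc i , p })
    (λ { (inj₁ p) → refl ; (inj₂ (i , p)) → refl }) (λ { (zero , p) → refl ; (suc i , p) → refl })) e

finite-fiber : ∀ {X} → Finite X → (f : X → Bool) → ∀ v → Finite (Σ X λ x → f x ≡ v)
finite-fiber {X} (n , e) f v with finite-fiberᶠ n (f ∘ Inverse.from e) v
... | m , g = m , ↔-trans (mk↔ₛ′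
    (λ { (x , p) → Inverse.to e x , trans (cong f (Inverse.strictlyInverseʳ e x)) p })
    (λ { (i , p) → Inverse.from e i , p })
    (λ { (i , p) → pair-≡ (Inverse.strictlyInverseˡ e i) })
    (λ { (x , p) → pair-≡ (Inverse.strictlyInverseʳ e x) })) g
  where
  pair-≡ : ∀ {Y : Set} {h : Y → Bool} {x y : Y} {p : h x ≡ v} {q : h y ≡ v} → x ≡ y → (x , p) ≡ (y , q)
  pair-≡ {p = p} {q} refl = cong (_ ,_) (uip p q)

¬true⇒false : ∀ {b : Bool} → ¬ (b ≡ true) → b ≡ false
¬true⇒false {true} n = ⊥-elim (n refl)
¬true⇒false {false} n = refl

search : ∀ {n} (f : Fin n → Bool) → (∃ λ i → f i ≡ true) ⊎ (∀ i → f i ≡ false)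
search f with Finₚ.any? (λ i → f i Bool.≟ true)
... | yes p = inj₁ p
... | no n = inj₂ (λ i → ¬true⇒false (λ p → n (i , p)))

has-≤ : ∀ {k n} G v → k ≤ n → Has n G v → Has k G v
has-≤ G v p (g , inj , a) = (λ i → g (inject≤ i p)) , (λ e → Finₚ.inject≤-injective p p _ _ (inj e)) , (λ i → a _)

cover-three : ∀ {n} → n ≡ 3 → (x y z : Fin n) → x ≢ y → y ≢ z → x ≢ z → ∀ u → In x y z u
cover-three refl x y z x≢y y≢z x≢z u with (u Fin.≟ x) ⊎-dec ((u Fin.≟ y) ⊎-dec (u Fin.≟ z))
... | yes i = i
... | no n = ⊥-elim (no-injection {P = λ _ → ⊤} (λ i _ → i) (λ _ _ → id) g (λ {i} {j} → g-inj i j) (λ _ → tt))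
  where
  g : Fin 4 → Fin 3
  g zero = u
  g (suc zero) = x
  g (suc (suc zero)) = y
  g (suc (suc (suc zero))) = z
  g-inj : ∀ i j → g i ≡ g j → i ≡ j
  g-inj zero zero _ = refl
  g-inj zero (suc zero) e = ⊥-elim (n (inj₁ e))
  g-inj zero (suc (suc zero)) e = ⊥-elim (n (inj₂ (inj₁ e)))
  g-inj zero (suc (suc (suc zero))) e = ⊥-elim (n (inj₂ (inj₂ e)))
  g-inj (suc zero) zero e = ⊥-elim (n (inj₁ (sym e)))
  g-inj (suc zero) (suc zero) _ = refl
  g-inj (suc zero) (suc (suc zero)) e = ⊥-elim (x≢y e)
  g-inj (suc zero) (suc (suc (suc zero))) e = ⊥-elim (x≢z e)
  g-inj (suc (suc zero)) zero e = ⊥-elim (n (inj₂ (inj₁ (sym e))))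
  g-inj (suc (suc zero)) (suc zero) e = ⊥-elim (x≢y (sym e))
  g-inj (suc (suc zero)) (suc (suc zero)) _ = refl
  g-inj (suc (suc zero)) (suc (suc (suc zero))) e = ⊥-elim (y≢z e)
  g-inj (suc (suc (suc zero))) zero e = ⊥-elim (n (inj₂ (inj₂ (sym e))))
  g-inj (suc (suc (suc zero))) (suc zero) e = ⊥-elim (x≢z (sym e))
  g-inj (suc (suc (suc zero))) (suc (suc zero)) e = ⊥-elim (y≢z (sym e))
  g-inj (suc (suc (suc zero))) (suc (suc (suc zero))) _ = refl

isY-has3 : ∀ {G v x y z} → IsY G v x y z → Has 3 G v
isY-has3 {G} {v} {x} {y} {z} Y = g , (λ {i} {j} → inj i j) , adj′
  where
  open IsY Y
  g : Fin 3 → V G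
  g zero = x
  g (suc zero) = y
  g (suc (suc zero)) = z
  inj : ∀ i j → g i ≡ g j → i ≡ j
  inj zero zero _ = refl
  inj zero (suc zero) e = ⊥-elim (x≢y e)
  inj zero (suc (suc zero)) e = ⊥-elim (x≢z e)
  inj (suc zero) zero e = ⊥-elim (x≢y (sym e))
  inj (suc zero) (suc zero) _ = refl
  inj (suc zero) (suc (suc zero)) e = ⊥-elim (y≢z e)
  inj (suc (suc zero)) zero e = ⊥-elim (x≢z (sym e))
  inj (suc (suc zero)) (suc zero) e = ⊥-elim (y≢z (sym e))
  inj (suc (suc zero)) (suc (suc zero)) _ = refl
  adj′ : ∀ i → Adj G v (g i)
  adj′ zero = nbr← in₁
  adj′ (suc zero) = nbr← in₂
  adj′ (suc (suc zero)) = nbr← in₃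

has-suc : ∀ {k} G {v} u → ((g , _) : Has k G v) → Adj G v u → (∀ i → g i ≢ u) → Has (suc k) G v
has-suc {k} G {v} u (g , inj , a) e n = g′ , (λ {i} {j} → inj′ i j) , a′
  where
  g′ : Fin (suc k) → V G
  g′ zero = u
  g′ (suc i) = g i
  inj′ : ∀ i j → g′ i ≡ g′ j → i ≡ j
  inj′ zero zero _ = refl
  inj′ zero (suc j) p = ⊥-elim (n j (sym p))
  inj′ (suc i) zero p = ⊥-elim (n i p)
  inj′ (suc i) (suc j) p = cong suc (inj p)
  a′ : ∀ i → Adj G v (g′ i)
  a′ zero = e
  a′ (suc i) = a i

join-injective : ∀ a b {s t : Fin a ⊎ Fin b} → Fin.join a b s ≡ Fin.join a b t → s ≡ t
join-injective a b {s} {t} e = trans (sym (Finₚ.splitAt-join a b s)) (trans (cong (splitAt a) e) (Finₚ.splitAt-join a b t))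

private
  bool : Fin 2 → Bool
  bool zero = false
  bool (suc _) = true

  bool⁻ : Bool → Fin 2
  bool⁻ false = zero
  bool⁻ true = suc zero

  bool-bool⁻ : ∀ v → bool (bool⁻ v) ≡ v
  bool-bool⁻ false = refl
  bool-bool⁻ true = refl

part-left : ∀ a b (x : Fin a) → part a b (toℕ (x ↑ˡ b)) ≡ zero
part-left a b x rewrite Finₚ.toℕ-↑ˡ x b | true-<ᵇ (Finₚ.toℕ<n x) = refl

part-right : ∀ a b (y : Fin b) → part a b (toℕ (a ↑ʳ y)) ≡ suc zero
part-right a b y with toℕ (a ↑ʳ y) <ᵇ a in e | toℕ (a ↑ʳ y) <ᵇ (a + b) in e′
... | true | _ = ⊥-elim (ℕₚ.<⇒≱ (<ᵇ-true e) (subst (a ≤_) (sym (Finₚ.toℕ-↑ʳ a y)) (ℕₚ.m≤m+n a _)))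
... | false | true = refl
... | false | false with () ← trans (sym e′) (true-<ᵇ (Finₚ.toℕ<n (a ↑ʳ y)))

⊕-zero-separated : ∀ {G H} n → (Iso (G ⊕ n) (H ⊕ n) → BIso G H) → Iso (G ⊕ 0 ⊕ n) (H ⊕ 0 ⊕ n) → BIso (G ⊕ 0) (H ⊕ 0)
⊕-zero-separated n s φ = biso-trans (biso-sym ⊕-zero) (biso-trans (s (iso-trans (plain (⊕-biso ⊕-zero ↔-refl))
  (iso-trans φ (plain (⊕-biso (biso-sym ⊕-zero) ↔-refl))))) ⊕-zero)

⊕-zero-path : ∀ {G H K} → BIso G H → BPath G K → BPath (H ⊕ 0) (K ⊕ 0)
⊕-zero-path φ done = via done (biso-trans (biso-sym ⊕-zero) (biso-trans (biso-sym φ) ⊕-zero))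
⊕-zero-path φ (up p S) = up (⊕-zero-path φ p) (⊕-star 0 S)
⊕-zero-path φ (down p S) = down (⊕-zero-path φ p) (⊕-star 0 S)
⊕-zero-path φ (via p ψ) = via (⊕-zero-path φ p) (⊕-biso ψ ↔-refl)

⊕-resplit : ∀ {B G H} c n → BIso (B ⊕ c) G → BIso G H → BIso (B ⊕ (c + n)) (H ⊕ (0 + n))
⊕-resplit c n φ ψ = biso-trans (⊕-+ c n) (⊕-biso (biso-trans φ ψ) ↔-refl)

iso-size : ∀ {G H n k l} → V G ↔ Fin k → V H ↔ Fin l → Iso (G ⊕ n) (H ⊕ n) → k ≡ l
iso-size {n = n} {k} {l} e f φ = ℕₚ.+-cancelʳ-≡ n _ _ (Perm.↔⇒≡ (↔-trans (↔-sym (proj₂ (finite-⊎ (k , e) (n , ↔-refl))))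
  (↔-trans (mk↔ₛ′ (to φ) (from φ) (to-from φ) (from-to φ)) (proj₂ (finite-⊎ (l , f) (n , ↔-refl))))))

-- For normal forms that are determined by their number of vertices. The given isomorphism is used
-- only to compare sizes; the base-preserving one runs through the normal form.
size-separated : (C : ℕ → BGraph) (s : ℕ → ℕ) → (∀ {i j} → s i ≡ s j → i ≡ j) → ∀ {G H} n i j →
  V (C i) ↔ Fin (s i) → V (C j) ↔ Fin (s j) → BIso G (C i) → BIso H (C j) → Iso (G ⊕ n) (H ⊕ n) → BIso G H
size-separated C s inj n i j e f φ ψ θ with inj (iso-size e f
  (iso-trans (iso-sym (plain (⊕-biso φ ↔-refl))) (iso-trans θ (plain (⊕-biso ψ ↔-refl)))))
... | refl = biso-trans φ (biso-sym ψ)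

exchange : ∀ {n} → Fin n → Fin n → Fin n → Fin n
exchange i j k with k Fin.≟ i
... | yes _ = j
... | no _ with k Fin.≟ j
... | yes _ = i
... | no _ = k

exchange-left : ∀ {n} (i j : Fin n) → exchange i j i ≡ j
exchange-left i j with i Fin.≟ i
... | yes _ = refl
... | no n = ⊥-elim (n refl)

exchange-right : ∀ {n} (i j : Fin n) → exchange i j j ≡ i
exchange-right i j with j Fin.≟ i
... | yes e = e
... | no _ with j Fin.≟ j
... | yes _ = refl
... | no n = ⊥-elim (n refl)

exchange-other : ∀ {n} {i j k : Fin n} → k ≢ i → k ≢ j → exchange i j k ≡ k
exchange-other {i = i} {j} {k} p q with k Fin.≟ i
... | yes e = ⊥-elim (p e)
... | no _ with k Fin.≟ j
... | yes e = ⊥-elim (q e)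
... | no _ = refl

exchange-involutive : ∀ {n} (i j k : Fin n) → exchange i j (exchange i j k) ≡ k
exchange-involutive i j k with k Fin.≟ i
... | yes refl = exchange-right i j
... | no p with k Fin.≟ j
... | yes refl = exchange-left i j
... | no q = exchange-other p q

exchange-↔ : ∀ {n} → Fin n → Fin n → Fin n ↔ Fin n
exchange-↔ i j = mk↔ₛ′ (exchange i j) (exchange i j) (exchange-involutive i j) (exchange-involutive i j)

module Tripartite (a b c : ℕ) where

  -- T holds the triangles of K a b c that have been replaced by stars; they are edge-disjoint.
  -- If a = b = 3 and all edges at a vertex z of the third part lie in triangles of T, then z has
  -- degree three and may be removed by a Y∇ move; E z records that this has been done.
  record Valid (T : Fin a → Fin b → Fin c → Bool) (E : Fin c → Bool) : Set where
    field
      one-z : ∀ {x y z z′} → T x y z ≡ true → T x y z′ ≡ true → z ≡ z′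
      one-y : ∀ {x y y′ z} → T x y z ≡ true → T x y′ z ≡ true → y ≡ y′
      one-x : ∀ {x x′ y z} → T x y z ≡ true → T x′ y z ≡ true → x ≡ x′
      flag-a : ∀ {z} → E z ≡ true → a ≡ 3
      flag-b : ∀ {z} → E z ≡ true → b ≡ 3
      flag-x : ∀ {z} → E z ≡ true → ∀ x → ∃ λ y → T x y z ≡ true
      flag-y : ∀ {z} → E z ≡ true → ∀ y → ∃ λ x → T x y z ≡ true

  record Config : Set where
    constructor config
    field
      T : Fin a → Fin b → Fin c → Bool
      E : Fin c → Bool
      valid : Valid T E
    open Valid valid public

  open Config

  -- The graph of a configuration

  data Vertex (S : Config) : Set where
    pa : Fin a → Vertex S
    pb : Fin b → Vertex S
    pc : ∀ z → E S z ≡ false → Vertex S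
    pt : ∀ x y z → T S x y z ≡ true → Vertex S

  pc-≡ : ∀ {S z z′ p p′} → z ≡ z′ → pc {S} z p ≡ pc z′ p′
  pc-≡ {p = p} {p′} refl = cong (pc _) (uip p p′)

  pt-≡ : ∀ {S x x′ y y′ z z′ q q′} → x ≡ x′ → y ≡ y′ → z ≡ z′ → pt {S} x y z q ≡ pt x′ y′ z′ q′
  pt-≡ {q = q} {q′} refl refl refl = cong (pt _ _ _) (uip q q′)

  pc-injective : ∀ {S z z′ p p′} → pc {S} z p ≡ pc z′ p′ → z ≡ z′
  pc-injective refl = refl

  pt-injective : ∀ {S x x′ y y′ z z′ q q′} → pt {S} x y z q ≡ pt x′ y′ z′ q′ → x ≡ x′ × y ≡ y′ × z ≡ z′
  pt-injective refl = refl , refl , refl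

  vertex-finite : ∀ S → Finite (Vertex S)
  vertex-finite S with finite-⊎ (a , ↔-refl) (finite-⊎ (b , ↔-refl) (finite-⊎ (finite-fiber (c , ↔-refl) (E S) false)
                         (finite-fiber (a * (b * c) , ↔-trans (↔-refl ×-↔ ↔-sym Finₚ.*↔×) (↔-sym Finₚ.*↔×)) (λ { (x , y , z) → T S x y z }) true)))
  ... | n , e = n , ↔-trans (mk↔ₛ′
    (λ { (pa x) → inj₁ x ; (pb y) → inj₂ (inj₁ y) ; (pc z p) → inj₂ (inj₂ (inj₁ (z , p)))
       ; (pt x y z q) → inj₂ (inj₂ (inj₂ ((x , y , z) , q))) })
    (λ { (inj₁ x) → pa x ; (inj₂ (inj₁ y)) → pb y ; (inj₂ (inj₂ (inj₁ (z , p)))) → pc z p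
       ; (inj₂ (inj₂ (inj₂ ((x , y , z) , q)))) → pt x y z q })
    (λ { (inj₁ x) → refl ; (inj₂ (inj₁ y)) → refl ; (inj₂ (inj₂ (inj₁ (z , p)))) → refl
       ; (inj₂ (inj₂ (inj₂ ((x , y , z) , q)))) → refl })
    (λ { (pa x) → refl ; (pb y) → refl ; (pc z p) → refl ; (pt x y z q) → refl })) e

  -- An edge between two parts is present unless a triangle of `T` contains it. The vertices `pt`
  -- are the centres of the stars. Removing `z` leaves a triangle on the centres at `z`; by `one-y`
  -- these are told apart by their first coordinates.
  Edge : ∀ S → Vertex S → Vertex S → Set
  Edge S (pa x) (pb y) = ∀ z → T S x y z ≡ false
  Edge S (pb y) (pa x) = ∀ z → T S x y z ≡ false
  Edge S (pa x) (pc z _) = ∀ y → T S x y z ≡ false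
  Edge S (pc z _) (pa x) = ∀ y → T S x y z ≡ false
  Edge S (pb y) (pc z _) = ∀ x → T S x y z ≡ false
  Edge S (pc z _) (pb y) = ∀ x → T S x y z ≡ false
  Edge S (pa x) (pt x′ _ _ _) = x ≡ x′
  Edge S (pt x′ _ _ _) (pa x) = x ≡ x′
  Edge S (pb y) (pt _ y′ _ _) = y ≡ y′
  Edge S (pt _ y′ _ _) (pb y) = y ≡ y′
  Edge S (pc z _) (pt _ _ z′ _) = z ≡ z′
  Edge S (pt _ _ z′ _) (pc z _) = z ≡ z′
  Edge S (pt x _ z _) (pt x′ _ z′ _) = E S z ≡ true × z ≡ z′ × x ≢ x′
  Edge S (pa _) (pa _) = ⊥
  Edge S (pb _) (pb _) = ⊥
  Edge S (pc _ _) (pc _ _) = ⊥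

  edge? : ∀ S u v → Dec (Edge S u v)
  edge? S (pa x) (pb y) = Finₚ.all? λ z → T S x y z Bool.≟ false
  edge? S (pb y) (pa x) = Finₚ.all? λ z → T S x y z Bool.≟ false
  edge? S (pa x) (pc z _) = Finₚ.all? λ y → T S x y z Bool.≟ false
  edge? S (pc z _) (pa x) = Finₚ.all? λ y → T S x y z Bool.≟ false
  edge? S (pb y) (pc z _) = Finₚ.all? λ x → T S x y z Bool.≟ false
  edge? S (pc z _) (pb y) = Finₚ.all? λ x → T S x y z Bool.≟ false
  edge? S (pa x) (pt x′ _ _ _) = x Fin.≟ x′
  edge? S (pt x′ _ _ _) (pa x) = x Fin.≟ x′
  edge? S (pb y) (pt _ y′ _ _) = y Fin.≟ y′
  edge? S (pt _ y′ _ _) (pb y) = y Fin.≟ y′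
  edge? S (pc z _) (pt _ _ z′ _) = z Fin.≟ z′
  edge? S (pt _ _ z′ _) (pc z _) = z Fin.≟ z′
  edge? S (pt x _ z _) (pt x′ _ z′ _) = (E S z Bool.≟ true) ×-dec (z Fin.≟ z′) ×-dec ¬? (x Fin.≟ x′)
  edge? S (pa _) (pa _) = no id
  edge? S (pb _) (pb _) = no id
  edge? S (pc _ _) (pc _ _) = no id

  edge-sym : ∀ S u v → Edge S u v → Edge S v u
  edge-sym S (pa x) (pb y) p = p
  edge-sym S (pb y) (pa x) p = p
  edge-sym S (pa x) (pc z _) p = p
  edge-sym S (pc z _) (pa x) p = p
  edge-sym S (pb y) (pc z _) p = p
  edge-sym S (pc z _) (pb y) p = p
  edge-sym S (pa x) (pt x′ _ _ _) p = p
  edge-sym S (pt x′ _ _ _) (pa x) p = p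
  edge-sym S (pb y) (pt _ y′ _ _) p = p
  edge-sym S (pt _ y′ _ _) (pb y) p = p
  edge-sym S (pc z _) (pt _ _ z′ _) p = p
  edge-sym S (pt _ _ z′ _) (pc z _) p = p
  edge-sym S (pt x _ z _) (pt x′ _ z′ _) (e , refl , n) = e , refl , n ∘ sym

  edge-irr : ∀ S v → ¬ Edge S v v
  edge-irr S (pt x y z q) (_ , _ , n) = n refl

  Part : ∀ S → Vertex S → Set
  Part S (pa _) = ⊤
  Part S (pb _) = ⊤
  Part S (pc _ _) = ⊥
  Part S (pt _ _ _ _) = ⊥

  ⟦_⟧ : Config → BGraph
  ⟦ S ⟧ = record
    { V = Vertex S ; card = proj₁ (vertex-finite S) ; enum = proj₂ (vertex-finite S)
    ; Adj = Edge S ; adj? = edge? S ; symm = λ {u} {v} → edge-sym S u v ; irr = λ {v} → edge-irr S v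
    ; Base = Part S
    ; base? = λ { (pa _) → yes tt ; (pb _) → yes tt ; (pc _ _) → no id ; (pt _ _ _ _) → no id } }

  module Relabel (S S′ : Config) (α : Fin b ↔ Fin b) (β : Fin c ↔ Fin c)
    (eT : ∀ x y z → T S x y z ≡ T S′ x (Inverse.to α y) (Inverse.to β z))
    (eE : ∀ z → E S z ≡ E S′ (Inverse.to β z)) where
    private
      α⁺ = Inverse.to α
      β⁺ = Inverse.to β

    map : Vertex S → Vertex S′
    map (pa x) = pa x
    map (pb y) = pb (α⁺ y)
    map (pc z p) = pc (β⁺ z) (trans (sym (eE z)) p)
    map (pt x y z q) = pt x (α⁺ y) (β⁺ z) (trans (sym (eT x y z)) q)

    private
      at-α : ∀ {P : Fin b → Set} → (∀ y → P (α⁺ y)) → ∀ y → P y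
      at-α {P} h y = subst P (Inverse.strictlyInverseˡ α y) (h _)
      at-β : ∀ {P : Fin c → Set} → (∀ y → P (β⁺ y)) → ∀ y → P y
      at-β {P} h y = subst P (Inverse.strictlyInverseˡ β y) (h _)

    map-pres : ∀ u v → Edge S u v → Edge S′ (map u) (map v)
    map-pres (pa x) (pb y) p = at-β (λ z → trans (sym (eT x y z)) (p z))
    map-pres (pb y) (pa x) p = at-β (λ z → trans (sym (eT x y z)) (p z))
    map-pres (pa x) (pc z _) p = at-α (λ y → trans (sym (eT x y z)) (p y))
    map-pres (pc z _) (pa x) p = at-α (λ y → trans (sym (eT x y z)) (p y))
    map-pres (pb y) (pc z _) p x = trans (sym (eT x y z)) (p x)
    map-pres (pc z _) (pb y) p x = trans (sym (eT x y z)) (p x)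
    map-pres (pa x) (pt x′ _ _ _) p = p
    map-pres (pt x′ _ _ _) (pa x) p = p
    map-pres (pb y) (pt _ y′ _ _) p = cong α⁺ p
    map-pres (pt _ y′ _ _) (pb y) p = cong α⁺ p
    map-pres (pc z _) (pt _ _ z′ _) p = cong β⁺ p
    map-pres (pt _ _ z′ _) (pc z _) p = cong β⁺ p
    map-pres (pt x _ z _) (pt x′ _ z′ _) (e , q , n) = trans (sym (eE z)) e , cong β⁺ q , n

    map-base : ∀ u → Part S u → Part S′ (map u)
    map-base (pa _) p = tt
    map-base (pb _) p = tt

  relabel : ∀ S S′ (α : Fin b ↔ Fin b) (β : Fin c ↔ Fin c) →
    (∀ x y z → T S x y z ≡ T S′ x (Inverse.to α y) (Inverse.to β z)) →
    (∀ z → E S z ≡ E S′ (Inverse.to β z)) → BIso ⟦ S ⟧ ⟦ S′ ⟧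
  relabel S S′ α β eT eE = record
    { plain = record
      { to = F.map ; from = B.map ; to-from = tf ; from-to = ft
      ; pres = λ {u} {v} → F.map-pres u v
      ; reflects = λ {u} {v} p → subst₂ (Edge S) (ft u) (ft v) (B.map-pres (F.map u) (F.map v) p) }
    ; base→ = λ {u} → F.map-base u
    ; base← = λ {u} p → subst (Part S) (ft u) (B.map-base (F.map u) p) }
    where
    module F = Relabel S S′ α β eT eE
    module B = Relabel S′ S (↔-sym α) (↔-sym β)
      (λ x y z → sym (trans (eT x _ _) (cong₂ (T S′ x) (Inverse.strictlyInverseˡ α y) (Inverse.strictlyInverseˡ β z))))
      (λ z → sym (trans (eE _) (cong (E S′) (Inverse.strictlyInverseˡ β z))))
    tf : ∀ v → F.map (B.map v) ≡ v
    tf (pa x) = refl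
    tf (pb y) = cong pb (Inverse.strictlyInverseˡ α y)
    tf (pc z _) = pc-≡ (Inverse.strictlyInverseˡ β z)
    tf (pt x y z _) = pt-≡ refl (Inverse.strictlyInverseˡ α y) (Inverse.strictlyInverseˡ β z)
    ft : ∀ v → B.map (F.map v) ≡ v
    ft (pa x) = refl
    ft (pb y) = cong pb (Inverse.strictlyInverseʳ α y)
    ft (pc z _) = pc-≡ (Inverse.strictlyInverseʳ β z)
    ft (pt x y z _) = pt-≡ refl (Inverse.strictlyInverseʳ α y) (Inverse.strictlyInverseʳ β z)

  same-config : ∀ S S′ → (∀ x y z → T S x y z ≡ T S′ x y z) → (∀ z → E S z ≡ E S′ z) → BIso ⟦ S ⟧ ⟦ S′ ⟧
  same-config S S′ = relabel S S′ ↔-refl ↔-refl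

  -- Moves between configurations

  -- A relation, so that one proof of the move covers a triangle added to `S`, one taken away from
  -- `S′`, and the successive truncations of a configuration used for reachability.
  record Adds (S S′ : Config) (x : Fin a) (y : Fin b) (z : Fin c) : Set where
    field
      fresh : T S x y z ≡ false
      added : T S′ x y z ≡ true
      keep  : ∀ {x′ y′ z′} → T S x′ y′ z′ ≡ true → T S′ x′ y′ z′ ≡ true
      split : ∀ {x′ y′ z′} → T S′ x′ y′ z′ ≡ true → T S x′ y′ z′ ≡ true ⊎ (x′ ≡ x × y′ ≡ y × z′ ≡ z)
      unflagged : E S z ≡ false
      flags : ∀ z′ → E S′ z′ ≡ E S z′

  adds-star : ∀ {S S′ x y z} → Adds S S′ x y z → ∀ p q → BStar ⟦ S ⟧ ⟦ S′ ⟧ (pa x) (pb y) (pc z p) (pt x y z q)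
  adds-star {S} {S′} {x} {y} {z} A p q = record
    { star = record
      -- The three edges are still present: a triangle of `T S` containing one of them would share
      -- it with the new triangle inside `S′`, hence equal the new one.
      { tri = (λ z′ → ¬true⇒false λ t → t≢f (subst (λ k → T S x y k ≡ true) (one-z S′ (keep t) added) t) fresh)
            , (λ x′ → ¬true⇒false λ t → t≢f (subst (λ k → T S k y z ≡ true) (one-x S′ (keep t) added) t) fresh)
            , (λ y′ → ¬true⇒false λ t → t≢f (subst (λ k → T S x k z ≡ true) (one-y S′ (keep t) added) t) fresh)
      ; old = o ; old-inj = λ {u} {v} → o-inj u v ; old≢hub = λ {u} → o≢ u ; cover = cov
      ; hub→ = λ {u} → h→ u ; hub← = λ {u} → h← u
      ; old→ = λ {u} {v} → o→ u v ; old← = λ {u} {v} → o← u v }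
    ; old-base→ = λ { {pa _} _ → tt ; {pb _} _ → tt }
    ; old-base← = λ { {pa _} _ → tt ; {pb _} _ → tt }
    ; hub-base = id }
    where
    open Adds A
    Corner : Vertex S → Set
    Corner = In (pa x) (pb y) (pc z p)
    o : Vertex S → Vertex S′
    o (pa x′) = pa x′
    o (pb y′) = pb y′
    o (pc z′ p′) = pc z′ (trans (flags z′) p′)
    o (pt x′ y′ z′ q′) = pt x′ y′ z′ (keep q′)
    o-inj : ∀ u v → o u ≡ o v → u ≡ v
    o-inj (pa _) (pa _) refl = refl
    o-inj (pb _) (pb _) refl = refl
    o-inj (pc _ _) (pc _ _) e = pc-≡ (pc-injective e)
    o-inj (pt _ _ _ _) (pt _ _ _ _) e = let (e₁ , e₂ , e₃) = pt-injective e in pt-≡ e₁ e₂ e₃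
    o≢ : ∀ u → o u ≢ pt x y z q
    o≢ (pt _ _ _ t) e with pt-injective e
    ... | refl , refl , refl = t≢f t fresh
    cov : ∀ v → v ≡ pt x y z q ⊎ ∃ λ u → o u ≡ v
    cov (pa x′) = inj₂ (pa x′ , refl)
    cov (pb y′) = inj₂ (pb y′ , refl)
    cov (pc z′ p′) = inj₂ (pc z′ (trans (sym (flags z′)) p′) , pc-≡ refl)
    cov (pt x′ y′ z′ q′) with split q′
    ... | inj₁ t = inj₂ (pt x′ y′ z′ t , pt-≡ refl refl refl)
    ... | inj₂ (e₁ , e₂ , e₃) = inj₁ (pt-≡ e₁ e₂ e₃)
    h→ : ∀ u → Edge S′ (pt x y z q) (o u) → Corner u
    h→ (pa _) e = inj₁ (cong pa e)
    h→ (pb _) e = inj₂ (inj₁ (cong pb e))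
    h→ (pc _ _) e = inj₂ (inj₂ (pc-≡ e))
    h→ (pt _ _ _ _) (e , _) = ⊥-elim (t≢f e (trans (flags z) unflagged))
    h← : ∀ u → Corner u → Edge S′ (pt x y z q) (o u)
    h← _ (inj₁ refl) = refl
    h← _ (inj₂ (inj₁ refl)) = refl
    h← _ (inj₂ (inj₂ refl)) = refl
    cx : ∀ {x′} → Corner (pa x′) → x′ ≡ x
    cx (inj₁ refl) = refl
    cx (inj₂ (inj₁ ()))
    cx (inj₂ (inj₂ ()))
    cy : ∀ {y′} → Corner (pb y′) → y′ ≡ y
    cy (inj₂ (inj₁ refl)) = refl
    cy (inj₂ (inj₂ ()))
    cz : ∀ {z′ p′} → Corner (pc z′ p′) → z′ ≡ z
    cz (inj₂ (inj₂ refl)) = refl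
    cz (inj₂ (inj₁ ()))
    ct : ∀ {x′ y′ z′ q′} → ¬ Corner (pt x′ y′ z′ q′)
    ct (inj₁ ())
    ct (inj₂ (inj₁ ()))
    ct (inj₂ (inj₂ ()))
    smaller : ∀ {x′ y′ z′} → T S′ x′ y′ z′ ≡ false → T S x′ y′ z′ ≡ false
    smaller n = ¬true⇒false λ t → t≢f (keep t) n
    larger : ∀ {x′ y′ z′} → T S x′ y′ z′ ≡ false → ¬ (x′ ≡ x × y′ ≡ y × z′ ≡ z) → T S′ x′ y′ z′ ≡ false
    larger f n = ¬true⇒false λ t → [ (λ s → t≢f s f) , n ]′ (split t)
    ab : ∀ {x′ y′} → (∀ z′ → T S′ x′ y′ z′ ≡ false) → ¬ (x′ ≡ x × y′ ≡ y)
    ab e (refl , refl) = t≢f added (e z)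
    ac : ∀ {x′ z′} → (∀ y′ → T S′ x′ y′ z′ ≡ false) → ¬ (x′ ≡ x × z′ ≡ z)
    ac e (refl , refl) = t≢f added (e y)
    bc : ∀ {y′ z′} → (∀ x′ → T S′ x′ y′ z′ ≡ false) → ¬ (y′ ≡ y × z′ ≡ z)
    bc e (refl , refl) = t≢f added (e x)
    o→ : ∀ u v → Edge S′ (o u) (o v) → Edge S u v × ¬ (Corner u × Corner v)
    o→ (pa _) (pb _) e = smaller ∘ e , λ { (i , j) → ab e (cx i , cy j) }
    o→ (pb _) (pa _) e = smaller ∘ e , λ { (i , j) → ab e (cx j , cy i) }
    o→ (pa _) (pc _ _) e = smaller ∘ e , λ { (i , j) → ac e (cx i , cz j) }
    o→ (pc _ _) (pa _) e = smaller ∘ e , λ { (i , j) → ac e (cx j , cz i) }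
    o→ (pb _) (pc _ _) e = smaller ∘ e , λ { (i , j) → bc e (cy i , cz j) }
    o→ (pc _ _) (pb _) e = smaller ∘ e , λ { (i , j) → bc e (cy j , cz i) }
    o→ (pa _) (pt _ _ _ _) e = e , ct ∘ proj₂
    o→ (pb _) (pt _ _ _ _) e = e , ct ∘ proj₂
    o→ (pc _ _) (pt _ _ _ _) e = e , ct ∘ proj₂
    o→ (pt _ _ _ _) (pa _) e = e , ct ∘ proj₁
    o→ (pt _ _ _ _) (pb _) e = e , ct ∘ proj₁
    o→ (pt _ _ _ _) (pc _ _) e = e , ct ∘ proj₁
    o→ (pt _ _ z′ _) (pt _ _ _ _) (e , r) = (trans (sym (flags z′)) e , r) , ct ∘ proj₁
    o← : ∀ u v → Edge S u v → ¬ (Corner u × Corner v) → Edge S′ (o u) (o v)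
    o← (pa _) (pb _) e n z′ = larger (e z′) λ { (refl , refl , _) → n (in₁ , in₂) }
    o← (pb _) (pa _) e n z′ = larger (e z′) λ { (refl , refl , _) → n (in₂ , in₁) }
    o← (pa _) (pc _ _) e n y′ = larger (e y′) λ { (refl , _ , refl) → n (in₁ , inj₂ (inj₂ (pc-≡ refl))) }
    o← (pc _ _) (pa _) e n y′ = larger (e y′) λ { (refl , _ , refl) → n (inj₂ (inj₂ (pc-≡ refl)) , in₁) }
    o← (pb _) (pc _ _) e n x′ = larger (e x′) λ { (_ , refl , refl) → n (in₂ , inj₂ (inj₂ (pc-≡ refl))) }
    o← (pc _ _) (pb _) e n x′ = larger (e x′) λ { (_ , refl , refl) → n (inj₂ (inj₂ (pc-≡ refl)) , in₂) }
    o← (pa _) (pt _ _ _ _) e n = e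
    o← (pb _) (pt _ _ _ _) e n = e
    o← (pc _ _) (pt _ _ _ _) e n = e
    o← (pt _ _ _ _) (pa _) e n = e
    o← (pt _ _ _ _) (pb _) e n = e
    o← (pt _ _ _ _) (pc _ _) e n = e
    o← (pt _ _ z′ _) (pt _ _ _ _) (e , r) n = trans (flags z′) e , r

  -- Directed from the flagged to the unflagged configuration, because that is the ∇Y move: applied
  -- to the three centres at `z`, it restores `z`.
  record Unflags (S S′ : Config) (z : Fin c) : Set where
    field
      flagged   : E S z ≡ true
      unflagged : E S′ z ≡ false
      others    : ∀ {z′} → z′ ≢ z → E S′ z′ ≡ E S z′
      triples   : ∀ x y z′ → T S′ x y z′ ≡ T S x y z′

  module _ {S : Config} {z : Fin c} {x₁ x₂ x₃ : Fin a} {y₁ y₂ y₃ : Fin b} where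

    unflags-star : ∀ {S′} → Unflags S S′ z → x₁ ≢ x₂ → x₂ ≢ x₃ → x₁ ≢ x₃ → (∀ x → In x₁ x₂ x₃ x) →
      ∀ q₁ q₂ q₃ p → BStar ⟦ S ⟧ ⟦ S′ ⟧ (pt x₁ y₁ z q₁) (pt x₂ y₂ z q₂) (pt x₃ y₃ z q₃) (pc z p)
    unflags-star {S′} U n₁₂ n₂₃ n₁₃ every q₁ q₂ q₃ p = record
      { star = record
        { tri = (flagged , refl , n₁₂) , (flagged , refl , n₂₃) , (flagged , refl , n₁₃)
        ; old = o ; old-inj = λ {u} {v} → o-inj u v ; old≢hub = λ {u} → o≢ u ; cover = cov
        ; hub→ = λ {u} → h→ u ; hub← = λ {u} → h← u
        ; old→ = λ {u} {v} → o→ u v ; old← = λ {u} {v} → o← u v }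
      ; old-base→ = λ { {pa _} _ → tt ; {pb _} _ → tt }
      ; old-base← = λ { {pa _} _ → tt ; {pb _} _ → tt }
      ; hub-base = id }
      where
      open Unflags U
      Corner : Vertex S → Set
      Corner = In (pt x₁ y₁ z q₁) (pt x₂ y₂ z q₂) (pt x₃ y₃ z q₃)
      ≢z : ∀ {z′} → E S z′ ≡ false → z′ ≢ z
      ≢z f refl = t≢f flagged f
      o : Vertex S → Vertex S′
      o (pa x′) = pa x′
      o (pb y′) = pb y′
      o (pc z′ p′) = pc z′ (trans (others (≢z p′)) p′)
      o (pt x′ y′ z′ q′) = pt x′ y′ z′ (trans (triples x′ y′ z′) q′)
      o-inj : ∀ u v → o u ≡ o v → u ≡ v
      o-inj (pa _) (pa _) refl = refl
      o-inj (pb _) (pb _) refl = refl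
      o-inj (pc _ _) (pc _ _) e = pc-≡ (pc-injective e)
      o-inj (pt _ _ _ _) (pt _ _ _ _) e = let (e₁ , e₂ , e₃) = pt-injective e in pt-≡ e₁ e₂ e₃
      o≢ : ∀ u → o u ≢ pc z p
      o≢ (pc _ p′) e = ≢z p′ (pc-injective e)
      cov : ∀ v → v ≡ pc z p ⊎ ∃ λ u → o u ≡ v
      cov (pa x′) = inj₂ (pa x′ , refl)
      cov (pb y′) = inj₂ (pb y′ , refl)
      cov (pt x′ y′ z′ q′) = inj₂ (pt x′ y′ z′ (trans (sym (triples x′ y′ z′)) q′) , pt-≡ refl refl refl)
      cov (pc z′ p′) with z′ Fin.≟ z
      ... | yes e = inj₁ (pc-≡ e)
      ... | no n = inj₂ (pc z′ (trans (sym (others n)) p′) , pc-≡ refl)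
      corner : ∀ {x′ y′ z′} q′ → z′ ≡ z → Corner (pt x′ y′ z′ q′)
      corner {x′} q′ refl with every x′
      ... | inj₁ refl = inj₁ (pt-≡ refl (one-y S q′ q₁) refl)
      ... | inj₂ (inj₁ refl) = inj₂ (inj₁ (pt-≡ refl (one-y S q′ q₂) refl))
      ... | inj₂ (inj₂ refl) = inj₂ (inj₂ (pt-≡ refl (one-y S q′ q₃) refl))
      h→ : ∀ u → Edge S′ (pc z p) (o u) → Corner u
      -- All edges from a flagged `z` to the base lie in triangles of `T`, so the restored vertex
      -- has no neighbour in the base.
      h→ (pa x′) e = let (y′ , t) = flag-x S flagged x′ in ⊥-elim (t≢f (trans (triples _ _ _) t) (e y′))
      h→ (pb y′) e = let (x′ , t) = flag-y S flagged y′ in ⊥-elim (t≢f (trans (triples _ _ _) t) (e x′))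
      h→ (pt _ _ _ q′) e = corner q′ (sym e)
      h← : ∀ u → Corner u → Edge S′ (pc z p) (o u)
      h← _ (inj₁ refl) = refl
      h← _ (inj₂ (inj₁ refl)) = refl
      h← _ (inj₂ (inj₂ refl)) = refl
      is-z : ∀ {x′ y′ z′ q′} → Corner (pt x′ y′ z′ q′) → z′ ≡ z
      is-z (inj₁ refl) = refl
      is-z (inj₂ (inj₁ refl)) = refl
      is-z (inj₂ (inj₂ refl)) = refl
      na : ∀ {x′} → ¬ Corner (pa x′)
      na (inj₁ ())
      na (inj₂ (inj₁ ()))
      na (inj₂ (inj₂ ()))
      nb : ∀ {y′} → ¬ Corner (pb y′)
      nb (inj₁ ())
      nb (inj₂ (inj₁ ()))
      nb (inj₂ (inj₂ ()))
      nc : ∀ {z′ p′} → ¬ Corner (pc z′ p′)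
      nc (inj₁ ())
      nc (inj₂ (inj₁ ()))
      nc (inj₂ (inj₂ ()))
      o→ : ∀ u v → Edge S′ (o u) (o v) → Edge S u v × ¬ (Corner u × Corner v)
      o→ (pa _) (pb _) e = (λ k → trans (sym (triples _ _ _)) (e k)) , na ∘ proj₁
      o→ (pb _) (pa _) e = (λ k → trans (sym (triples _ _ _)) (e k)) , nb ∘ proj₁
      o→ (pa _) (pc _ _) e = (λ k → trans (sym (triples _ _ _)) (e k)) , na ∘ proj₁
      o→ (pc _ _) (pa _) e = (λ k → trans (sym (triples _ _ _)) (e k)) , nc ∘ proj₁
      o→ (pb _) (pc _ _) e = (λ k → trans (sym (triples _ _ _)) (e k)) , nb ∘ proj₁
      o→ (pc _ _) (pb _) e = (λ k → trans (sym (triples _ _ _)) (e k)) , nc ∘ proj₁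
      o→ (pa _) (pt _ _ _ _) e = e , na ∘ proj₁
      o→ (pb _) (pt _ _ _ _) e = e , nb ∘ proj₁
      o→ (pc _ _) (pt _ _ _ _) e = e , nc ∘ proj₁
      o→ (pt _ _ _ _) (pa _) e = e , na ∘ proj₂
      o→ (pt _ _ _ _) (pb _) e = e , nb ∘ proj₂
      o→ (pt _ _ _ _) (pc _ _) e = e , nc ∘ proj₂
      o→ (pt _ _ z′ _) (pt _ _ _ _) (e , r) = (trans (sym (others z′≢z)) e , r) , z′≢z ∘ is-z ∘ proj₁
        where
        z′≢z : z′ ≢ z
        z′≢z refl = t≢f e unflagged
      o← : ∀ u v → Edge S u v → ¬ (Corner u × Corner v) → Edge S′ (o u) (o v)
      o← (pa _) (pb _) e n k = trans (triples _ _ _) (e k)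
      o← (pb _) (pa _) e n k = trans (triples _ _ _) (e k)
      o← (pa _) (pc _ _) e n k = trans (triples _ _ _) (e k)
      o← (pc _ _) (pa _) e n k = trans (triples _ _ _) (e k)
      o← (pb _) (pc _ _) e n k = trans (triples _ _ _) (e k)
      o← (pc _ _) (pb _) e n k = trans (triples _ _ _) (e k)
      o← (pa _) (pt _ _ _ _) e n = e
      o← (pb _) (pt _ _ _ _) e n = e
      o← (pc _ _) (pt _ _ _ _) e n = e
      o← (pt _ _ _ _) (pa _) e n = e
      o← (pt _ _ _ _) (pb _) e n = e
      o← (pt _ _ _ _) (pc _ _) e n = e
      o← (pt _ _ z′ q′) (pt _ _ _ q″) (e , refl , d) n =
        trans (others (λ z′≡z → n (corner q′ z′≡z , corner q″ z′≡z))) e , refl , d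

  eq³ : Fin a → Fin b → Fin c → Fin a → Fin b → Fin c → Bool
  eq³ x y z x′ y′ z′ = (x′ == x) ∧ (y′ == y) ∧ (z′ == z)

  eq³-true : ∀ {x y z x′ y′ z′} → eq³ x y z x′ y′ z′ ≡ true → x′ ≡ x × y′ ≡ y × z′ ≡ z
  eq³-true {x} {y} {z} {x′} {y′} e with ∧-true {x′ == x} e
  ... | e₁ , e′ with ∧-true {y′ == y} e′
  ... | e₂ , e₃ = ==-true e₁ , ==-true e₂ , ==-true e₃

  true-eq³ : ∀ x y z → eq³ x y z x y z ≡ true
  true-eq³ x y z = true-∧ (true-== {i = x} refl) (true-∧ (true-== {i = y} refl) (true-== {i = z} refl))

  add : ∀ S {x y z} → E S z ≡ false → (∀ z′ → T S x y z′ ≡ false) → (∀ x′ → T S x′ y z ≡ false) → (∀ y′ → T S x y′ z ≡ false) →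
    ∃ λ S′ → Adds S S′ x y z
  add S {x} {y} {z} un xy yz xz = config T′ (E S) record
      { one-z = λ {x′} {y′} {z₁} {z₂} p q → oz (split′ p) (split′ q)
      ; one-y = λ p q → oy (split′ p) (split′ q)
      ; one-x = λ p q → ox (split′ p) (split′ q)
      ; flag-a = flag-a S ; flag-b = flag-b S
      ; flag-x = λ e x′ → let (y′ , t) = flag-x S e x′ in y′ , true-∨ˡ t
      ; flag-y = λ e y′ → let (x′ , t) = flag-y S e y′ in x′ , true-∨ˡ t } ,
    record { fresh = xy z ; added = true-∨ʳ {T S x y z} (true-eq³ x y z) ; keep = true-∨ˡ ; split = split′
           ; unflagged = un ; flags = λ _ → refl }
    where
    T′ : Fin a → Fin b → Fin c → Bool
    T′ x′ y′ z′ = T S x′ y′ z′ ∨ eq³ x y z x′ y′ z′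
    split′ : ∀ {x′ y′ z′} → T′ x′ y′ z′ ≡ true → T S x′ y′ z′ ≡ true ⊎ (x′ ≡ x × y′ ≡ y × z′ ≡ z)
    split′ {x′} {y′} {z′} p = Sum.map id eq³-true (∨-true {T S x′ y′ z′} p)
    This : Fin a → Fin b → Fin c → Set
    This x′ y′ z′ = T S x′ y′ z′ ≡ true ⊎ (x′ ≡ x × y′ ≡ y × z′ ≡ z)
    oz : ∀ {x′ y′ z₁ z₂} → This x′ y′ z₁ → This x′ y′ z₂ → z₁ ≡ z₂
    oz (inj₁ p) (inj₁ q) = one-z S p q
    oz (inj₁ p) (inj₂ (refl , refl , refl)) = ⊥-elim (t≢f p (xy _))
    oz (inj₂ (refl , refl , refl)) (inj₁ q) = ⊥-elim (t≢f q (xy _))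
    oz (inj₂ (_ , _ , e)) (inj₂ (_ , _ , e′)) = trans e (sym e′)
    oy : ∀ {x′ y₁ y₂ z′} → This x′ y₁ z′ → This x′ y₂ z′ → y₁ ≡ y₂
    oy (inj₁ p) (inj₁ q) = one-y S p q
    oy (inj₁ p) (inj₂ (refl , refl , refl)) = ⊥-elim (t≢f p (xz _))
    oy (inj₂ (refl , refl , refl)) (inj₁ q) = ⊥-elim (t≢f q (xz _))
    oy (inj₂ (_ , e , _)) (inj₂ (_ , e′ , _)) = trans e (sym e′)
    ox : ∀ {x₁ x₂ y′ z′} → This x₁ y′ z′ → This x₂ y′ z′ → x₁ ≡ x₂
    ox (inj₁ p) (inj₁ q) = one-x S p q
    ox (inj₁ p) (inj₂ (refl , refl , refl)) = ⊥-elim (t≢f p (yz _))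
    ox (inj₂ (refl , refl , refl)) (inj₁ q) = ⊥-elim (t≢f q (yz _))
    ox (inj₂ (e , _ , _)) (inj₂ (e′ , _ , _)) = trans e (sym e′)

  remove : ∀ S {x y z} → T S x y z ≡ true → E S z ≡ false → ∃ λ S′ → Adds S′ S x y z
  remove S {x} {y} {z} t un = config T′ (E S) record
      { one-z = λ p q → one-z S (sub p) (sub q) ; one-y = λ p q → one-y S (sub p) (sub q) ; one-x = λ p q → one-x S (sub p) (sub q)
      ; flag-a = flag-a S ; flag-b = flag-b S
      ; flag-x = λ e x′ → let (y′ , t′) = flag-x S e x′ in y′ , stays e t′
      ; flag-y = λ e y′ → let (x′ , t′) = flag-y S e y′ in x′ , stays e t′ } ,
    record { fresh = ¬true⇒false λ p → not-true (proj₂ (∧-true {T S x y z} p)) (true-eq³ x y z)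
           ; added = t ; keep = sub
           ; split = λ {x′} {y′} {z′} p → split′ p
           ; unflagged = un ; flags = λ _ → refl }
    where
    T′ : Fin a → Fin b → Fin c → Bool
    T′ x′ y′ z′ = T S x′ y′ z′ ∧ not (eq³ x y z x′ y′ z′)
    sub : ∀ {x′ y′ z′} → T′ x′ y′ z′ ≡ true → T S x′ y′ z′ ≡ true
    sub p = proj₁ (∧-true p)
    split′ : ∀ {x′ y′ z′} → T S x′ y′ z′ ≡ true → T′ x′ y′ z′ ≡ true ⊎ (x′ ≡ x × y′ ≡ y × z′ ≡ z)
    split′ {x′} {y′} {z′} p with eq³ x y z x′ y′ z′ in e
    ... | true = inj₂ (eq³-true e)
    ... | false = inj₁ (true-∧ p refl)
    stays : ∀ {x′ y′ z′} → E S z′ ≡ true → T S x′ y′ z′ ≡ true → T′ x′ y′ z′ ≡ true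
    stays e p with split′ p
    ... | inj₁ q = q
    ... | inj₂ (_ , _ , refl) = ⊥-elim (t≢f e un)

  unflag : ∀ S {z} → E S z ≡ true → ∃ λ S′ → Unflags S S′ z
  unflag S {z} e = config (T S) E′ record
      { one-z = one-z S ; one-y = one-y S ; one-x = one-x S
      ; flag-a = flag-a S ∘ sub ; flag-b = flag-b S ∘ sub ; flag-x = flag-x S ∘ sub ; flag-y = flag-y S ∘ sub } ,
    record { flagged = e ; unflagged = ¬true⇒false λ p → not-true (proj₂ (∧-true {E S z} p)) (true-== {i = z} refl)
           ; others = λ n → ≡true-ext sub (λ p → true-∧ p (true-not (n ∘ ==-true)))
           ; triples = λ _ _ _ → refl }
    where
    E′ : Fin c → Bool
    E′ z′ = E S z′ ∧ not (z′ == z)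
    sub : ∀ {z′} → E′ z′ ≡ true → E S z′ ≡ true
    sub p = proj₁ (∧-true p)

  flag : ∀ S {z} → E S z ≡ false → a ≡ 3 → b ≡ 3 → (∀ x → ∃ λ y → T S x y z ≡ true) → (∀ y → ∃ λ x → T S x y z ≡ true) →
    ∃ λ S′ → Unflags S′ S z
  flag S {z} un a3 b3 fx fy = config (T S) E′ record
      { one-z = one-z S ; one-y = one-y S ; one-x = one-x S
      ; flag-a = λ _ → a3 ; flag-b = λ _ → b3
      ; flag-x = λ e → [ flag-x S , (λ { refl → fx }) ]′ (split′ e)
      ; flag-y = λ e → [ flag-y S , (λ { refl → fy }) ]′ (split′ e) } ,
    record { flagged = true-∨ʳ {E S z} (true-== {i = z} refl) ; unflagged = un
           ; others = λ n → ≡true-ext true-∨ˡ (λ p → [ id , ⊥-elim ∘ n ]′ (split′ p))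
           ; triples = λ _ _ _ → refl }
    where
    E′ : Fin c → Bool
    E′ z′ = E S z′ ∨ (z′ == z)
    split′ : ∀ {z′} → E′ z′ ≡ true → E S z′ ≡ true ⊎ z′ ≡ z
    split′ {z′} p = Sum.map id ==-true (∨-true {E S z′} p)

  data Triple (S : Config) : Vertex S → Set where
    triple : ∀ {x y z q} → Triple S (pt x y z q)

  -- The corners of a star have lost the edges between them, a second centre at the same `z` shares
  -- no corner in the base, and `z` itself is absent when centres are adjacent.
  triple-nbrs : ∀ S {x y z q} u v → Edge S (pt x y z q) u → Edge S (pt x y z q) v → Edge S u v → Triple S u × Triple S v
  triple-nbrs S {q = q} (pa _) (pb _) refl refl e = ⊥-elim (t≢f q (e _))
  triple-nbrs S {q = q} (pa _) (pc _ _) refl refl e = ⊥-elim (t≢f q (e _))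
  triple-nbrs S (pa _) (pt _ _ _ _) refl (_ , _ , n) e = ⊥-elim (n e)
  triple-nbrs S {q = q} (pb _) (pa _) refl refl e = ⊥-elim (t≢f q (e _))
  triple-nbrs S {q = q} (pb _) (pc _ _) refl refl e = ⊥-elim (t≢f q (e _))
  triple-nbrs S {q = q} (pb _) (pt _ _ _ q′) refl (_ , refl , n) refl = ⊥-elim (n (one-x S q q′))
  triple-nbrs S {q = q} (pc _ _) (pa _) refl refl e = ⊥-elim (t≢f q (e _))
  triple-nbrs S {q = q} (pc _ _) (pb _) refl refl e = ⊥-elim (t≢f q (e _))
  triple-nbrs S (pc _ p) (pt _ _ _ _) refl (f , _ , _) e = ⊥-elim (t≢f f p)
  triple-nbrs S (pt _ _ _ _) (pa _) (_ , _ , n) refl e = ⊥-elim (n e)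
  triple-nbrs S {q = q} (pt _ _ _ q′) (pb _) (_ , refl , n) refl refl = ⊥-elim (n (one-x S q q′))
  triple-nbrs S (pt _ _ _ _) (pc _ p) (f , _ , _) refl e = ⊥-elim (t≢f f p)
  triple-nbrs S (pt _ _ _ _) (pt _ _ _ _) _ _ _ = triple , triple

  Up : ∀ S → (u v w : Vertex S) → Set
  Up S u v w = ∃ λ S′ → ∃ λ h → BStar ⟦ S ⟧ ⟦ S′ ⟧ u v w h

  up-resp : ∀ {S u v w u′ v′ w′} → (∀ {k} → In u v w k → In u′ v′ w′ k) → (∀ {k} → In u′ v′ w′ k → In u v w k) →
    IsTriangle ⟦ S ⟧ u′ v′ w′ → Up S u v w → Up S u′ v′ w′
  up-resp f g t (S′ , h , B) = S′ , h , bstar-resp f g t B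

  up-parts : ∀ S {x y z p} → IsTriangle ⟦ S ⟧ (pa x) (pb y) (pc z p) → Up S (pa x) (pb y) (pc z p)
  up-parts S {p = p} (xy , yz , xz) with add S p xy yz xz
  ... | S′ , A = S′ , _ , adds-star A p (Adds.added A)

  up-triples : ∀ S {x y z q x′ y′ z′ q′ x″ y″ z″ q″} →
    IsTriangle ⟦ S ⟧ (pt x y z q) (pt x′ y′ z′ q′) (pt x″ y″ z″ q″) → Up S (pt x y z q) (pt x′ y′ z′ q′) (pt x″ y″ z″ q″)
  up-triples S ((f , refl , n) , (_ , refl , n′) , (_ , _ , n″)) with unflag S f
  ... | S′ , U = S′ , pc _ (Unflags.unflagged U) ,
        unflags-star U n n′ n″ (cover-three (flag-a S f) _ _ _ n n′ n″) _ _ _ _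

  -- By `triple-nbrs` a triangle with a centre has only centres, namely those left behind by a
  -- removed vertex, and the move restores that vertex. Any other triangle has one vertex in each
  -- part and is added to `T`.
  triangle-move : ∀ S u v w → IsTriangle ⟦ S ⟧ u v w → Up S u v w
  triangle-move S (pt x y z q) v w t@(uv , vw , uw) with triple-nbrs S {x} {y} {z} {q} v w uv uw vw
  ... | triple , triple = up-triples S t
  triangle-move S u@(pa _) (pt x y z q) w (uv , vw , uw) with triple-nbrs S {x} {y} {z} {q} u w uv vw uw
  ... | () , _
  triangle-move S u@(pb _) (pt x y z q) w (uv , vw , uw) with triple-nbrs S {x} {y} {z} {q} u w uv vw uw
  ... | () , _
  triangle-move S u@(pc _ _) (pt x y z q) w (uv , vw , uw) with triple-nbrs S {x} {y} {z} {q} u w uv vw uw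
  ... | () , _
  triangle-move S u@(pa _) v@(pb _) (pt x y z q) (uv , vw , uw) with triple-nbrs S {x} {y} {z} {q} u v uw vw uv
  ... | () , _
  triangle-move S u@(pa _) v@(pc _ _) (pt x y z q) (uv , vw , uw) with triple-nbrs S {x} {y} {z} {q} u v uw vw uv
  ... | () , _
  triangle-move S u@(pb _) v@(pa _) (pt x y z q) (uv , vw , uw) with triple-nbrs S {x} {y} {z} {q} u v uw vw uv
  ... | () , _
  triangle-move S u@(pb _) v@(pc _ _) (pt x y z q) (uv , vw , uw) with triple-nbrs S {x} {y} {z} {q} u v uw vw uv
  ... | () , _
  triangle-move S u@(pc _ _) v@(pa _) (pt x y z q) (uv , vw , uw) with triple-nbrs S {x} {y} {z} {q} u v uw vw uv
  ... | () , _
  triangle-move S u@(pc _ _) v@(pb _) (pt x y z q) (uv , vw , uw) with triple-nbrs S {x} {y} {z} {q} u v uw vw uv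
  ... | () , _
  triangle-move S (pa _) (pb _) (pc _ _) t = up-parts S t
  triangle-move S (pa _) (pc _ _) (pb _) t@(uv , vw , uw) =
    up-resp (In-swap ∘ In-rotate ∘ In-rotate) (In-swap ∘ In-rotate ∘ In-rotate) t (up-parts S (uw , vw , uv))
  triangle-move S (pb _) (pa _) (pc _ _) t@(uv , vw , uw) = up-resp In-swap In-swap t (up-parts S (uv , uw , vw))
  triangle-move S (pb _) (pc _ _) (pa _) t@(uv , vw , uw) = up-resp In-rotate (In-rotate ∘ In-rotate) t (up-parts S (uw , uv , vw))
  triangle-move S (pc _ _) (pa _) (pb _) t@(uv , vw , uw) = up-resp (In-rotate ∘ In-rotate) In-rotate t (up-parts S (vw , uw , uv))
  triangle-move S (pc _ _) (pb _) (pa _) t@(uv , vw , uw) =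
    up-resp (In-swap ∘ In-rotate) (In-swap ∘ In-rotate) t (up-parts S (vw , uv , uw))
  triangle-move S (pa _) (pa _) _ (() , _)
  triangle-move S (pb _) (pb _) _ (() , _)
  triangle-move S (pc _ _) (pc _ _) _ (() , _)
  triangle-move S (pa _) (pb _) (pa _) (_ , _ , ())
  triangle-move S (pa _) (pb _) (pb _) (_ , () , _)
  triangle-move S (pa _) (pc _ _) (pa _) (_ , _ , ())
  triangle-move S (pa _) (pc _ _) (pc _ _) (_ , () , _)
  triangle-move S (pb _) (pa _) (pa _) (_ , () , _)
  triangle-move S (pb _) (pa _) (pb _) (_ , _ , ())
  triangle-move S (pb _) (pc _ _) (pb _) (_ , _ , ())
  triangle-move S (pb _) (pc _ _) (pc _ _) (_ , () , _)
  triangle-move S (pc _ _) (pa _) (pa _) (_ , () , _)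
  triangle-move S (pc _ _) (pa _) (pc _ _) (_ , _ , ())
  triangle-move S (pc _ _) (pb _) (pb _) (_ , () , _)
  triangle-move S (pc _ _) (pb _) (pc _ _) (_ , _ , ())

  -- Degrees in the graph of a configuration

  First : ∀ {S} → Vertex S → Fin a → Set
  First (pa x) k = x ≡ k
  First (pt x _ _ _) k = x ≡ k
  First _ k = ⊥

  Second : ∀ {S} → Vertex S → Fin b → Set
  Second (pb y) k = y ≡ k
  Second (pt _ y _ _) k = y ≡ k
  Second _ k = ⊥

  Third : ∀ {S} → Vertex S → Fin c → Set
  Third (pc z _) k = z ≡ k
  Third (pt _ _ z _) k = z ≡ k
  Third _ k = ⊥

  first-unique : ∀ {S} (v : Vertex S) {k l} → First v k → First v l → k ≡ l
  first-unique (pa _) refl refl = refl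
  first-unique (pt _ _ _ _) refl refl = refl

  second-unique : ∀ {S} (v : Vertex S) {k l} → Second v k → Second v l → k ≡ l
  second-unique (pb _) refl refl = refl
  second-unique (pt _ _ _ _) refl refl = refl

  third-unique : ∀ {S} (v : Vertex S) {k l} → Third v k → Third v l → k ≡ l
  third-unique (pc _ _) refl refl = refl
  third-unique (pt _ _ _ _) refl refl = refl

  -- Neighbours with different coordinates are different, so one neighbour for each value of a
  -- coordinate bounds the degree from below.
  has-coordinate : ∀ {S v n} {P : Vertex S → Fin n → Set} → (∀ u {k l} → P u k → P u l → k ≡ l) →
    (∀ k → ∃ λ u → P u k × Edge S v u) → Has n ⟦ S ⟧ v
  has-coordinate {P = P} uniq g = (λ k → proj₁ (g k)) ,
    (λ {i} {j} e → uniq _ (proj₁ (proj₂ (g i))) (subst (λ u → P u j) (sym e) (proj₁ (proj₂ (g j))))) ,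
    (λ k → proj₂ (proj₂ (g k)))

  -- For each `z`, the edge to `z` is either intact or replaced by an edge to a centre at `z`. If
  -- `z` has been removed, the second case holds by `flag-x`.
  degree-a : ∀ S x → Has c ⟦ S ⟧ (pa x)
  degree-a S x = has-coordinate third-unique go
    where
    go : ∀ z → ∃ λ u → Third u z × Edge S (pa x) u
    go z with search (λ y → T S x y z)
    ... | inj₁ (y , q) = pt x y z q , refl , refl
    ... | inj₂ none = pc z (¬true⇒false λ e → let (y , q) = flag-x S e x in t≢f q (none y)) , refl , none

  degree-b : ∀ S y → Has c ⟦ S ⟧ (pb y)
  degree-b S y = has-coordinate third-unique go
    where
    go : ∀ z → ∃ λ u → Third u z × Edge S (pb y) u
    go z with search (λ x → T S x y z)
    ... | inj₁ (x , q) = pt x y z q , refl , refl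
    ... | inj₂ none = pc z (¬true⇒false λ e → let (x , q) = flag-y S e y in t≢f q (none x)) , refl , none

  private
    second-nbr : ∀ S z p y → ∃ λ u → Second u y × Edge S (pc z p) u
    second-nbr S z p y with search (λ x → T S x y z)
    ... | inj₁ (x , q) = pt x y z q , refl , refl
    ... | inj₂ none = pb y , refl , none

    first-nbr : ∀ S z p x → ∃ λ u → First u x × Edge S (pc z p) u
    first-nbr S z p x with search (λ y → T S x y z)
    ... | inj₁ (y , q) = pt x y z q , refl , refl
    ... | inj₂ none = pa x , refl , none

  degree-c : ∀ S z p → Has b ⟦ S ⟧ (pc z p)
  degree-c S z p = has-coordinate second-unique (second-nbr S z p)

  -- The extra neighbour `pa x` has no second coordinate, so it is not among the `b` neighbours
  -- found by that coordinate.
  degree-c-a : ∀ S z p {x} → (∀ y → T S x y z ≡ false) → Has (suc b) ⟦ S ⟧ (pc z p)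
  degree-c-a S z p {x} none = has-suc ⟦ S ⟧ (pa x) (degree-c S z p) none
    (λ y e → subst (λ u → Second u y) e (proj₁ (proj₂ (second-nbr S z p y))))

  degree-c-b : ∀ S z p {y} → (∀ x → T S x y z ≡ false) → Has (suc a) ⟦ S ⟧ (pc z p)
  degree-c-b S z p {y} none = has-suc ⟦ S ⟧ (pb y) (has-coordinate first-unique (first-nbr S z p)) none
    (λ x e → subst (λ u → First u x) e (proj₁ (proj₂ (first-nbr S z p x))))

  -- A centre at a removed vertex is joined to the `a - 1` other centres there and to two base
  -- vertices. As `a = 3`, this makes four, so it cannot be removed by a Y∇ move.
  degree-t : ∀ S {x y z} q → E S z ≡ true → Has (suc a) ⟦ S ⟧ (pt x y z q)
  degree-t S {x} {y} {z} q f = has-suc ⟦ S ⟧ (pb y) (has-coordinate first-unique nbr) refl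
    (λ x′ e → subst (λ u → First u x′) e (proj₁ (proj₂ (nbr x′))))
    where
    nbr : ∀ x′ → ∃ λ u → First u x′ × Edge S (pt x y z q) u
    nbr x′ with x Fin.≟ x′
    ... | yes refl = pa x , refl , refl
    ... | no n = let (y′ , q′) = flag-x S f x′ in pt x′ y′ z q′ , refl , f , refl , n

  -- Each neighbour occupies one base vertex: a neighbour in the base occupies itself, and a centre
  -- occupies its first coordinate, which for this reason is no longer a neighbour of `z`.
  few-c : ∀ S {z p} → ¬ Has (suc (a + b)) ⟦ S ⟧ (pc z p)
  few-c S {z} {p} (g , inj , e) = no-injection {P = Edge S (pc z p)} (λ u k → Fin.join a b (slot u k)) (λ {u} {v} k l q → slot-inj u v k l (join-injective a b q)) g inj e
    where
    slot : ∀ u → Edge S (pc z p) u → Fin a ⊎ Fin b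
    slot (pa x) _ = inj₁ x
    slot (pb y) _ = inj₂ y
    slot (pt x _ _ _) _ = inj₁ x
    slot-inj : ∀ u v k l → slot u k ≡ slot v l → u ≡ v
    slot-inj (pa _) (pa _) _ _ refl = refl
    slot-inj (pa _) (pt _ y _ q) k refl refl = ⊥-elim (t≢f q (k y))
    slot-inj (pb _) (pb _) _ _ refl = refl
    slot-inj (pt _ y _ q) (pa _) refl l refl = ⊥-elim (t≢f q (l y))
    slot-inj (pt _ _ _ q) (pt _ _ _ q′) refl refl refl = pt-≡ refl (one-y S q q′) refl

  few-t : ∀ S {x y z q} → 2 ≤ a → ¬ Has (suc (a + b)) ⟦ S ⟧ (pt x y z q)
  few-t S {x} {y} {z} {q} 2≤a (g , inj , e) =
    no-injection {P = Edge S (pt x y z q)} (λ u k → Fin.join a b (slot u k)) (λ {u} {v} k l q → slot-inj u v k l (join-injective a b q)) g inj e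
    where
    other : ∃ λ x′ → x ≢ x′
    other with x Fin.≟ fromℕ< 2≤a
    ... | no n = fromℕ< 2≤a , n
    ... | yes refl = fromℕ< (ℕₚ.<-trans (s≤s z≤n) 2≤a) ,
          λ e → ℕₚ.1+n≢0 (trans (sym (Finₚ.toℕ-fromℕ< 2≤a)) (trans (cong toℕ e) (Finₚ.toℕ-fromℕ< _)))
    x′ = proj₁ other
    slot : ∀ u → Edge S (pt x y z q) u → Fin a ⊎ Fin b
    slot (pa _) _ = inj₁ x
    slot (pb y) _ = inj₂ y
    -- A slot different from that of `pa x`, which is why `a` must be at least 2. No other centre
    -- competes for it, since centres are adjacent only when `z` has been removed.
    slot (pc _ _) _ = inj₁ x′
    slot (pt x _ _ _) _ = inj₁ x
    slot-inj : ∀ u v k l → slot u k ≡ slot v l → u ≡ v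
    slot-inj (pa _) (pa _) refl refl _ = refl
    slot-inj (pa _) (pc _ _) refl l r = ⊥-elim (proj₂ other (inj₁-injective r))
    slot-inj (pa _) (pt _ _ _ _) refl (_ , _ , n) r = ⊥-elim (n (inj₁-injective r))
    slot-inj (pb _) (pb _) _ _ refl = refl
    slot-inj (pc _ _) (pa _) k refl r = ⊥-elim (proj₂ other (sym (inj₁-injective r)))
    slot-inj (pc _ _) (pc _ _) refl refl _ = pc-≡ refl
    slot-inj (pc _ p) (pt _ _ _ _) refl (f , _ , _) _ = ⊥-elim (t≢f f p)
    slot-inj (pt _ _ _ _) (pa _) (_ , _ , n) refl r = ⊥-elim (n (sym (inj₁-injective r)))
    slot-inj (pt _ _ _ _) (pc _ p) (f , _ , _) refl _ = ⊥-elim (t≢f f p)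
    slot-inj (pt _ _ _ q) (pt _ _ _ q′) (_ , refl , _) (_ , refl , _) refl = pt-≡ refl (one-y S q q′) refl

  few-base : ∀ S (g : Fin (suc (a + b)) → Vertex S) → (∀ {i j} → g i ≡ g j → i ≡ j) → ¬ (∀ i → Part S (g i))
  few-base S = no-injection {P = Part S} (λ u k → Fin.join a b (slot u k)) (λ {u} {v} k l q → slot-inj u v k l (join-injective a b q))
    where
    slot : ∀ u → Part S u → Fin a ⊎ Fin b
    slot (pa x) _ = inj₁ x
    slot (pb y) _ = inj₂ y
    slot-inj : ∀ u v k l → slot u k ≡ slot v l → u ≡ v
    slot-inj (pa _) (pa _) _ _ refl = refl
    slot-inj (pb _) (pb _) _ _ refl = refl

  graded : 2 ≤ a → a + b < c → ∀ S → Graded (a + b) ⟦ S ⟧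
  graded 2≤a D<c S = record
    { base-many = λ { {pa x} _ → has-≤ ⟦ S ⟧ (pa x) D<c (degree-a S x) ; {pb y} _ → has-≤ ⟦ S ⟧ (pb y) D<c (degree-b S y) }
    ; nonbase-few = λ { {pa x} n → ⊥-elim (n tt) ; {pb y} n → ⊥-elim (n tt) ; {pc z p} _ → few-c S ; {pt x y z q} _ → few-t S 2≤a }
    ; base-bounded = few-base S }

  -- A present vertex of the third part has between `b` and `a + b` neighbours, so it is never
  -- removable if `b ≥ 4` or `a = b = 1`. If `a = b = 3`, degree three forces all its edges to the
  -- base into triangles of `T`, which is what a flag requires.
  Ordinary : Set
  Ordinary = 4 ≤ b ⊎ (a ≡ 3 × b ≡ 3) ⊎ (a ≡ 1 × b ≡ 1)

  Down : ∀ S → Vertex S → Set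
  Down S v = ∃ λ S′ → ∃ λ u → ∃ λ u′ → ∃ λ u″ → BStar ⟦ S′ ⟧ ⟦ S ⟧ u u′ u″ v

  unflags-move : ∀ {S S′ z} → Unflags S S′ z → ∀ p → ∃ λ u → ∃ λ u′ → ∃ λ u″ → BStar ⟦ S ⟧ ⟦ S′ ⟧ u u′ u″ (pc z p)
  unflags-move {S} {S′} {z} U p = _ , _ , _ ,
    unflags-star U (n (λ ())) (n (λ ())) (n (λ ())) (cover-three a3 _ _ _ (n (λ ())) (n (λ ())) (n (λ ())))
      (proj₂ (tr zero)) (proj₂ (tr (suc zero))) (proj₂ (tr (suc (suc zero)))) p
    where
    a3 = flag-a S (Unflags.flagged U)
    x : Fin 3 → Fin a
    x = Fin.cast (sym a3)
    n : ∀ {i j : Fin 3} → i ≢ j → x i ≢ x j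
    n i≢j e = i≢j (Finₚ.toℕ-injective (trans (sym (Finₚ.toℕ-cast (sym a3) _)) (trans (cong toℕ e) (Finₚ.toℕ-cast (sym a3) _))))
    tr : ∀ i → ∃ λ y → T S (x i) y z ≡ true
    tr i = flag-x S (Unflags.flagged U) (x i)

  y-move : Ordinary → ∀ S v {u u′ u″} → ¬ Part S v → IsY ⟦ S ⟧ v u u′ u″ → Down S v
  y-move o S (pa _) n Y = ⊥-elim (n tt)
  y-move o S (pb _) n Y = ⊥-elim (n tt)
  y-move o S (pt x y z q) n Y with E S z in e
  ... | true = ⊥-elim (isY⇒¬has4 Y (has-≤ ⟦ S ⟧ (pt x y z q) (ℕₚ.≤-reflexive (cong suc (sym (flag-a S e)))) (degree-t S q e)))
  ... | false with remove S q e
  ... | S′ , A = S′ , _ , _ , _ , adds-star A (Adds.unflagged A) q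
  y-move (inj₁ 4≤b) S (pc z p) n Y = ⊥-elim (isY⇒¬has4 Y (has-≤ ⟦ S ⟧ (pc z p) 4≤b (degree-c S z p)))
  y-move (inj₂ (inj₂ (a1 , b1))) S (pc z p) n Y =
    ⊥-elim (few-c S {z} {p} (has-≤ ⟦ S ⟧ (pc z p) (ℕₚ.≤-reflexive (cong suc (cong₂ _+_ a1 b1))) (isY-has3 Y)))
  y-move (inj₂ (inj₁ (a3 , b3))) S (pc z p) n Y with flag S p a3 b3 fx fy
    where
    fx : ∀ x → ∃ λ y → T S x y z ≡ true
    fx x with search (λ y → T S x y z)
    ... | inj₁ t = t
    ... | inj₂ none = ⊥-elim (isY⇒¬has4 Y (has-≤ ⟦ S ⟧ (pc z p) (ℕₚ.≤-reflexive (cong suc (sym b3))) (degree-c-a S z p none)))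
    fy : ∀ y → ∃ λ x → T S x y z ≡ true
    fy y with search (λ x → T S x y z)
    ... | inj₁ t = t
    ... | inj₂ none = ⊥-elim (isY⇒¬has4 Y (has-≤ ⟦ S ⟧ (pc z p) (ℕₚ.≤-reflexive (cong suc (sym a3))) (degree-c-b S z p none)))
  ... | S′ , U = S′ , unflags-move U p

  -- The triangles of T use distinct edges between the first two parts, all different from the
  -- given one, so there are fewer than a * b ≤ c of them.
  unused : a * b ≤ c → ∀ S {x y} → (∀ z → T S x y z ≡ false) → ∃ λ z → ∀ x′ y′ → T S x′ y′ z ≡ false
  unused ab≤c S {x₀} {y₀} none with Finₚ.any? (λ z → Finₚ.all? λ x → Finₚ.all? λ y → T S x y z Bool.≟ false)
  ... | yes p = p
  ... | no n = ⊥-elim (ℕₚ.<⇒≱ (s≤s ab≤c) (Finₚ.injective⇒≤ {f = f} (λ {i} {j} → f-inj i j)))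
    where
    used : ∀ z → ∃ λ x → ∃ λ y → T S x y z ≡ true
    used z with search (λ x → [ (λ _ → true) , (λ _ → false) ]′ (search (λ y → T S x y z)))
    ... | inj₁ (x , _) with search (λ y → T S x y z)
    ... | inj₁ (y , q) = x , y , q
    used z | inj₂ no-x = ⊥-elim (n (z , λ x y → ¬true⇒false λ q → absurd x y q))
      where
      absurd : ∀ x y → T S x y z ≡ true → ⊥
      absurd x y q with search (λ y → T S x y z) | no-x x
      ... | inj₂ none | _ = t≢f q (none y)
    f : Fin (suc c) → Fin (a * b)
    f zero = combine x₀ y₀
    f (suc z) = combine (proj₁ (used z)) (proj₁ (proj₂ (used z)))
    clash : ∀ z → combine x₀ y₀ ≢ combine (proj₁ (used z)) (proj₁ (proj₂ (used z)))
    clash z e with used z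
    ... | x , y , q with Finₚ.combine-injective x₀ y₀ x y e
    ... | refl , refl = t≢f q (none z)
    f-inj : ∀ i j → f i ≡ f j → i ≡ j
    f-inj zero zero e = refl
    f-inj zero (suc z) e = ⊥-elim (clash z e)
    f-inj (suc z) zero e = ⊥-elim (clash z (sym e))
    f-inj (suc z) (suc z′) e with used z | used z′
    ... | x , y , q | x′ , y′ , q′ with Finₚ.combine-injective x y x′ y′ e
    ... | refl , refl = cong suc (one-z S q q′)

  full-vertex : a * b ≤ c → ∀ S {x y} → (∀ z → T S x y z ≡ false) → ∃ (Full ⟦ S ⟧)
  full-vertex ab≤c S {x} none with unused ab≤c S none
  ... | z , free = pc z (¬true⇒false λ e → let (y , q) = flag-x S e x in t≢f q (free x y)) , record
    { full-base = id
    ; full→ = λ { {pa _} _ → tt ; {pb _} _ → tt ; {pt x y _ q} refl → t≢f q (free x y) }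
    ; full← = λ { {pa x} _ y → free x y ; {pb y} _ x → free x y } }

  -- Enumerating the configurations

  valid? : ∀ T E → Dec (Valid T E)
  valid? T E = map′
    (λ { (p , q , r , f) → record
      { one-z = λ {x} {y} {z} {z′} → p x y z z′ ; one-y = λ {x} {y} {y′} {z} → q x y y′ z ; one-x = λ {x} {x′} {y} {z} → r x x′ y z
      ; flag-a = λ {z} e → proj₁ (f z e) ; flag-b = λ {z} e → proj₁ (proj₂ (f z e))
      ; flag-x = λ {z} e → proj₁ (proj₂ (proj₂ (f z e))) ; flag-y = λ {z} e → proj₂ (proj₂ (proj₂ (f z e))) } })
    (λ v → let module W = Valid v in (λ _ _ _ _ → W.one-z) , (λ _ _ _ _ → W.one-y) , (λ _ _ _ _ → W.one-x) ,
      λ z e → W.flag-a e , W.flag-b e , W.flag-x e , W.flag-y e)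
    (Finₚ.all? (λ x → Finₚ.all? λ y → Finₚ.all? λ z → Finₚ.all? λ z′ →
       (T x y z Bool.≟ true) →-dec ((T x y z′ Bool.≟ true) →-dec (z Fin.≟ z′))) ×-dec
     Finₚ.all? (λ x → Finₚ.all? λ y → Finₚ.all? λ y′ → Finₚ.all? λ z →
       (T x y z Bool.≟ true) →-dec ((T x y′ z Bool.≟ true) →-dec (y Fin.≟ y′))) ×-dec
     Finₚ.all? (λ x → Finₚ.all? λ x′ → Finₚ.all? λ y → Finₚ.all? λ z →
       (T x y z Bool.≟ true) →-dec ((T x′ y z Bool.≟ true) →-dec (x Fin.≟ x′))) ×-dec
     Finₚ.all? (λ z → (E z Bool.≟ true) →-dec ((a ℕ.≟ 3) ×-dec (b ℕ.≟ 3) ×-dec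
       (Finₚ.all? λ x → Finₚ.any? λ y → T x y z Bool.≟ true) ×-dec
       (Finₚ.all? λ y → Finₚ.any? λ x → T x y z Bool.≟ true))))

  valid-resp : ∀ {T E T′ E′} → (∀ x y z → T′ x y z ≡ T x y z) → (∀ z → E′ z ≡ E z) → Valid T E → Valid T′ E′
  valid-resp eT eE v = record
    { one-z = λ p q → W.one-z (trans (sym (eT _ _ _)) p) (trans (sym (eT _ _ _)) q)
    ; one-y = λ p q → W.one-y (trans (sym (eT _ _ _)) p) (trans (sym (eT _ _ _)) q)
    ; one-x = λ p q → W.one-x (trans (sym (eT _ _ _)) p) (trans (sym (eT _ _ _)) q)
    ; flag-a = λ e → W.flag-a (trans (sym (eE _)) e) ; flag-b = λ e → W.flag-b (trans (sym (eE _)) e)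
    ; flag-x = λ e x → let (y , t) = W.flag-x (trans (sym (eE _)) e) x in y , trans (eT _ _ _) t
    ; flag-y = λ e y → let (x , t) = W.flag-y (trans (sym (eE _)) e) y in x , trans (eT _ _ _) t }
    where module W = Valid v

  empty : Config
  empty = config (λ _ _ _ → false) (λ _ → false) record
    { one-z = λ () ; one-y = λ () ; one-x = λ () ; flag-a = λ () ; flag-b = λ () ; flag-x = λ () ; flag-y = λ () }

  rank : Fin a → Fin b → Fin c → Fin (a * (b * c))
  rank x y z = combine x (combine y z)

  rank-injective : ∀ {x y z x′ y′ z′} → rank x y z ≡ rank x′ y′ z′ → x ≡ x′ × y ≡ y′ × z ≡ z′
  rank-injective {x} {y} {z} {x′} {y′} {z′} e with Finₚ.combine-injective x (combine y z) x′ (combine y′ z′) e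
  ... | e₁ , e₂ with Finₚ.combine-injective y z y′ z′ e₂
  ... | e₃ , e₄ = e₁ , e₃ , e₄

  -- One bit for each triangle of `K a b c` and one for each vertex of the third part.
  codes : ℕ
  codes = 2 ^ (a * (b * c)) * 2 ^ c

  private
    decode-T : Fin codes → Fin a → Fin b → Fin c → Bool
    decode-T k x y z = bool (finToFun (proj₁ (remQuot {2 ^ (a * (b * c))} (2 ^ c) k)) (rank x y z))

    decode-E : Fin codes → Fin c → Bool
    decode-E k z = bool (finToFun (proj₂ (remQuot {2 ^ (a * (b * c))} (2 ^ c) k)) z)

  decode : Fin codes → Config
  decode k with valid? (decode-T k) (decode-E k)
  ... | yes v = config (decode-T k) (decode-E k) v
  -- Invalid bit patterns merely repeat the empty configuration, which does no harm because
  -- representatives of the classes are selected afterwards.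
  ... | no _ = empty

  private
    encode-T : Config → Fin (a * (b * c)) → Fin 2
    encode-T S i = let (x , j) = remQuot {a} (b * c) i ; (y , z) = remQuot {b} c j in bool⁻ (T S x y z)

    encode-E : Config → Fin c → Fin 2
    encode-E S z = bool⁻ (E S z)

  encode : Config → Fin codes
  encode S = combine (funToFin (encode-T S)) (funToFin (encode-E S))

  private
    decode-encode-T : ∀ S x y z → decode-T (encode S) x y z ≡ T S x y z
    decode-encode-T S x y z = trans
      (cong (λ k → bool (finToFun (proj₁ k) (rank x y z)))
        (Finₚ.remQuot-combine {2 ^ (a * (b * c))} {2 ^ c} (funToFin (encode-T S)) (funToFin (encode-E S))))
      (trans (cong bool (Finₚ.finToFun-funToFin (encode-T S) (rank x y z)))
      (trans (bool-bool⁻ _)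
      (trans (cong (λ k → T S (proj₁ k) (proj₁ (remQuot {b} c (proj₂ k))) (proj₂ (remQuot {b} c (proj₂ k))))
               (Finₚ.remQuot-combine {a} {b * c} x (combine y z)))
             (cong (λ k → T S x (proj₁ k) (proj₂ k)) (Finₚ.remQuot-combine {b} {c} y z)))))

    decode-encode-E : ∀ S z → decode-E (encode S) z ≡ E S z
    decode-encode-E S z = trans
      (cong (λ k → bool (finToFun (proj₂ k) z))
        (Finₚ.remQuot-combine {2 ^ (a * (b * c))} {2 ^ c} (funToFin (encode-T S)) (funToFin (encode-E S))))
      (trans (cong bool (Finₚ.finToFun-funToFin (encode-E S) z)) (bool-bool⁻ _))

    decode-valid : ∀ k → Valid (decode-T k) (decode-E k) →
      (∀ x y z → T (decode k) x y z ≡ decode-T k x y z) × (∀ z → E (decode k) z ≡ decode-E k z)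
    decode-valid k v with valid? (decode-T k) (decode-E k)
    ... | yes _ = (λ _ _ _ → refl) , (λ _ → refl)
    ... | no n = ⊥-elim (n v)

  decode-encode : ∀ S → BIso ⟦ S ⟧ ⟦ decode (encode S) ⟧
  decode-encode S = same-config S (decode (encode S))
    (λ x y z → sym (trans (proj₁ same x y z) (decode-encode-T S x y z))) (λ z → sym (trans (proj₂ same z) (decode-encode-E S z)))
    where same = decode-valid (encode S) (valid-resp (decode-encode-T S) (decode-encode-E S) (valid S))

  -- Reaching every configuration from the empty one

  -- Triangles are inserted one at a time in the order of `rank`, with all flags off, since a flag
  -- is valid only once all triangles at its vertex are present. The flags follow one at a time in
  -- `restrict-flags`.
  restrict : Config → ℕ → Config
  restrict S k = config (λ x y z → T S x y z ∧ (toℕ (rank x y z) <ᵇ k)) (λ _ → false) record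
    { one-z = λ p q → one-z S (proj₁ (∧-true p)) (proj₁ (∧-true q))
    ; one-y = λ p q → one-y S (proj₁ (∧-true p)) (proj₁ (∧-true q))
    ; one-x = λ p q → one-x S (proj₁ (∧-true p)) (proj₁ (∧-true q))
    ; flag-a = λ () ; flag-b = λ () ; flag-x = λ () ; flag-y = λ () }

  restrict-zero : ∀ S x y z → T empty x y z ≡ T (restrict S 0) x y z
  restrict-zero S x y z = sym (¬true⇒false λ p → t≢f (proj₂ (∧-true {T S x y z} p)) refl)

  restrict-all : ∀ S x y z → T (restrict S (a * (b * c))) x y z ≡ T S x y z
  restrict-all S x y z = ≡true-ext (λ p → proj₁ (∧-true p)) (λ p → true-∧ p (true-<ᵇ (Finₚ.toℕ<n (rank x y z))))

  restrict-step : ∀ S k → (∃ λ x → ∃ λ y → ∃ λ z → Adds (restrict S k) (restrict S (suc k)) x y z) ⊎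
    (∀ x y z → T (restrict S k) x y z ≡ T (restrict S (suc k)) x y z)
  restrict-step S k with Finₚ.any? (λ x → Finₚ.any? λ y → Finₚ.any? λ z → (T S x y z Bool.≟ true) ×-dec (toℕ (rank x y z) ℕ.≟ k))
  ... | yes (x , y , z , t , refl) = inj₁ (x , y , z , record
    { fresh = ¬true⇒false λ p → ℕₚ.<-irrefl refl (<ᵇ-true {toℕ (rank x y z)} (proj₂ (∧-true {T S x y z} p)))
    ; added = true-∧ t (true-<ᵇ (ℕₚ.n<1+n (toℕ (rank x y z))))
    ; keep = λ {x′} {y′} {z′} p → let (p₁ , p₂) = ∧-true {T S x′ y′ z′} p in
        true-∧ p₁ (true-<ᵇ {toℕ (rank x′ y′ z′)} (ℕₚ.m<n⇒m<1+n (<ᵇ-true {toℕ (rank x′ y′ z′)} p₂)))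
    ; split = λ {x′} {y′} {z′} p → let (p₁ , p₂) = ∧-true {T S x′ y′ z′} p in
        Sum.map (λ l → true-∧ p₁ (true-<ᵇ l)) (λ e → rank-injective (Finₚ.toℕ-injective e))
          (ℕₚ.m≤n⇒m<n∨m≡n (ℕₚ.≤-pred (<ᵇ-true {toℕ (rank x′ y′ z′)} p₂)))
    ; unflagged = refl ; flags = λ _ → refl })
  ... | no n = inj₂ λ x y z → ≡true-ext
    (λ p → let (p₁ , p₂) = ∧-true {T S x y z} p in
      true-∧ p₁ (true-<ᵇ {toℕ (rank x y z)} (ℕₚ.m<n⇒m<1+n (<ᵇ-true {toℕ (rank x y z)} p₂))))
    (λ p → let (p₁ , p₂) = ∧-true {T S x y z} p in
      true-∧ p₁ (true-<ᵇ {toℕ (rank x y z)} (ℕₚ.≤∧≢⇒< (ℕₚ.≤-pred (<ᵇ-true {toℕ (rank x y z)} p₂)) (λ e → n (x , y , z , p₁ , e)))))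

  restrict-flags : Config → ℕ → Config
  restrict-flags S k = config (T S) (λ z → E S z ∧ (toℕ z <ᵇ k)) record
    { one-z = one-z S ; one-y = one-y S ; one-x = one-x S
    ; flag-a = λ e → flag-a S (proj₁ (∧-true e)) ; flag-b = λ e → flag-b S (proj₁ (∧-true e))
    ; flag-x = λ e → flag-x S (proj₁ (∧-true e)) ; flag-y = λ e → flag-y S (proj₁ (∧-true e)) }

  flags-step : ∀ S k → (∃ λ z → Unflags (restrict-flags S (suc k)) (restrict-flags S k) z) ⊎
    (∀ z → E (restrict-flags S k) z ≡ E (restrict-flags S (suc k)) z)
  flags-step S k with Finₚ.any? (λ z → (E S z Bool.≟ true) ×-dec (toℕ z ℕ.≟ k))
  ... | yes (z , t , refl) = inj₁ (z , record
    { flagged = true-∧ t (true-<ᵇ (ℕₚ.n<1+n (toℕ z)))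
    ; unflagged = ¬true⇒false λ p → ℕₚ.<-irrefl refl (<ᵇ-true {toℕ z} (proj₂ (∧-true {E S z} p)))
    ; others = λ {z′} n → ≡true-ext
        (λ p → let (p₁ , p₂) = ∧-true {E S z′} p in true-∧ p₁ (true-<ᵇ {toℕ z′} (ℕₚ.m<n⇒m<1+n (<ᵇ-true {toℕ z′} p₂))))
        (λ p → let (p₁ , p₂) = ∧-true {E S z′} p in
          true-∧ p₁ (true-<ᵇ {toℕ z′} (ℕₚ.≤∧≢⇒< (ℕₚ.≤-pred (<ᵇ-true {toℕ z′} p₂)) (n ∘ Finₚ.toℕ-injective))))
    ; triples = λ _ _ _ → refl })
  ... | no n = inj₂ λ z → ≡true-ext
    (λ p → let (p₁ , p₂) = ∧-true {E S z} p in true-∧ p₁ (true-<ᵇ {toℕ z} (ℕₚ.m<n⇒m<1+n (<ᵇ-true {toℕ z} p₂))))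
    (λ p → let (p₁ , p₂) = ∧-true {E S z} p in
      true-∧ p₁ (true-<ᵇ {toℕ z} (ℕₚ.≤∧≢⇒< (ℕₚ.≤-pred (<ᵇ-true {toℕ z} p₂)) (λ e → n (z , p₁ , e)))))

  reach-restrict : ∀ S k → BPath ⟦ empty ⟧ ⟦ restrict S k ⟧
  reach-restrict S zero = via {H = ⟦ empty ⟧} {K = ⟦ restrict S zero ⟧} done (same-config empty (restrict S zero) (restrict-zero S) (λ _ → refl))
  reach-restrict S (suc k) = extend (restrict-step S k)
    where
    extend : (∃ λ x → ∃ λ y → ∃ λ z → Adds (restrict S k) (restrict S (suc k)) x y z) ⊎
      (∀ x y z → T (restrict S k) x y z ≡ T (restrict S (suc k)) x y z) → BPath ⟦ empty ⟧ ⟦ restrict S (suc k) ⟧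
    extend (inj₁ (x , y , z , A)) = up {H = ⟦ restrict S k ⟧} {K = ⟦ restrict S (suc k) ⟧} (reach-restrict S k)
      (adds-star {restrict S k} {restrict S (suc k)} {x} {y} {z} A (Adds.unflagged A) (Adds.added A))
    extend (inj₂ e) = via {H = ⟦ restrict S k ⟧} {K = ⟦ restrict S (suc k) ⟧} (reach-restrict S k) (same-config (restrict S k) (restrict S (suc k)) e (λ _ → refl))

  reach-flags : ∀ S k → BPath ⟦ empty ⟧ ⟦ restrict-flags S k ⟧
  reach-flags S zero = via {H = ⟦ restrict S (a * (b * c)) ⟧} {K = ⟦ restrict-flags S zero ⟧} (reach-restrict S (a * (b * c)))
    (same-config (restrict S (a * (b * c))) (restrict-flags S zero) (restrict-all S)
      (λ z → sym (¬true⇒false λ p → t≢f (proj₂ (∧-true {E S z} p)) refl)))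
  reach-flags S (suc k) = extend (flags-step S k)
    where
    extend : (∃ λ z → Unflags (restrict-flags S (suc k)) (restrict-flags S k) z) ⊎
      (∀ z → E (restrict-flags S k) z ≡ E (restrict-flags S (suc k)) z) → BPath ⟦ empty ⟧ ⟦ restrict-flags S (suc k) ⟧
    extend (inj₁ (z , U)) = let (_ , _ , _ , B) = unflags-move {restrict-flags S (suc k)} {restrict-flags S k} {z} U (Unflags.unflagged U) in
      down {H = ⟦ restrict-flags S k ⟧} {K = ⟦ restrict-flags S (suc k) ⟧} (reach-flags S k) B
    extend (inj₂ e) = via {H = ⟦ restrict-flags S k ⟧} {K = ⟦ restrict-flags S (suc k) ⟧} (reach-flags S k) (same-config (restrict-flags S k) (restrict-flags S (suc k)) (λ _ _ _ → refl) e)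

  reach-config : ∀ S → BPath ⟦ empty ⟧ ⟦ S ⟧
  reach-config S = via {H = ⟦ restrict-flags S c ⟧} {K = ⟦ S ⟧} (reach-flags S c) (same-config (restrict-flags S c) S (λ _ _ _ → refl)
    (λ z → ≡true-ext (λ p → proj₁ (∧-true p)) (λ p → true-∧ p (true-<ᵇ (Finₚ.toℕ<n z)))))

  bipartite-⊕ : BIso (bipartite a b ⊕ c) ⟦ empty ⟧
  bipartite-⊕ = biso-sym record
    { plain = record
      { to = t ; from = [ (λ u → [ pa , pb ]′ (splitAt a u)) , (λ z → pc z refl) ]′
      ; to-from = tf ; from-to = ft
      ; pres = λ {u} {v} → P u v ; reflects = λ {u} {v} → R u v }
    ; base→ = λ { {pa _} _ → tt ; {pb _} _ → tt }
    ; base← = λ { {pa _} _ → tt ; {pb _} _ → tt } }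
    where
    f : V (bipartite a b ⊕ c) → Vertex empty
    f = [ (λ u → [ pa , pb ]′ (splitAt a u)) , (λ z → pc z refl) ]′
    t : Vertex empty → V (bipartite a b ⊕ c)
    t (pa x) = inj₁ (x ↑ˡ b)
    t (pb y) = inj₁ (a ↑ʳ y)
    t (pc z _) = inj₂ z
    tf : ∀ v → t (f v) ≡ v
    tf (inj₂ z) = refl
    tf (inj₁ u) with splitAt a u in e
    ... | inj₁ x = cong inj₁ (Finₚ.splitAt⁻¹-↑ˡ e)
    ... | inj₂ y = cong inj₁ (Finₚ.splitAt⁻¹-↑ʳ e)
    ft : ∀ v → f (t v) ≡ v
    ft (pa x) = cong [ pa , pb ]′ (Finₚ.splitAt-↑ˡ a x b)
    ft (pb y) = cong [ pa , pb ]′ (Finₚ.splitAt-↑ʳ a b y)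
    ft (pc z p) = pc-≡ refl
    apart : ∀ x y → part a b (toℕ (x ↑ˡ b)) ≢ part a b (toℕ (a ↑ʳ y))
    apart x y e with trans (sym (part-left a b x)) (trans e (part-right a b y))
    ... | ()
    P : ∀ u v → Edge empty u v → Adj (bipartite a b ⊕ c) (t u) (t v)
    P (pa x) (pb y) _ = apart x y
    P (pb y) (pa x) _ = apart x y ∘ sym
    P (pa _) (pc _ _) _ = tt
    P (pc _ _) (pa _) _ = tt
    P (pb _) (pc _ _) _ = tt
    P (pc _ _) (pb _) _ = tt
    R : ∀ u v → Adj (bipartite a b ⊕ c) (t u) (t v) → Edge empty u v
    R (pa x) (pa x′) n = n (trans (part-left a b x) (sym (part-left a b x′)))
    R (pb y) (pb y′) n = n (trans (part-right a b y) (sym (part-right a b y′)))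
    R (pa _) (pb _) _ _ = refl
    R (pb _) (pa _) _ _ = refl
    R (pa _) (pc _ _) _ _ = refl
    R (pc _ _) (pa _) _ _ = refl
    R (pb _) (pc _ _) _ _ = refl
    R (pc _ _) (pb _) _ _ = refl

  -- The family described by configurations

  open Stable (λ i → ⟦ decode i ⟧) (λ _ → 0)

  private
    config-target : ∀ S → Target 0 ⟦ S ⟧
    config-target S = encode S , 0 , biso-trans (decode-encode S) ⊕-zero , refl

  -- In the ordinary cases `a + b` is 2 or at least 4: in the one case three distinct base vertices
  -- are too many, in the other they are too few.
  three-parts : Ordinary → ∀ S → ¬ ∃ λ u → ∃ λ v → ∃ λ w → u ≢ v × v ≢ w × u ≢ w ×
    Part S u × Part S v × Part S w × (∀ k → Part S k → In u v w k)
  three-parts o S (u , v , w , u≢v , v≢w , u≢w , pu , pv , pw , all-in) =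
    [ many ∘ (λ 4≤b → ℕₚ.≤-trans 4≤b (ℕₚ.m≤n+m b a)) ,
      [ (λ { (a3 , b3) → many (ℕₚ.≤-trans (ℕₚ.≤ᵇ⇒≤ 4 6 _) (ℕₚ.≤-reflexive (sym (cong₂ _+_ a3 b3)))) }) ,
        (λ { (a1 , b1) → few (ℕₚ.≤-reflexive (cong suc (cong₂ _+_ a1 b1))) }) ]′ ]′ o
    where
    many : ¬ (4 ≤ a + b)
    many le = no-four (λ i → g (splitAt a (inject≤ i le)))
      (λ e → Finₚ.inject≤-injective le le _ _ (split-inj (g-inj _ _ e)))
      (λ i → all-in _ (g-part (splitAt a (inject≤ i le))))
      where
      g : Fin a ⊎ Fin b → Vertex S
      g = [ pa , pb ]′
      g-inj : ∀ s t → g s ≡ g t → s ≡ t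
      g-inj (inj₁ _) (inj₁ _) refl = refl
      g-inj (inj₂ _) (inj₂ _) refl = refl
      g-part : ∀ s → Part S (g s)
      g-part (inj₁ _) = tt
      g-part (inj₂ _) = tt
      split-inj : ∀ {i j : Fin (a + b)} → splitAt a i ≡ splitAt a j → i ≡ j
      split-inj {i} {j} e = trans (sym (Finₚ.join-splitAt a b i)) (trans (cong (Fin.join a b) e) (Finₚ.join-splitAt a b j))
    few : ¬ (suc (a + b) ≤ 3)
    few le = few-base S (λ i → g (inject≤ i le)) (λ e → Finₚ.inject≤-injective le le _ _ (g-inj _ _ e)) (λ i → g-part (inject≤ i le))
      where
      g : Fin 3 → Vertex S
      g zero = u
      g (suc zero) = v
      g (suc (suc zero)) = w
      g-part : ∀ i → Part S (g i)
      g-part zero = pu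
      g-part (suc zero) = pv
      g-part (suc (suc zero)) = pw
      g-inj : ∀ i j → g i ≡ g j → i ≡ j
      g-inj zero zero _ = refl
      g-inj zero (suc zero) e = ⊥-elim (u≢v e)
      g-inj zero (suc (suc zero)) e = ⊥-elim (u≢w e)
      g-inj (suc zero) zero e = ⊥-elim (u≢v (sym e))
      g-inj (suc zero) (suc zero) _ = refl
      g-inj (suc zero) (suc (suc zero)) e = ⊥-elim (v≢w e)
      g-inj (suc (suc zero)) zero e = ⊥-elim (u≢w (sym e))
      g-inj (suc (suc zero)) (suc zero) e = ⊥-elim (v≢w (sym e))
      g-inj (suc (suc zero)) (suc (suc zero)) _ = refl

  base-edge : ∀ S u v → Part S u → Part S v → Edge S u v → ∃ λ x → ∃ λ y → ∀ z → T S x y z ≡ false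
  base-edge S (pa x) (pb y) _ _ e = x , y , e
  base-edge S (pb y) (pa x) _ _ e = x , y , e

  module _ (o : Ordinary) (4≤c : 4 ≤ c) (ab≤c : a * b ≤ c) where

    closed : Closed
    closed = record
      { close-up = λ i {x} {y} {z} t → let (S′ , h , B) = triangle-move (decode i) x y z t in ⟦ S′ ⟧ , h , B , config-target S′
      ; close-new = λ i {x} {y} bx by e → let (_ , _ , none) = base-edge (decode i) x y bx by e in
          inj₁ (full-vertex ab≤c (decode i) none)
      ; close-down = λ i {v} n Y → let (S′ , x , y , z , B) = y-move o (decode i) v n Y in ⟦ S′ ⟧ , x , y , z , B , config-target S′
      ; base-degree = λ i {v} p → let (g , inj , e) = four (decode i) v p in inj₁ ∘ g , inj ∘ inj₁-injective , e
      ; base-size = λ i → three-parts o (decode i) }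
      where
      four : ∀ S v → Part S v → Has 4 ⟦ S ⟧ v
      four S (pa x) _ = has-≤ ⟦ S ⟧ (pa x) 4≤c (degree-a S x)
      four S (pb y) _ = has-≤ ⟦ S ⟧ (pb y) 4≤c (degree-b S y)

    ordinary-family : (∀ n S S′ → Iso (⟦ S ⟧ ⊕ n) (⟦ S′ ⟧ ⊕ n) → BIso ⟦ S ⟧ ⟦ S′ ⟧) → ∃ λ k → ∀ n → FamilySize (K a b (c + n)) k
    ordinary-family separated = class-count closed (encode empty) reach sep ,
      λ n → stable-family closed (encode empty) reach sep n (K a b (c + n)) (K-simple a b (c + n))
        (iso-trans {H = bipartite a b ⊕ (c + n)} (K-⊕ a b (c + n))
          (plain (⊕-resplit {bipartite a b} {⟦ empty ⟧} {⟦ decode (encode empty) ⟧} c n bipartite-⊕ (decode-encode empty))))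
      where
      reach : ∀ i → BPath (⟦ decode (encode empty) ⟧ ⊕ 0) (⟦ decode i ⟧ ⊕ 0)
      reach i = ⊕-zero-path {⟦ empty ⟧} {⟦ decode (encode empty) ⟧} {⟦ decode i ⟧} (decode-encode empty) (reach-config (decode i))
      sep : ∀ n i j → Iso (⟦ decode i ⟧ ⊕ 0 ⊕ n) (⟦ decode j ⟧ ⊕ 0 ⊕ n) → BIso (⟦ decode i ⟧ ⊕ 0) (⟦ decode j ⟧ ⊕ 0)
      sep n i j = ⊕-zero-separated {⟦ decode i ⟧} {⟦ decode j ⟧} n (separated n (decode i) (decode j))

  -- With a single vertex in the first part, T is a matching between the other two parts.

  module Single (a1 : a ≡ 1) (b≤c : b ≤ c) where

    private
      all-equal : ∀ {n} → n ≡ 1 → (x x′ : Fin n) → x ≡ x′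
      all-equal refl zero zero = refl

      3≢1 : ∀ {n} → n ≡ 1 → n ≢ 3
      3≢1 refl ()

    no-flags : ∀ S z → E S z ≡ false
    no-flags S z = ¬true⇒false λ e → 3≢1 a1 (flag-a S e)

    diagonal : ℕ → Fin b → Fin c → Bool
    diagonal j y z = (toℕ y ≡ᵇ toℕ z) ∧ (toℕ y <ᵇ j)

    diagonal-true : ∀ {j y z} → diagonal j y z ≡ true → toℕ y ≡ toℕ z × toℕ y < j
    diagonal-true {j} {y} {z} p = let (p₁ , p₂) = ∧-true {toℕ y ≡ᵇ toℕ z} p in ≡ᵇ-true p₁ , <ᵇ-true {toℕ y} p₂

    true-diagonal : ∀ {j y z} → toℕ y ≡ toℕ z → toℕ y < j → diagonal j y z ≡ true
    true-diagonal p q = true-∧ (true-≡ᵇ p) (true-<ᵇ q)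

    canonical : ℕ → Config
    canonical j = config (λ _ → diagonal j) (λ _ → false) record
      { one-z = λ {x} {y} {z} {z′} p q → Finₚ.toℕ-injective
          (trans (sym (proj₁ (diagonal-true {j} {y} {z} p))) (proj₁ (diagonal-true {j} {y} {z′} q)))
      ; one-y = λ {x} {y} {y′} {z} p q → Finₚ.toℕ-injective
          (trans (proj₁ (diagonal-true {j} {y} {z} p)) (sym (proj₁ (diagonal-true {j} {y′} {z} q))))
      ; one-x = λ _ _ → all-equal a1 _ _
      ; flag-a = λ () ; flag-b = λ () ; flag-x = λ () ; flag-y = λ () }

    Matches : Config → ℕ → Set
    Matches S j = Σ (Fin b ↔ Fin b) λ α → Σ (Fin c ↔ Fin c) λ β →
      ∀ x y z → T S x y z ≡ diagonal j (Inverse.to α y) (Inverse.to β z)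

    -- Both ends of the new edge of the matching stand at positions at least `j`, because all
    -- earlier positions are matched already. Exchanging each end with position `j` extends the
    -- diagonal by one.
    matches-adds : ∀ {S S′ x y z j} → Adds S S′ x y z → Matches S j → j < b × Matches S′ (suc j)
    matches-adds {S} {S′} {x} {y} {z} {j} A (α , β , h) = j<b ,
      ↔-trans α (exchange-↔ y₁ yⱼ) , ↔-trans β (exchange-↔ z₁ zⱼ) , λ x′ y′ z′ → ≡true-ext (into x′ y′ z′) (outof x′ y′ z′)
      where
      open Adds A
      y₁ = Inverse.to α y
      z₁ = Inverse.to β z
      no-z : ∀ z′ → ¬ (T S x y z′ ≡ true)
      no-z z′ t = t≢f (subst (λ k → T S x y k ≡ true) (one-z S′ (keep t) added) t) fresh
      no-y : ∀ y′ → ¬ (T S x y′ z ≡ true)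
      no-y y′ t = t≢f (subst (λ k → T S x k z ≡ true) (one-y S′ (keep t) added) t) fresh
      j≤y : j ≤ toℕ y₁
      j≤y = ℕₚ.≮⇒≥ λ lt → no-z (Inverse.from β (inject≤ y₁ b≤c)) (trans (h x y _)
        (true-diagonal (sym (trans (cong toℕ (Inverse.strictlyInverseˡ β _)) (Finₚ.toℕ-inject≤ y₁ b≤c))) lt))
      j<b : j < b
      j<b = ℕₚ.≤-<-trans j≤y (Finₚ.toℕ<n y₁)
      j≤z : j ≤ toℕ z₁
      -- The bound `j < b`, just obtained from the other end, supplies the partner in the second
      -- part of a position below `j`.
      j≤z = ℕₚ.≮⇒≥ λ lt → let y′ = fromℕ< (ℕₚ.<-trans lt j<b) ; e = Finₚ.toℕ-fromℕ< (ℕₚ.<-trans lt j<b) in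
        no-y (Inverse.from α y′) (trans (h x _ z) (subst (λ u → diagonal j u z₁ ≡ true) (sym (Inverse.strictlyInverseˡ α y′))
          (true-diagonal e (subst (_< j) (sym e) lt))))
      yⱼ = fromℕ< j<b
      zⱼ = fromℕ< (ℕₚ.<-≤-trans j<b b≤c)
      eyⱼ : toℕ yⱼ ≡ j
      eyⱼ = Finₚ.toℕ-fromℕ< j<b
      ezⱼ : toℕ zⱼ ≡ j
      ezⱼ = Finₚ.toℕ-fromℕ< (ℕₚ.<-≤-trans j<b b≤c)
      τ = exchange y₁ yⱼ
      σ = exchange z₁ zⱼ
      τ-low : ∀ u → toℕ u < j → τ u ≡ u
      τ-low u lt = exchange-other (λ { refl → ℕₚ.<⇒≱ lt j≤y }) (λ { refl → ℕₚ.<⇒≢ lt eyⱼ })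
      σ-low : ∀ v → toℕ v < j → σ v ≡ v
      σ-low v lt = exchange-other (λ { refl → ℕₚ.<⇒≱ lt j≤z }) (λ { refl → ℕₚ.<⇒≢ lt ezⱼ })
      into : ∀ x′ y′ z′ → T S′ x′ y′ z′ ≡ true → diagonal (suc j) (τ (Inverse.to α y′)) (σ (Inverse.to β z′)) ≡ true
      into x′ y′ z′ t with split t
      ... | inj₂ (refl , refl , refl) = true-diagonal
              (trans (cong toℕ (exchange-left y₁ yⱼ)) (trans eyⱼ (sym (trans (cong toℕ (exchange-left z₁ zⱼ)) ezⱼ))))
              (s≤s (ℕₚ.≤-reflexive (trans (cong toℕ (exchange-left y₁ yⱼ)) eyⱼ)))
      ... | inj₁ s = let (e , lt) = diagonal-true {j} {Inverse.to α y′} {Inverse.to β z′} (trans (sym (h x′ y′ z′)) s) in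
              subst₂ (λ u v → diagonal (suc j) u v ≡ true) (sym (τ-low _ lt)) (sym (σ-low _ (subst (_< j) e lt)))
                (true-diagonal e (ℕₚ.m<n⇒m<1+n lt))
      to-inj : ∀ {n} (γ : Fin n ↔ Fin n) {p q : Fin n} → Inverse.to γ p ≡ Inverse.to γ q → p ≡ q
      to-inj γ {p} {q} r = trans (sym (Inverse.strictlyInverseʳ γ p)) (trans (cong (Inverse.from γ) r) (Inverse.strictlyInverseʳ γ q))
      undo : ∀ {n} {i k u w : Fin n} → exchange i k u ≡ w → u ≡ exchange i k w
      undo {i = i} {k} {u} e = trans (sym (exchange-involutive i k u)) (cong (exchange i k) e)
      outof : ∀ x′ y′ z′ → diagonal (suc j) (τ (Inverse.to α y′)) (σ (Inverse.to β z′)) ≡ true → T S′ x′ y′ z′ ≡ true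
      outof x′ y′ z′ d with diagonal-true {suc j} {τ (Inverse.to α y′)} {σ (Inverse.to β z′)} d
      ... | e , s≤s le with ℕₚ.m≤n⇒m<n∨m≡n le
      ... | inj₁ lt = keep (trans (h x′ y′ z′) (subst₂ (λ u v → diagonal j u v ≡ true)
              (sym (trans (undo refl) (τ-low _ lt))) (sym (trans (undo refl) (σ-low _ (subst (_< j) e lt)))) (true-diagonal e lt)))
      ... | inj₂ eq = subst₂ (λ u v → T S′ x′ u v ≡ true) (sym y′≡y) (sym z′≡z)
                        (subst (λ k → T S′ k y z ≡ true) (all-equal a1 x x′) added)
        where
        y′≡y : y′ ≡ y
        y′≡y = to-inj α (trans (undo {w = yⱼ} (Finₚ.toℕ-injective (trans eq (sym eyⱼ)))) (exchange-right y₁ yⱼ))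
        z′≡z : z′ ≡ z
        z′≡z = to-inj β (trans (undo {w = zⱼ} (Finₚ.toℕ-injective (trans (sym e) (trans eq (sym ezⱼ))))) (exchange-right z₁ zⱼ))

    matches-restrict : ∀ S k → ∃ λ j → j ≤ b × Matches (restrict S k) j
    matches-restrict S zero = 0 , z≤n , ↔-refl , ↔-refl , λ x y z → trans (sym (restrict-zero S x y z))
      (sym (¬true⇒false λ p → ℕₚ.n≮0 (proj₂ (diagonal-true {0} {y} {z} p))))
    matches-restrict S (suc k) = extend (restrict-step S k) (matches-restrict S k)
      where
      extend : (∃ λ x → ∃ λ y → ∃ λ z → Adds (restrict S k) (restrict S (suc k)) x y z) ⊎
        (∀ x y z → T (restrict S k) x y z ≡ T (restrict S (suc k)) x y z) →
        (∃ λ j → j ≤ b × Matches (restrict S k) j) → ∃ λ j → j ≤ b × Matches (restrict S (suc k)) j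
      extend (inj₁ (_ , _ , _ , A)) (j , _ , m) = suc j , matches-adds A m
      extend (inj₂ e) (j , j≤b , α , β , h) = j , j≤b , α , β , λ x y z → trans (sym (e x y z)) (h x y z)

    canonical-form : ∀ S → ∃ λ j → j ≤ b × BIso ⟦ S ⟧ ⟦ canonical j ⟧
    canonical-form S = let (j , j≤b , α , β , h) = matches-restrict S (a * (b * c)) in
      j , j≤b , relabel S (canonical j) α β (λ x y z → trans (sym (restrict-all S x y z)) (h x y z)) (no-flags S)

    canonical-vertices : ∀ {j} → j ≤ b → Vertex (canonical j) ↔ (Fin a ⊎ (Fin b ⊎ (Fin c ⊎ Fin j)))
    canonical-vertices {j} j≤b = mk↔ₛ′
      (λ { (pa x) → inj₁ x ; (pb y) → inj₂ (inj₁ y) ; (pc z _) → inj₂ (inj₂ (inj₁ z))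
         ; (pt x y z q) → inj₂ (inj₂ (inj₂ (fromℕ< (proj₂ (diagonal-true {j} {y} {z} q))))) })
      (λ { (inj₁ x) → pa x ; (inj₂ (inj₁ y)) → pb y ; (inj₂ (inj₂ (inj₁ z))) → pc z refl
         ; (inj₂ (inj₂ (inj₂ k))) → pt x₀ (inject≤ k j≤b) (inject≤ k j≤c) (on k) })
      (λ { (inj₁ x) → refl ; (inj₂ (inj₁ y)) → refl ; (inj₂ (inj₂ (inj₁ z))) → refl
         ; (inj₂ (inj₂ (inj₂ k))) → cong (inj₂ ∘ inj₂ ∘ inj₂) (Finₚ.toℕ-injective
             (trans (Finₚ.toℕ-fromℕ< _) (Finₚ.toℕ-inject≤ k j≤b))) })
      (λ { (pa x) → refl ; (pb y) → refl ; (pc z _) → pc-≡ refl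
         ; (pt x y z q) → pt-≡ (all-equal a1 _ _)
             (Finₚ.toℕ-injective (trans (Finₚ.toℕ-inject≤ _ j≤b) (Finₚ.toℕ-fromℕ< _)))
             (Finₚ.toℕ-injective (trans (Finₚ.toℕ-inject≤ _ j≤c) (trans (Finₚ.toℕ-fromℕ< _) (proj₁ (diagonal-true {j} {y} {z} q))))) })
      where
      j≤c = ℕₚ.≤-trans j≤b b≤c
      x₀ : Fin a
      x₀ = Fin.cast (sym a1) zero
      on : ∀ k → diagonal j (inject≤ k j≤b) (inject≤ k j≤c) ≡ true
      on k = true-diagonal (trans (Finₚ.toℕ-inject≤ k j≤b) (sym (Finₚ.toℕ-inject≤ k j≤c)))
        (subst (_< j) (sym (Finₚ.toℕ-inject≤ k j≤b)) (Finₚ.toℕ<n k))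

    single-separated : ∀ n S S′ → Iso (⟦ S ⟧ ⊕ n) (⟦ S′ ⟧ ⊕ n) → BIso ⟦ S ⟧ ⟦ S′ ⟧
    single-separated n S S′ = compare (canonical-form S) (canonical-form S′)
      where
      size-at : ℕ → ℕ
      size-at j = a + (b + (c + j))
      vertices : ∀ j → j ≤ b → Vertex (canonical j) ↔ Fin (a + (b + (c + j)))
      vertices j j≤b = ↔-trans (canonical-vertices j≤b)
        (proj₂ (finite-⊎ (a , ↔-refl) (finite-⊎ (b , ↔-refl) (finite-⊎ (c , ↔-refl) (j , ↔-refl)))))
      compare : (∃ λ j → j ≤ b × BIso ⟦ S ⟧ ⟦ canonical j ⟧) → (∃ λ j → j ≤ b × BIso ⟦ S′ ⟧ ⟦ canonical j ⟧) →
        Iso (⟦ S ⟧ ⊕ n) (⟦ S′ ⟧ ⊕ n) → BIso ⟦ S ⟧ ⟦ S′ ⟧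
      compare (i , i≤b , φ) (j , j≤b , ψ) = size-separated (λ k → ⟦ canonical k ⟧) size-at
        (λ e → ℕₚ.+-cancelˡ-≡ c _ _ (ℕₚ.+-cancelˡ-≡ b _ _ (ℕₚ.+-cancelˡ-≡ a _ _ e)))
        {⟦ S ⟧} {⟦ S′ ⟧} n i j (vertices i i≤b) (vertices j j≤b) φ ψ

-- Assembling the cases

single-family : ∀ b c → 4 ≤ b ⊎ b ≡ 1 → 4 ≤ c → b ≤ c → ∃ λ k → ∀ n → FamilySize (K 1 b (c + n)) k
single-family b c o 4≤c b≤c = ordinary-family
  ([ inj₁ , (λ b1 → inj₂ (inj₂ (refl , b1))) ]′ o) 4≤c (subst (_≤ c) (sym (ℕₚ.*-identityˡ b)) b≤c) (single-separated refl b≤c)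
  where
  open Tripartite 1 b c
  open Single

plural-family : ∀ a b c → 4 ≤ b ⊎ (a ≡ 3 × b ≡ 3) → 2 ≤ a → 4 ≤ c → a * b ≤ c → a + b < c → ∃ λ k → ∀ n → FamilySize (K a b (c + n)) k
plural-family a b c o 2≤a 4≤c ab≤c D<c = ordinary-family ([ inj₁ , inj₂ ∘ inj₁ ]′ o) 4≤c ab≤c
  (λ n S S′ → graded-separated (graded 2≤a D<c S) (graded 2≤a D<c S′) n)
  where open Tripartite a b c

-- This places the degree threshold `a + b` strictly below `d`, as `graded` requires.
sum<product : ∀ a b → (2 + a) + (4 + b) < (2 + a) * (4 + b)
sum<product a b = subst ((2 + a) + (4 + b) <_) (sym (identity a b)) (ℕₚ.m<m+n _ (s≤s z≤n))
  where
  open +-*-Solver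
  identity : ∀ a b → (2 + a) * (4 + b) ≡ (2 + a) + (4 + b) + suc (1 + b + (3 * a + a * b))
  identity = solve 2 (λ a b → (con 2 :+ a) :* (con 4 :+ b) :=
    (con 2 :+ a) :+ (con 4 :+ b) :+ (con 1 :+ (con 1 :+ b :+ (con 3 :* a :+ a :* b)))) refl

-- For the three listed pairs `4 ⊔ (a * b)` evaluates to 4, 4 and 6, the `free` entry of the first
-- code of the list; for `a = b = 3` it evaluates to 9.
families : ∀ a b → 1 ≤ a → a ≤ b → ¬ (a ≡ 1 × b ≡ 2) → ∃ λ k → ∀ n → FamilySize (K a b (4 ⊔ (a * b) + n)) k
families 1 1 _ _ _ = single-family 1 4 (inj₂ refl) ℕₚ.≤-refl (s≤s z≤n)
families 1 2 _ _ n = ⊥-elim (n (refl , refl))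
families 1 3 _ _ _ = family-1-3
families 1 b@(suc (suc (suc (suc b′)))) _ _ _ = single-family b (4 ⊔ (1 * b)) (inj₁ (s≤s (s≤s (s≤s (s≤s z≤n)))))
  (ℕₚ.m≤m⊔n 4 (1 * b)) (ℕₚ.≤-trans (ℕₚ.≤-reflexive (sym (ℕₚ.*-identityˡ b))) (ℕₚ.m≤n⊔m 4 (1 * b)))
families 2 2 _ _ _ = family-2-2
families 2 3 _ _ _ = family-2-3
families 3 3 _ _ _ = plural-family 3 3 9 (inj₂ (refl , refl)) (s≤s (s≤s z≤n)) (ℕₚ.≤ᵇ⇒≤ 4 9 _) ℕₚ.≤-refl (ℕₚ.≤ᵇ⇒≤ 7 9 _)
families a@(suc (suc a′)) b@(suc (suc (suc (suc b′)))) _ _ _ = plural-family a b (4 ⊔ (a * b)) (inj₁ (s≤s (s≤s (s≤s (s≤s z≤n)))))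
  (s≤s (s≤s z≤n)) (ℕₚ.m≤m⊔n 4 (a * b)) (ℕₚ.m≤n⊔m 4 (a * b)) (ℕₚ.<-≤-trans (sum<product a′ b′) (ℕₚ.m≤n⊔m 4 (a * b)))
families (suc (suc _)) 1 _ (s≤s ()) _
families (suc (suc (suc _))) 2 _ (s≤s (s≤s ())) _
families (suc (suc (suc (suc _)))) 3 _ (s≤s (s≤s (s≤s ()))) _

theorem2 : (a b c : ℕ) → 1 ≤ a → a ≤ b → b ≤ c → ¬ (a ≡ 1 × b ≡ 2) →
    4 ⊔ (a * b) ≤ c →
    ∃ λ k → FamilySize (K a b c) k × FamilySize (K a b (4 ⊔ (a * b))) k
theorem2 a b c 1≤a a≤b b≤c n d≤c = let (k , family) = families a b 1≤a a≤b n in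
  k , subst (λ m → FamilySize (K a b m) k) (ℕₚ.m+[n∸m]≡n d≤c) (family (c ∸ (4 ⊔ (a * b)))) ,
  subst (λ m → FamilySize (K a b m) k) (ℕₚ.+-identityʳ _) (family 0)
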